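{- Let $F$ be a matching of size $k$ in a graph $G$, let $t \ge 0$ be an integer, and let $\mathcal{A}=(A_1,\ldots,A_m)$ be a family of sets of edges of $G$ such that for any $t+1$ distinct indices $i_1,\ldots,i_{t+1}$, the set $A_{i_1}\cup\cdots\cup A_{i_{t+1}}$ contains (as a subset) an $F$-augmenting alternating path. Let $J=\{j : A_j \subseteq F\}$. If there is no $\mathcal{A}$-rainbow $F$-augmenting alternating path, then (1) $m \le 2k+t$, and (2) if $m = 2k+t$, then $|J| = t$ and the $2k$ sets $A_j$, $j \notin J$, form a generalized $k$-badge.
   Context: Paths are identified with their edge sets. Given a matching $F$, a simple path is $F$-alternating if every other edge of it belongs to $F$; an $F$-augmenting alternating path ($F$-AAP) is an $F$-alternating path both of whose endpoints are not covered by $F$ (so its first and last edges are not in $F$). For an indexed family $\mathcal{S}=(S_1,\ldots,S_m)$ of edge sets, a set $X$ is $\mathcal{S}$-rainbow if there is an injective map $\phi: X \to \{1,\ldots,m\}$ with $x \in S_{\phi(x)}$ for all $x\in X$; an $F$-AAP (in $G$) is $\mathcal{S}$-rainbow if its set of non-$F$ edges is $\mathcal{S}$-rainbow. For $m \ge 1$, an $m$-origamistrip $OS$ with endpoints $x,y$ is a graph on distinct vertices $u_1,\ldots,u_m,v_1,\ldots,v_m,x,y$ whose edge set is the union of the disjoint matchings $M(OS)=\{u_1v_1,\ldots,u_mv_m\}$ (the skeleton), $A(OS)=\{xu_1, v_1u_2, \ldots, v_{m-1}u_m, v_my\}$ and $B(OS)=\{xv_1, u_1v_2, \ldots, u_{m-1}v_m,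 u_my\}$; the $u_i,v_i$ are its interior vertices. Let $P^A(OS)=A(OS)\cup M(OS)$, $P^B(OS)=B(OS)\cup M(OS)$. A badge is a family of paths obtained from a loopless multigraph $H$ and a positive integer weighting $w$ of $E(H)$: for each edge $e=xy$ of $H$ take a $w(e)$-origamistrip $OS(e)$ with endpoints $x,y$, the interior vertex sets of the different $OS(e)$ being pairwise disjoint and disjoint from $V(H)$; the badge consists of $P^A(OS(e))$ and $P^B(OS(e))$, each repeated $w(e)$ times, over all $e \in E(H)$. Its skeleton is $M(\mathcal{B})=\bigcup_e M(OS(e))$ and it is a $k$-badge where $k=\sum_e w(e)$. A generalized $k$-badge is a family obtained from a $k$-badge $\mathcal{B}$ by replacing each member $P$ by a set of the form $(P\setminus X)\cup Y$ with $X, Y \subseteq M(\mathcal{B})$ (i.e., arbitrarily adding and deleting skeleton edges in each member). -}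

module Defs where

open import Data.Nat using (ℕ; zero; suc; _+_; _*_; _≤_)
open import Data.Fin using (Fin; zero; suc; inject₁; fromℕ)
open import Data.Bool using (Bool; true; false; if_then_else_)
open import Data.List using (map; allFin)
open import Data.Nat.ListAction using (sum)
open import Data.Product using (Σ; ∃; ∃-syntax; _×_; _,_; proj₁; proj₂)
open import Data.Sum using (_⊎_)
open import Relation.Nullary using (¬_)
open import Relation.Binary.PropositionalEquality using (_≡_; _≢_)
open import Function.Definitions using (Injective)

-- Vertices are Fin n (a finite graph on n vertices).
-- A set of edges is represented by a relation on vertices; the
-- unordered edge {x,y} belongs to S iff S x y or S y x.  All notions
-- below are defined only through this (symmetric) membership.

EdgeSet : ℕ → Set₁
EdgeSet n = Fin n → Fin n → Set

module _ {n : ℕ} where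

  Vtx : Set
  Vtx = Fin n

  _∈ₑ_ : Vtx × Vtx → EdgeSet n → Set
  (x , y) ∈ₑ S = S x y ⊎ S y x

  _≈ₑ_ : Vtx × Vtx → Vtx × Vtx → Set
  (a , b) ≈ₑ (c , d) = (a ≡ c × b ≡ d) ⊎ (a ≡ d × b ≡ c)

  _⊆ₑ_ : EdgeSet n → EdgeSet n → Set
  S ⊆ₑ T = ∀ x y → (x , y) ∈ₑ S → (x , y) ∈ₑ T

  _≐ₑ_ : EdgeSet n → EdgeSet n → Set
  S ≐ₑ T = (S ⊆ₑ T) × (T ⊆ₑ S)

  _∪ₑ_ : EdgeSet n → EdgeSet n → EdgeSet n
  (S ∪ₑ T) x y = S x y ⊎ T x y

  _∖ₑ_ : EdgeSet n → EdgeSet n → EdgeSet n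
  (S ∖ₑ T) x y = S x y × ¬ ((x , y) ∈ₑ T)

  ⋃ₑ : ∀ {m r} → (Fin r → Fin m) → (Fin m → EdgeSet n) → EdgeSet n
  ⋃ₑ ι A x y = ∃[ q ] A (ι q) x y

record Graph (n : ℕ) : Set₁ where
  field
    E        : EdgeSet n
    loopless : ∀ x → ¬ ((x , x) ∈ₑ E)

open Graph public

module _ {n : ℕ} where

  IsMatching : Graph n → EdgeSet n → Set
  IsMatching G F =
    (F ⊆ₑ E G) ×
    (∀ x y z → (x , y) ∈ₑ F → (x , z) ∈ₑ F → y ≡ z)

  HasSize : EdgeSet n → ℕ → Set
  HasSize F k =
    Σ (Fin k → Fin n × Fin n) λ es →
      (∀ r → es r ∈ₑ F) ×
      (∀ r s → es r ≈ₑ es s → r ≡ s) ×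
      (∀ x y → (x , y) ∈ₑ F → ∃[ r ] (es r ≈ₑ (x , y)))

  Covered : EdgeSet n → Fin n → Set
  Covered F v = ∃[ u ] ((v , u) ∈ₑ F)

-- F-augmenting alternating paths in G.
-- A path is a sequence of distinct vertices vs 0 , … , vs L with
-- L = suc len ≥ 1 edges; its i-th edge is {vs i , vs (i+1)}.

record AAP {n : ℕ} (G : Graph n) (F : EdgeSet n) : Set where
  field
    len : ℕ
    vs  : Fin (suc (suc len)) → Fin n
  edge : Fin (suc len) → Fin n × Fin n
  edge i = vs (inject₁ i) , vs (suc i)
  field
    simple      : Injective _≡_ _≡_ vs
    inG         : ∀ i → edge i ∈ₑ E G
    alternating : ∀ (i : Fin len) →
                    (edge (inject₁ i) ∈ₑ F → ¬ (edge (suc i) ∈ₑ F)) ×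
                    (¬ (edge (inject₁ i) ∈ₑ F) → edge (suc i) ∈ₑ F)
    startFree   : ¬ Covered F (vs zero)
    endFree     : ¬ Covered F (vs (fromℕ (suc len)))

module _ {n : ℕ} {G : Graph n} {F : EdgeSet n} where

  _⊆Path_ : AAP G F → EdgeSet n → Set
  P ⊆Path S = ∀ i → AAP.edge P i ∈ₑ S

  -- the set of non-F edges of P is 𝒜-rainbow (edges of a simple path
  -- are identified with their positions, which are pairwise distinct
  -- as edges)
  IsRainbow : ∀ {m} → (Fin m → EdgeSet n) → AAP G F → Set
  IsRainbow {m} A P =
    Σ (Fin (suc (AAP.len P)) → Fin m) λ φ →
      (∀ i → ¬ (AAP.edge P i ∈ₑ F) → AAP.edge P i ∈ₑ A (φ i)) ×
      (∀ i j → ¬ (AAP.edge P i ∈ₑ F) → ¬ (AAP.edge P j ∈ₑ F) →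
               φ i ≡ φ j → i ≡ j)

-- Badges.
-- H is a loopless multigraph with edges indexed by Fin h, edge e having
-- endpoints ends e; its weight is weight e = suc (w₀ e) (positive).
-- The origamistrip OS(e) has interior vertices u e i , v e i
-- (i : Fin (weight e)), i.e. u₁…u_w , v₁…v_w of the paper (0-indexed).

record Badge (n : ℕ) : Set where
  field
    h        : ℕ
    ends     : Fin h → Fin n × Fin n
    loopless : ∀ e → proj₁ (ends e) ≢ proj₂ (ends e)
    w₀       : Fin h → ℕ
  weight : Fin h → ℕ
  weight e = suc (w₀ e)
  field
    u v : (e : Fin h) → Fin (weight e) → Fin n
  interior : (Σ (Fin h) λ e → Bool × Fin (weight e)) → Fin n
  interior p = if proj₁ (proj₂ p) then u (proj₁ p) (proj₂ (proj₂ p))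
                                  else v (proj₁ p) (proj₂ (proj₂ p))
  field
    interiorDistinct : Injective _≡_ _≡_ interior
    interiorOutside  : ∀ p e → interior p ≢ proj₁ (ends e)
                              × interior p ≢ proj₂ (ends e)
  size : ℕ
  size = sum (map weight (allFin h))

  Mₑ : Fin h → EdgeSet n
  Mₑ e a b = ∃[ i ] (a ≡ u e i × b ≡ v e i)

  Aₑ : Fin h → EdgeSet n
  Aₑ e a b =
      (a ≡ proj₁ (ends e) × b ≡ u e zero)
    ⊎ (∃[ i ] (a ≡ v e (inject₁ i) × b ≡ u e (suc i)))
    ⊎ (a ≡ v e (fromℕ (w₀ e)) × b ≡ proj₂ (ends e))

  Bₑ : Fin h → EdgeSet n
  Bₑ e a b =
      (a ≡ proj₁ (ends e) × b ≡ v e zero)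
    ⊎ (∃[ i ] (a ≡ u e (inject₁ i) × b ≡ v e (suc i)))
    ⊎ (a ≡ u e (fromℕ (w₀ e)) × b ≡ proj₂ (ends e))

  PA PB : Fin h → EdgeSet n
  PA e = Aₑ e ∪ₑ Mₑ e
  PB e = Bₑ e ∪ₑ Mₑ e

  skeleton : EdgeSet n
  skeleton a b = ∃[ e ] Mₑ e a b

  -- members of the badge: P^A(OS e) and P^B(OS e), each w(e) times
  Index : Set
  Index = Σ (Fin h) λ e → Bool × Fin (weight e)

  member : Index → EdgeSet n
  member (e , true  , _) = PA e
  member (e , false , _) = PB e

IsGenBadge : ∀ {n m} → ℕ → (Fin m → EdgeSet n) → (Fin m → Set) → Set₁
IsGenBadge {n} {m} k A sel =
  Σ (Badge n) λ 𝓑 →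
    (Badge.size 𝓑 ≡ k) ×
    Σ (Badge.Index 𝓑 → Fin m) λ β →
      Injective _≡_ _≡_ β ×
      (∀ b → sel (β b)) ×
      (∀ j → sel j → ∃[ b ] (β b ≡ j)) ×
      (∀ b → Σ (EdgeSet n) λ X → Σ (EdgeSet n) λ Y →
               (X ⊆ₑ Badge.skeleton 𝓑) × (Y ⊆ₑ Badge.skeleton 𝓑) ×
               (A (β b) ≐ₑ ((Badge.member 𝓑 b ∖ₑ X) ∪ₑ Y)))

CountIs : ∀ {m} → (Fin m → Set) → ℕ → Set
CountIs {m} sel t =
  Σ (Fin t → Fin m) λ ι →
    Injective _≡_ _≡_ ι × (∀ r → sel (ι r)) × (∀ j → sel j → ∃[ r ] (ι r ≡ j))

{-# OPTIONS --safe #-}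
module Submission where

-- Grow stars root – leaf = tip (an edge of a new colour from an uncovered root, then the
-- matching edge) as long as possible.  Deleting roots and leaves turns the tips into
-- uncovered vertices of a smaller instance, where induction gives a rainbow path between
-- two tips.  Prolonged through its stars it is a rainbow path of the original instance, or
-- an odd cycle through a common root with fewer colours than covered vertices; the growth
-- can only fail at a triangle, two colours c and d joining an uncovered x to both ends of
-- a matching edge uv.  In an odd cycle through x every vertex is reached from x by a
-- rainbow alternating path, so rainbow paths lift from its contraction to x.  Counting
-- colours gives m ≤ 2k + t.
--
-- If m = 2k + t only the triangle is left.  By induction its contraction carries a badge
-- on the colours other than c and d.  Either every colour of a strip at x still leaves x
-- directly, and then x, u, v, y is a new strip of width 1 for some y, or some colour runs
-- x u v z …; then so do all colours on its side of its strip, those on the other side run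
-- x v u (mate z) …, and u, v prolong this strip by one.  Any further edge of a colour
-- would complete a rainbow path.

open import Data.Bool using (Bool; true; false; if_then_else_)
open import Data.Empty using (⊥; ⊥-elim)
open import Data.Fin using (Fin; zero; suc; inject₁; fromℕ; inject≤; cast)
import Data.Fin.Properties as Fin
open import Data.List using (List; []; _∷_; _++_; length; filter; map; allFin; reverse; take; drop; lookup)
import Data.List.Properties as List
open import Data.List.Membership.DecPropositional using () renaming (_∈?_ to mem?)
open import Data.List.Membership.Propositional using (_∈_; _∉_)
import Data.List.Membership.Propositional.Properties as ∈
open import Data.List.Relation.Binary.Permutation.Propositional using (_↭_; ↭-refl; ↭-sym; ↭-trans; prep)
import Data.List.Relation.Binary.Permutation.Propositional as ↭
import Data.List.Relation.Binary.Permutation.Propositional.Properties as ↭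
import Data.List.Relation.Binary.Permutation.Setoid.Properties as ↭S
open import Data.List.Relation.Binary.Sublist.Propositional using (_⊆_; []; _∷_; _∷ʳ_)
import Data.List.Relation.Binary.Sublist.Propositional as Sublist
open import Data.List.Relation.Unary.All using (All; []; _∷_)
import Data.List.Relation.Unary.All as All
import Data.List.Relation.Unary.All.Properties as AllP
open import Data.List.Relation.Unary.Any using (here; there; index)
import Data.List.Relation.Unary.Any.Properties as Any
open import Data.List.Relation.Unary.Unique.Propositional using (Unique; []; _∷_)
import Data.List.Relation.Unary.Unique.Propositional.Properties as Unique
open import Data.Nat using (ℕ; zero; suc; _+_; _*_; _≤_; _<_; z≤n; s≤s)
open import Data.Nat.ListAction using (sum)
import Data.Nat.Properties as ℕ
open import Data.Nat.Solver using (module +-*-Solver)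
open +-*-Solver using (solve; _:+_; _:*_; _:=_; con)
open import Data.Product using (Σ; ∃-syntax; _×_; _,_; proj₁; proj₂)
open import Data.Sum using (_⊎_; inj₁; inj₂; [_,_]′; swap)
open import Function.Definitions using (Injective)
open import Relation.Binary.PropositionalEquality using (_≡_; _≢_; refl; sym; trans; cong; cong₂; subst; subst₂; setoid; module ≡-Reasoning)
open import Relation.Nullary using (¬_; Dec; yes; no; ¬?; _⊎-dec_)
open import Relation.Unary using (Decidable)
open import Defs using (EdgeSet; _∈ₑ_; _≈ₑ_; _⊆ₑ_; _∖ₑ_; _∪ₑ_; ⋃ₑ; Graph; E; loopless; IsMatching; HasSize; Covered; AAP; _⊆Path_; IsRainbow; Badge; IsGenBadge; CountIs)

-- The induction is steered by the number of colours minus the number of covered vertices, and each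
-- reduction has its own balance. A star takes away one colour and two covered vertices, so a single
-- star turns a weak inequality into the strict one that the residual instance needs. The odd cycles
-- closed through stars also have fewer colours than covered vertices. A triangle has two of each
-- and gains nothing; hence it alone remains when m = 2k + t, and there the structure must be
-- carried through the contraction. The obstacle is that the badge of the contraction shows edges
-- only up to identifying x, u and v: an edge at x may come from any of the three corners, and edges
-- inside the triangle are invisible. It is resolved by the t pure colours, whose edges are matching
-- edges. Any further colour must contain an augmenting path together with them, and this path is
-- then monochromatic. So each colour crosses the graph on its own from one uncovered vertex to
-- another, which forces where it meets the triangle and, for c and d, that it contains its whole
-- side of the strip.

module _ where

  -- Lists without repetitions

  private variable
    X : Set
    x y : X
    xs ys zs : List X

  Unique-↭ : {X : Set} {xs ys : List X} → xs ↭ ys → Unique xs → Unique ys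
  Unique-↭ p = ↭S.Unique-resp-↭ (setoid _) (↭.↭⇒↭ₛ p)

  Unique-∷ : x ∉ xs → Unique xs → Unique (x ∷ xs)
  Unique-∷ x∉ u = AllP.¬Any⇒All¬ _ x∉ ∷ u

  Unique-++ : Unique xs → Unique ys → (∀ {z} → z ∈ xs → z ∉ ys) → Unique (xs ++ ys)
  Unique-++ u w d = Unique.++⁺ u w λ (p , q) → d p q

  Unique-++⁻ : ∀ (xs : List X) {ys} → Unique (xs ++ ys) →
               Unique xs × Unique ys × (∀ {z} → z ∈ xs → z ∉ ys)
  Unique-++⁻ []       u       = [] , u , λ ()
  Unique-++⁻ (x ∷ xs) (a ∷ u) with Unique-++⁻ xs u
  ... | u₁ , u₂ , d = AllP.++⁻ˡ xs a ∷ u₁ , u₂ , λ where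
    (here refl) q → All.lookup (AllP.++⁻ʳ xs a) q refl
    (there p)   q → d p q

  ∉-head : Unique (x ∷ xs) → x ∉ xs
  ∉-head = Unique.Unique[x∷xs]⇒x∉xs

  pair-unique : x ≢ y → Unique (x ∷ y ∷ [])
  pair-unique ne = (ne ∷ []) ∷ [] ∷ []

  remove : x ∈ xs → ∃[ ys ] (xs ↭ x ∷ ys)
  remove p with ∈.∈-∃++ p
  ... | as , bs , refl = as ++ bs , ↭.shift _ as bs

  remove₂ : x ∈ xs → y ∈ xs → x ≢ y → ∃[ ys ] (xs ↭ x ∷ y ∷ ys)
  remove₂ p q x≢y with remove p
  ... | ys , e with ↭.∈-resp-↭ e q
  ... | here y≡x = ⊥-elim (x≢y (sym y≡x))
  ... | there q′ with remove q′
  ... | zs , e′ = zs , ↭-trans e (prep _ e′)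

  ∈-∷⁻ : ∀ {z : X} → z ∈ x ∷ xs → (z ≡ x) ⊎ (z ∈ xs)
  ∈-∷⁻ (here e)  = inj₁ e
  ∈-∷⁻ (there p) = inj₂ p

  ∈-[] : {P : Set} {z : X} → z ∈ [] → P
  ∈-[] ()

  infixr 5 _∷⊑_ _∷#_ _∷∉_

  _∷⊑_ : x ∈ ys → (∀ {z} → z ∈ xs → z ∈ ys) → ∀ {z} → z ∈ x ∷ xs → z ∈ ys
  (p ∷⊑ f) (here refl) = p
  (p ∷⊑ f) (there i)   = f i

  _∷#_ : x ∉ ys → (∀ {z} → z ∈ xs → z ∉ ys) → ∀ {z} → z ∈ x ∷ xs → z ∉ ys
  (p ∷# f) (here refl) = p
  (p ∷# f) (there i)   = f i

  _∷∉_ : ∀ {z : X} → z ≢ x → z ∉ xs → z ∉ x ∷ xs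
  (p ∷∉ f) (here e)  = p e
  (p ∷∉ f) (there i) = f i

  swap₂ : ∀ {z} → z ∈ x ∷ y ∷ [] → z ∈ y ∷ x ∷ []
  swap₂ = there (here refl) ∷⊑ here refl ∷⊑ ∈-[]

  length-⊆ : Unique xs → (∀ {z} → z ∈ xs → z ∈ ys) → length xs ≤ length ys
  length-⊆ []          _ = z≤n
  length-⊆ {xs = x ∷ xs} {ys = ys} u@(_ ∷ u′) f with remove (f (here refl))
  ... | zs , e = subst (suc (length xs) ≤_) (sym (↭.↭-length e)) (s≤s (length-⊆ u′ g))
    where
    g : ∀ {z} → z ∈ xs → z ∈ zs
    g p with ↭.∈-resp-↭ e (f (there p))
    ... | here refl = ⊥-elim (∉-head u p)
    ... | there q   = q

  split-off : ∀ (es : List X) {cs} → Unique es → (∀ {z} → z ∈ es → z ∈ cs) → ∃[ ds ] (cs ↭ es ++ ds)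
  split-off []       {cs} _ _ = cs , ↭-refl
  split-off (e ∷ es) {cs} u@(_ ∷ u′) s with remove (s (here refl))
  ... | cs′ , σ with split-off es u′ (λ i → [ (λ { refl → ⊥-elim (∉-head u i) }) , (λ j → j) ]′ (∈-∷⁻ (↭.∈-resp-↭ σ (s (there i)))))
  ... | ds , τ = ds , ↭-trans σ (prep e τ)

  inhabited : 0 < length xs → ∃[ x ] x ∈ xs
  inhabited {xs = x ∷ _} _ = x , here refl

  filter-⊆ : ∀ {P : X → Set} (P? : Decidable P) (xs : List X) → filter P? xs ⊆ xs
  filter-⊆ P? []       = []
  filter-⊆ P? (x ∷ xs) with P? x
  ... | yes _ = refl ∷ filter-⊆ P? xs
  ... | no  _ = x ∷ʳ filter-⊆ P? xs

  -- Replaces a case distinction on Rich, which is undecidable: whether an edge belongs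
  -- to a colour is not assumed decidable.
  sublist-choice : ∀ {P : List X → Set} {Q : Set} (xs : List X) →
                   (∀ ys → ys ⊆ xs → P ys ⊎ Q) → (∀ ys → ys ⊆ xs → P ys) ⊎ Q
  sublist-choice {P = P} [] f with f [] []
  ... | inj₁ p = inj₁ λ { [] [] → p }
  ... | inj₂ q = inj₂ q
  sublist-choice {P = P} (x ∷ xs) f
    with sublist-choice {P = P} xs (λ ys s → f ys (x ∷ʳ s))
       | sublist-choice {P = λ ys → P (x ∷ ys)} xs (λ ys s → f (x ∷ ys) (refl ∷ s))
  ... | inj₂ q | _      = inj₂ q
  ... | inj₁ _ | inj₂ q = inj₂ q
  ... | inj₁ g | inj₁ h = inj₁ λ where
    ys        (.x ∷ʳ s)  → g ys s
    (.x ∷ ys) (refl ∷ s) → h ys s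

-- Alternating walks, augmenting paths and blossoms

_⊑_ : {X : Set} → List X → List X → Set
xs ⊑ ys = ∀ {z} → z ∈ xs → z ∈ ys

-- The matching is encoded by the involution exchanging the two ends of each of
-- its edges and fixing the uncovered vertices.
record System (n m : ℕ) : Set₁ where
  field
    mate     : Fin n → Fin n
    mate²    : ∀ v → mate (mate v) ≡ v
    edge     : Fin m → Fin n → Fin n → Set
    edge-sym : ∀ {c a b} → edge c a b → edge c b a

module Alternating {n m : ℕ} (𝒮 : System n m) where
  open System 𝒮 public

  private
    V = Fin n
    C = Fin m

  Free : V → Set
  Free v = mate v ≡ v

  Free? : Decidable Free
  Free? v = mate v Fin.≟ v

  -- Alternating walks from r ending with a matching edge; the indices record the
  -- end, the colours of the non-matching edges and the vertices other than r.
  data Walk (r : V) : V → List C → List V → Set where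
    here : Walk r r [] []
    step : ∀ {p q q′ c cs vs} → Walk r p cs vs → edge c p q → q′ ≡ mate q →
           Walk r q′ (c ∷ cs) (q ∷ q′ ∷ vs)

  -- That `x` and `y` differ from the vertices in `vs` is automatic: they are free, and a simple
  -- walk visits only covered vertices after its start. Colours may repeat; they are listed up to
  -- order so that a reversed path has the same list.
  record Augmenting (x y : V) (es : List C) : Set where
    field
      {end}   : V
      {c}     : C
      {cs}    : List C
      {vs}    : List V
      colours : es ↭ c ∷ cs
      walk    : Walk x end cs vs
      last    : edge c end y
      x-free  : Free x
      y-free  : Free y
      x≢y     : x ≢ y
      simple  : Unique vs

  AugmentingIn : List C → Set
  AugmentingIn ds = ∃[ x ] ∃[ y ] ∃[ es ] (Augmenting x y es × es ⊑ ds)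

  Rainbow : List C → Set
  Rainbow ds = ∃[ x ] ∃[ y ] ∃[ es ] (Augmenting x y es × es ⊑ ds × Unique es)

  Rich : ℕ → List C → Set
  Rich t cs = ∀ ds → Unique ds → ds ⊑ cs → t < length ds → AugmentingIn ds

  Rich-⊑ : ∀ {t cs ds} → ds ⊑ cs → Rich t cs → Rich t ds
  Rich-⊑ s h es u s′ = h es u (λ p → s (s′ p))

  -- The indices `es` and `zs` are budgets: two walks with disjoint budgets can be joined, whatever
  -- they use of them.
  record Reach (r z : V) (es : List C) (zs : List V) : Set where
    field
      {cs}   : List C
      {vs}   : List V
      walk   : Walk r z cs vs
      cs!    : Unique cs
      vs!    : Unique vs
      cs⊑    : cs ⊑ es
      vs⊑    : vs ⊑ zs

  mate-injective : ∀ {a b} → mate a ≡ mate b → a ≡ b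
  mate-injective e = trans (sym (mate² _)) (trans (cong mate e) (mate² _))

  edge-≡ : ∀ {c a a′ b b′} → a ≡ a′ → b ≡ b′ → edge c a b → edge c a′ b′
  edge-≡ refl refl e = e

  walk-closed : ∀ {r p cs vs z} → Walk r p cs vs → z ∈ vs → mate z ∈ vs
  walk-closed (step w _ refl) (here refl)         = there (here refl)
  walk-closed (step w _ refl) (there (here refl)) = here (mate² _)
  walk-closed (step w _ refl) (there (there i))   = there (there (walk-closed w i))

  walk-covered : ∀ {r p cs vs z} → Walk r p cs vs → Unique vs → z ∈ vs → ¬ Free z
  walk-covered (step w _ refl) ((a ∷ _) ∷ _) (here refl)         f = a (sym f)
  walk-covered (step w _ refl) ((a ∷ _) ∷ _) (there (here refl)) f = a (sym (mate-injective f))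
  walk-covered (step w _ refl) (_ ∷ _ ∷ u)   (there (there i))     = walk-covered w u i

  walk-end : ∀ {r p cs vs} → Walk r p cs vs → (p ≡ r) ⊎ (p ∈ vs)
  walk-end here          = inj₁ refl
  walk-end (step _ _ _)  = inj₂ (there (here refl))

  walk-length : ∀ {r p cs vs} → Walk r p cs vs → length vs ≡ length cs + length cs
  walk-length here = refl
  walk-length (step {cs = cs} w _ _) =
    cong suc (trans (cong suc (walk-length w)) (sym (ℕ.+-suc (length cs) (length cs))))

  -- Otherwise the step would go back along the matching edge just used and repeat `q`; at the free
  -- root it would not move at all.
  step-nonmatching : ∀ {r p q q′ cs vs} → Walk r p cs vs → Free r →
                     q′ ≡ mate q → Unique (q ∷ q′ ∷ vs) → q ≢ mate p
  step-nonmatching w f refl ((a ∷ b) ∷ _) q≡ with walk-end w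
  ... | inj₁ refl = a (trans (trans q≡ f) (trans (sym f) (cong mate (trans (sym f) (sym q≡)))))
  ... | inj₂ p∈   = All.lookup b (walk-closed w p∈) q≡

  Augmenting-↭ : ∀ {x y es fs} → es ↭ fs → Augmenting x y es → Augmenting x y fs
  Augmenting-↭ e P = record { colours = ↭-trans (↭-sym e) colours ; walk = walk ; last = last
    ; x-free = x-free ; y-free = y-free ; x≢y = x≢y ; simple = simple }
    where open Augmenting P

  -- The second walk is consumed from its end: its last step, read backwards, prolongs the first
  -- walk and leaves a shorter bridge.
  bridge : ∀ {x y p q c cs ds vs ws} → Walk x p cs vs → edge c p q → Walk y q ds ws →
           Free x → Free y → x ≢ y → Unique (vs ++ ws) → Augmenting x y (c ∷ cs ++ ds)
  bridge {c = c} {cs} {vs = vs} w e here fx fy ne u = record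
    { colours = prep c (↭.++-identityʳ cs) ; walk = w ; last = e ; x-free = fx ; y-free = fy
    ; x≢y = ne ; simple = Unique-↭ (↭.++-identityʳ vs) u }
  bridge {c = c} {cs} {vs = vs} w e (step {q = t} {q′ = q} {c = c′} {cs = ds} {vs = ws} w′ e′ refl) fx fy ne u =
    Augmenting-↭ (↭-sym (↭.shift c′ (c ∷ cs) ds))
      (bridge (step w e (sym (mate² t))) (edge-sym e′) w′ fx fy ne
        (Unique-↭ (↭-trans (↭.shifts vs (t ∷ q ∷ [])) (↭.swap t q ↭-refl)) u))

  reverseAug : ∀ {x y es} → Augmenting x y es → Augmenting y x es
  reverseAug P = Augmenting-↭ (↭-sym colours)
    (bridge here (edge-sym last) walk y-free x-free (λ e → x≢y (sym e)) simple)
    where open Augmenting P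

  -- Going around an odd cycle through r in one of the two directions, every other
  -- vertex is reached by its matching edge.
  cycle-reach : ∀ {r p q z c cs ds vs ws} → Walk r p cs vs → edge c p q → Walk r q ds ws →
                Unique (c ∷ cs ++ ds) → Unique (vs ++ ws) → z ∈ ws →
                Reach r z (c ∷ cs ++ ds) (vs ++ ws)
  cycle-reach {c = c} {cs} {vs = vs} w e w′@(step {q = t} {q′ = q} {c = c′} {cs = ds} {vs = ws} w″ e′ refl) uc uv = λ where
      (here refl) → record { walk = step w e (sym (mate² t)) ; cs! = proj₁ (Unique-++⁻ (c ∷ cs) uc)
        ; vs! = proj₁ (Unique-++⁻ (q ∷ t ∷ vs) uv′) ; cs⊑ = ∈.∈-++⁺ˡ
        ; vs⊑ = λ i → ↭.∈-resp-↭ (↭-sym σ) (∈.∈-++⁺ˡ i) }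
      (there (here refl)) → record { walk = w′ ; cs! = proj₁ (proj₂ (Unique-++⁻ (c ∷ cs) uc))
        ; vs! = proj₁ (proj₂ (Unique-++⁻ vs uv)) ; cs⊑ = ∈.∈-++⁺ʳ (c ∷ cs) ; vs⊑ = ∈.∈-++⁺ʳ vs }
      (there (there i)) → let open Reach (cycle-reach (step w e (sym (mate² t))) (edge-sym e′) w″
                                           (Unique-↭ τ uc) uv′ i) in
        record { walk = walk ; cs! = cs! ; vs! = vs! ; cs⊑ = λ j → ↭.∈-resp-↭ (↭-sym τ) (cs⊑ j)
               ; vs⊑ = λ j → ↭.∈-resp-↭ (↭-sym σ) (vs⊑ j) }
    where
    σ : vs ++ t ∷ q ∷ ws ↭ q ∷ t ∷ vs ++ ws
    σ = ↭-trans (↭.shifts vs (t ∷ q ∷ [])) (↭.swap t q ↭-refl)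
    τ : c ∷ cs ++ c′ ∷ ds ↭ c′ ∷ c ∷ cs ++ ds
    τ = ↭.shift c′ (c ∷ cs) ds
    uv′ = Unique-↭ σ uv

  -- All that a contraction needs of an odd cycle through `r`; its cyclic order is forgotten. Being
  -- covered, the vertices `zs` do not include `r`.
  record Blossom (r : V) (es : List C) (zs : List V) : Set where
    field
      r-free  : Free r
      es!     : Unique es
      zs!     : Unique zs
      closed  : ∀ {z} → z ∈ zs → mate z ∈ zs
      covered : ∀ {z} → z ∈ zs → ¬ Free z
      reach   : ∀ {z} → z ∈ zs → Reach r z es zs

  cycle-blossom : ∀ {r p q c cs ds vs ws} → Free r → Walk r p cs vs → edge c p q → Walk r q ds ws →
                  Unique (c ∷ cs ++ ds) → Unique (vs ++ ws) → Blossom r (c ∷ cs ++ ds) (vs ++ ws)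
  cycle-blossom {c = c} {cs} {ds} {vs} {ws} f w e w′ uc uv = record
    { r-free = f ; es! = uc ; zs! = uv ; closed = closed ; covered = covered ; reach = reach }
    where
    closed : ∀ {z} → z ∈ vs ++ ws → mate z ∈ vs ++ ws
    closed i with ∈.∈-++⁻ vs i
    ... | inj₁ j = ∈.∈-++⁺ˡ (walk-closed w j)
    ... | inj₂ j = ∈.∈-++⁺ʳ vs (walk-closed w′ j)
    covered : ∀ {z} → z ∈ vs ++ ws → ¬ Free z
    covered i with ∈.∈-++⁻ vs i
    ... | inj₁ j = walk-covered w (proj₁ (Unique-++⁻ vs uv)) j
    ... | inj₂ j = walk-covered w′ (proj₁ (proj₂ (Unique-++⁻ vs uv))) j
    σ : vs ++ ws ↭ ws ++ vs
    σ = ↭.++-comm vs ws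
    τ : c ∷ cs ++ ds ↭ c ∷ ds ++ cs
    τ = prep c (↭.++-comm cs ds)
    reach : ∀ {z} → z ∈ vs ++ ws → Reach _ z (c ∷ cs ++ ds) (vs ++ ws)
    reach i with ∈.∈-++⁻ vs i
    ... | inj₂ j = cycle-reach w e w′ uc uv j
    ... | inj₁ j = record { walk = walk ; cs! = cs! ; vs! = vs!
                          ; cs⊑ = λ k → ↭.∈-resp-↭ (↭-sym τ) (cs⊑ k)
                          ; vs⊑ = λ k → ↭.∈-resp-↭ (↭-sym σ) (vs⊑ k) }
      where open Reach (cycle-reach w′ (edge-sym e) w (Unique-↭ τ uc) (Unique-↭ σ uv) j)

  coveredVertices : List V
  coveredVertices = filter (λ v → ¬? (Free? v)) (allFin n)

  order : ℕ
  order = length coveredVertices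

  covered-∈ : ∀ {v} → ¬ Free v → v ∈ coveredVertices
  covered-∈ = ∈.∈-filter⁺ (λ v → ¬? (Free? v)) (∈.∈-allFin _)

  covered-∈⁻ : ∀ {v} → v ∈ coveredVertices → ¬ Free v
  covered-∈⁻ i = proj₂ (∈.∈-filter⁻ (λ v → ¬? (Free? v)) {xs = allFin n} i)

  coveredVertices! : Unique coveredVertices
  coveredVertices! = Unique.filter⁺ (λ v → ¬? (Free? v)) (Unique.allFin⁺ n)

-- Contraction of a blossom to its root

module Contraction {n m : ℕ} (𝒮 : System n m) (r : Fin n) (zs : List (Fin n))
                   (r-free : System.mate 𝒮 r ≡ r)
                   (closed : ∀ {z} → z ∈ zs → System.mate 𝒮 z ∈ zs)
                   (covered : ∀ {z} → z ∈ zs → System.mate 𝒮 z ≢ z) where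
  open Alternating 𝒮 using (Augmenting; Augmenting-↭; AugmentingIn; Free; Rainbow; Reach; Rich; Walk; bridge; covered-∈; covered-∈⁻; coveredVertices; coveredVertices!; edge; edge-sym; edge-≡; here; mate; mate²; order; reverseAug; step; walk-covered; walk-end)

  private
    V = Fin n
    C = Fin m

  infix 4 _∈?_
  _∈?_ : ∀ (v : V) (xs : List V) → Dec (v ∈ xs)
  _∈?_ = mem? Fin._≟_

  r∉zs : r ∉ zs
  r∉zs i = covered i r-free

  free-∉ : ∀ {v} → Free v → v ∉ zs
  free-∉ f i = covered i f

  mate-∉ : ∀ {v} → v ∉ zs → mate v ∉ zs
  mate-∉ v∉ i = v∉ (subst (_∈ zs) (mate² _) (closed i))

  mate/ : V → V
  mate/ v with v ∈? zs
  ... | yes _ = v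
  ... | no  _ = mate v

  mate/-in : ∀ {v} → v ∈ zs → mate/ v ≡ v
  mate/-in {v} i with v ∈? zs
  ... | yes _ = refl
  ... | no v∉ = ⊥-elim (v∉ i)

  mate/-out : ∀ {v} → v ∉ zs → mate/ v ≡ mate v
  mate/-out {v} v∉ with v ∈? zs
  ... | yes i = ⊥-elim (v∉ i)
  ... | no  _ = refl

  mate/² : ∀ v → mate/ (mate/ v) ≡ v
  mate/² v with v ∈? zs
  ... | yes i = mate/-in i
  ... | no v∉ = trans (mate/-out (mate-∉ v∉)) (mate² v)

  -- `p` stands for `a` after the contraction. The vertices in `zs` are not removed: `mate/` fixes
  -- them and no `p` lies in `zs`, so they become isolated uncovered vertices. Edges inside the
  -- blossom become loops at `r`; this is why later conditions on edges assume distinct ends.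
  LiesAt : V → V → Set
  LiesAt a p = (a ∈ zs × p ≡ r) ⊎ (a ∉ zs × p ≡ a)

  contracted : System n m
  contracted = record
    { mate     = mate/
    ; mate²    = mate/²
    ; edge     = λ c p q → ∃[ a ] ∃[ b ] (LiesAt a p × LiesAt b q × edge c a b)
    ; edge-sym = λ (a , b , la , lb , e) → b , a , lb , la , edge-sym e
    }

  module / = Alternating contracted using (Augmenting; AugmentingIn; Free; Rainbow; Rich; Walk; covered-∈⁻; coveredVertices; coveredVertices!; edge; here; mate; mate²; order; reverseAug; step; walk-covered; walk-end)

  free/ : ∀ {v} → Free v → /.Free v
  free/ f = trans (mate/-out (free-∉ f)) f

  free/⁻ : ∀ {v} → v ∉ zs → /.Free v → Free v
  free/⁻ v∉ f = trans (sym (mate/-out v∉)) f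

  edge/ : ∀ {c a b} → a ∉ zs → b ∉ zs → edge c a b → /.edge c a b
  edge/ a∉ b∉ e = _ , _ , inj₂ (a∉ , refl) , inj₂ (b∉ , refl) , e

  lies-≢r : ∀ {a p} → LiesAt a p → p ≢ r → a ≡ p × p ∉ zs
  lies-≢r (inj₁ (_ , p≡r))   p≢r = ⊥-elim (p≢r p≡r)
  lies-≢r (inj₂ (a∉ , refl)) _   = refl , a∉

  edge/⁻ : ∀ {c p q} → /.edge c p q → p ≢ r → q ≢ r → edge c p q
  edge/⁻ (a , b , la , lb , e) p≢ q≢ = edge-≡ (proj₁ (lies-≢r la p≢)) (proj₁ (lies-≢r lb q≢)) e

  end-∉ : ∀ {x p cs vs} → Free x → Walk x p cs vs → (∀ {z} → z ∈ vs → z ∉ zs) → p ∉ zs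
  end-∉ f w out with walk-end w
  ... | inj₁ refl = free-∉ f
  ... | inj₂ i    = out i

  -- The walk is cut at its first vertex in `zs`; the edge entering the blossom becomes a last edge
  -- to `r`.
  project-walk : ∀ {x p cs vs} → Walk x p cs vs → Free x → x ≢ r → Unique vs →
    (∃[ es ] (/.Augmenting x r es × es ⊑ cs)) ⊎ (/.Walk x p cs vs × (∀ {z} → z ∈ vs → z ∉ zs))
  project-walk here f x≢r u = inj₂ (/.here , λ ())
  project-walk (step {q = q} {c = c} {cs} {vs} w e refl) f x≢r (a ∷ b ∷ u) with project-walk w f x≢r u
  ... | inj₁ (es , P , s) = inj₁ (es , P , λ i → there (s i))
  ... | inj₂ (w′ , out) with q ∈? zs
  ... | yes q∈ = inj₁ (c ∷ cs , record { colours = ↭-refl ; walk = w′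
      ; last = _ , _ , inj₂ (end-∉ f w out , refl) , inj₁ (q∈ , refl) , e
      ; x-free = free/ f ; y-free = free/ r-free ; x≢y = x≢r ; simple = u } , λ i → i)
  ... | no q∉ = inj₂ (/.step w′ (edge/ (end-∉ f w out) q∉ e) (sym (mate/-out q∉)) , λ where
      (here refl)         → q∉
      (there (here refl)) → mate-∉ q∉
      (there (there i))   → out i)

  project-≢r : ∀ {x y es} → Augmenting x y es → x ≢ r →
               ∃[ x′ ] ∃[ y′ ] ∃[ fs ] (/.Augmenting x′ y′ fs × fs ⊑ es)
  project-≢r {x} {y} P x≢r with project-walk walk x-free x≢r simple
    where open Augmenting P
  ... | inj₁ (es , P′ , s) = x , r , es , P′ , λ i → ↭.∈-resp-↭ (↭-sym (Augmenting.colours P)) (there (s i))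
  ... | inj₂ (w′ , out) = x , y , _ , record { colours = colours ; walk = w′
      ; last = edge/ (end-∉ x-free walk out) (free-∉ y-free) last ; x-free = free/ x-free
      ; y-free = free/ y-free ; x≢y = x≢y ; simple = simple } , λ i → i
    where open Augmenting P

  -- Cutting at the blossom requires a start other than `r`, and at least one of the two ends is
  -- such a start.
  project : ∀ {ds} → AugmentingIn ds → /.AugmentingIn ds
  project (x , y , es , P , s) with x Fin.≟ r
  ... | no x≢r =
    let x′ , y′ , fs , P′ , s′ = project-≢r P x≢r in x′ , y′ , fs , P′ , λ i → s (s′ i)
  ... | yes refl =
    let x′ , y′ , fs , P′ , s′ = project-≢r (reverseAug P) (λ e → Augmenting.x≢y P (sym e))
    in x′ , y′ , fs , P′ , λ i → s (s′ i)

  project-rich : ∀ {t cs} → Rich t cs → /.Rich t cs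
  project-rich h ds u s l = project (h ds u s l)

  -- The inner vertices of a simple walk are covered by `mate/`, hence avoid `r` and `zs`, and
  -- elsewhere nothing has changed.
  lift-walk : ∀ {x p cs vs} → /.Walk x p cs vs → x ≢ r → Unique vs →
              Walk x p cs vs × (∀ {z} → z ∈ vs → z ∉ zs)
  lift-walk /.here x≢r u = here , λ ()
  lift-walk {x} (/.step {p = p} {q} {vs = vs} w e refl) x≢r u@((q≢q′ ∷ _) ∷ _ ∷ u′)
    with lift-walk w x≢r u′
  ... | w′ , out = step w′ (edge/⁻ e p≢r q≢r) (mate/-out q∉) , λ where
        (here refl)         → q∉
        (there (here refl)) → λ i → mate-∉ q∉ (subst (_∈ zs) (mate/-out q∉) i)
        (there (there i))   → out i
    where
    q∉ : q ∉ zs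
    q∉ i = q≢q′ (sym (mate/-in i))
    q≢r : q ≢ r
    q≢r refl = q≢q′ (sym (free/ r-free))
    p≢r : p ≢ r
    p≢r refl with /.walk-end w
    ... | inj₁ e = x≢r (sym e)
    ... | inj₂ i = /.walk-covered w u′ i (free/ r-free)

  start-∉ : ∀ {x p q c cs vs} → /.Walk x p cs vs → /.edge c p q → x ≢ r → x ∉ zs
  start-∉ /.here         (_ , _ , la , _) x≢r = proj₂ (lies-≢r la x≢r)
  start-∉ (/.step w e _) _ x≢r = start-∉ w e x≢r

  end-≢r : ∀ {x p cs vs} → /.Walk x p cs vs → x ≢ r → Unique vs → p ≢ r
  end-≢r w x≢r u refl with /.walk-end w
  ... | inj₁ refl = x≢r refl
  ... | inj₂ i    = /.walk-covered w u i (free/ r-free)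

  module _ {es : List C} (reach : ∀ {z} → z ∈ zs → Reach r z es zs) where

    -- Only the last edge can touch the blossom. If it enters at `b`, the colours `es`, still
    -- unspent, lead from `b` to `r`.
    lift-≢r : ∀ {x y fs cs} → /.Augmenting x y fs → x ≢ r → Unique fs → fs ⊑ cs → es ⊑ cs →
              (∀ {c} → c ∈ fs → c ∉ es) → Rainbow cs
    lift-≢r {x} {y} {fs} {cs} P x≢r fs! fs⊑ es⊑ dis = finish last
      where
      open /.Augmenting P hiding (cs)
      w = proj₁ (lift-walk walk x≢r simple)
      out = proj₂ (lift-walk walk x≢r simple)
      fx : Free x
      fx = free/⁻ (start-∉ walk last x≢r) x-free
      finish : /.edge c end y → Rainbow cs
      finish (a , b , la , lb , e) with lies-≢r la (end-≢r walk x≢r simple)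
      finish (a , b , la , inj₂ (b∉ , refl) , e) | refl , _ =
        x , y , fs , record { colours = colours ; walk = w ; last = e ; x-free = fx
          ; y-free = free/⁻ b∉ y-free ; x≢y = x≢y ; simple = simple } , fs⊑ , fs!
      finish (a , b , la , inj₁ (b∈ , refl) , e) | refl , _ =
        x , r , _ , Augmenting-↭ (↭.++⁺ʳ _ (↭-sym colours))
          (bridge w e R.walk fx r-free x≢r
            (Unique-++ simple R.vs! (λ i j → out i (R.vs⊑ j)))) ,
        (λ i → [ fs⊑ , (λ j → es⊑ (R.cs⊑ j)) ]′ (∈.∈-++⁻ fs i)) ,
        Unique-++ fs! R.cs! (λ i j → dis i (R.cs⊑ j))
        where module R = Reach (reach b∈)

    lift : ∀ {cs ds} → /.Rainbow ds → ds ⊑ cs → es ⊑ cs → (∀ {c} → c ∈ ds → c ∉ es) → Rainbow cs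
    lift (x , y , fs , P , s , u) ds⊑ es⊑ dis with x Fin.≟ r
    ... | no x≢r   = lift-≢r P x≢r u (λ i → ds⊑ (s i)) es⊑ (λ i → dis (s i))
    ... | yes refl = lift-≢r (/.reverseAug P) (λ e → /.Augmenting.x≢y P (sym e)) u
                       (λ i → ds⊑ (s i)) es⊑ (λ i → dis (s i))

  order-drop : Unique zs → /.order + length zs ≤ order
  order-drop zs! = subst (_≤ order) (List.length-++ /.coveredVertices)
    (length-⊆ (Unique-++ /.coveredVertices! zs! (λ i j → /.covered-∈⁻ i (mate/-in j)))
      λ i → covered-∈ ([ (λ j f → /.covered-∈⁻ j (free/ f)) , covered ]′ (∈.∈-++⁻ /.coveredVertices i)))

Unique-⊆ : {X : Set} {xs ys : List X} → xs ⊆ ys → Unique ys → Unique xs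
Unique-⊆ []         u       = u
Unique-⊆ (_ ∷ʳ s)   (_ ∷ u) = Unique-⊆ s u
Unique-⊆ (refl ∷ s) (a ∷ u) = AllP.anti-mono (Sublist.lookup s) a ∷ Unique-⊆ s u

-- Growing stars

module _ {n m : ℕ} (𝒮 : System n m) where
  open Alternating 𝒮 using (Blossom; Free; Rainbow; edge; mate)

  record Triangle (cs : List (Fin m)) : Set where
    field
      {r u}  : Fin n
      {c d}  : Fin m
      r-free : Free r
      u-cov  : ¬ Free u
      c≢d    : c ≢ d
      c∈     : c ∈ cs
      d∈     : d ∈ cs
      ru     : edge c r u
      ru′    : edge d r (mate u)

  data Outcome (cs : List (Fin m)) : Set where
    rainbow  : Rainbow cs → Outcome cs
    triangle : Triangle cs → Outcome cs
    blossom  : ∀ {r es zs} → Blossom r es zs → es ⊑ cs → length es < length zs → Outcome cs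

Greedy : ∀ {n m} → System n m → Set
Greedy 𝒮 = ∀ {t cs} → Unique cs → Rich t cs → order + t < length cs → Rainbow cs
  where open Alternating 𝒮 using (Augmenting; Augmenting-↭; Blossom; Free; Rainbow; Reach; Rich; bridge; covered-∈; covered-∈⁻; coveredVertices; coveredVertices!; edge; mate; order; reverseAug)

-- `enough` is weak although `Greedy` is strict: one star already supplies the missing unit. Hence
-- the same growth serves both the bound and the extremal case.
module Growth {n m : ℕ} (𝒮 : System n m) {cs : List (Fin m)} {t : ℕ}
              (cs! : Unique cs) (rich : Alternating.Rich 𝒮 t cs)
              (enough : Alternating.order 𝒮 + t ≤ length cs) (t< : t < length cs)
              (smaller : ∀ (𝒯 : System n m) → Alternating.order 𝒯 < Alternating.order 𝒮 → Greedy 𝒯)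
              where
  open Alternating 𝒮 using (Augmenting; AugmentingIn; Free; Rainbow; Rich; Walk; bridge; covered-∈; covered-∈⁻; coveredVertices; coveredVertices!; cycle-blossom; edge; edge-sym; here; mate; mate-injective; mate²; order; step; walk-length)

  private
    V = Fin n
    C = Fin m

  _∈?_ : ∀ (v : V) (xs : List V) → Dec (v ∈ xs)
  _∈?_ = mem? Fin._≟_

  infixr 5 _⊙_
  _⊙_ : ∀ {r x p cs ds vs ws} → Walk r x cs vs → Walk x p ds ws → Walk r p (ds ++ cs) (ws ++ vs)
  w ⊙ here         = w
  w ⊙ step w′ e eq = step (w ⊙ w′) e eq

  record Star : Set where
    field
      {root leaf} : V
      {colour}    : C
      root-free   : Free root
      spoke       : edge colour root leaf
    tip : V
    tip = mate leaf
    ray : Walk root tip (colour ∷ []) (leaf ∷ tip ∷ [])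
    ray = step here spoke refl
  open Star

  starVs : List Star → List V
  starVs []       = []
  starVs (s ∷ ss) = leaf s ∷ tip s ∷ starVs ss

  starCs : List Star → List C
  starCs = map (λ s → colour s)

  starVs-length : ∀ ss → length (starVs ss) ≡ length ss + length ss
  starVs-length []       = refl
  starVs-length (s ∷ ss) = cong suc (trans (cong suc (starVs-length ss)) (sym (ℕ.+-suc (length ss) (length ss))))

  starVs-↭ : ∀ {ss ss′} → ss ↭ ss′ → starVs ss ↭ starVs ss′
  starVs-↭ ↭.refl         = ↭-refl
  starVs-↭ (↭.prep s p)   = prep _ (prep _ (starVs-↭ p))
  starVs-↭ (↭.swap s s′ p) =
    ↭-trans (↭.shifts (leaf s ∷ tip s ∷ []) (leaf s′ ∷ tip s′ ∷ [])) (prep _ (prep _ (prep _ (prep _ (starVs-↭ p)))))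
  starVs-↭ (↭.trans p q)  = ↭-trans (starVs-↭ p) (starVs-↭ q)

  find : ∀ {z} ss → z ∈ starVs ss → ∃[ s ] (s ∈ ss × ((z ≡ leaf s) ⊎ (z ≡ tip s)))
  find (s ∷ ss) (here e)          = s , here refl , inj₁ e
  find (s ∷ ss) (there (here e))  = s , here refl , inj₂ e
  find (s ∷ ss) (there (there i)) = let s′ , j , k = find ss i in s′ , there j , k

  leaf-∈ : ∀ {s ss} → s ∈ ss → leaf s ∈ starVs ss
  leaf-∈ (here refl) = here refl
  leaf-∈ (there i)   = there (there (leaf-∈ i))

  tip-∈ : ∀ {s ss} → s ∈ ss → tip s ∈ starVs ss
  tip-∈ (here refl) = there (here refl)
  tip-∈ (there i)   = there (there (tip-∈ i))

  starVs-closed : ∀ {z} ss → z ∈ starVs ss → mate z ∈ starVs ss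
  starVs-closed ss i with find ss i
  ... | s , j , inj₁ refl = tip-∈ j
  ... | s , j , inj₂ refl = subst (_∈ starVs ss) (sym (mate² _)) (leaf-∈ j)

  record State : Set where
    field
      stars : List Star
      rest  : List C
      vs!   : Unique (starVs stars)
      cs′!  : Unique (starCs stars ++ rest)
      cs′⊑  : (starCs stars ++ rest) ⊑ cs
      total : length stars + length rest ≡ length cs

  record Sprout (sv : List V) (rest : List C) : Set where
    field
      {x q}  : V
      {c}    : C
      x-free : Free x
      xq     : edge c x q
      q∉     : q ∉ sv
      q-cov  : ¬ Free q
      c∈     : c ∈ rest

  -- The roots and leaves are deleted and the tips become the uncovered vertices.
  module Residual (Σ₀ : State) (grow : Sprout (starVs (State.stars Σ₀)) (State.rest Σ₀) → Outcome 𝒮 cs) where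
    open State Σ₀

    sv : List V
    sv = starVs stars

    -- Roots, leaves and the remaining uncovered vertices stay in the residual system without any
    -- edge, so that an augmenting path there has to end in two tips.
    Alive : V → Set
    Alive a = (a ∉ sv × ¬ Free a) ⊎ (∃[ s ] (s ∈ stars × a ≡ tip s))

    mate₁ : V → V
    mate₁ v with v ∈? sv
    ... | yes _ = v
    ... | no  _ = mate v

    mate₁-in : ∀ {v} → v ∈ sv → mate₁ v ≡ v
    mate₁-in {v} i with v ∈? sv
    ... | yes _ = refl
    ... | no v∉ = ⊥-elim (v∉ i)

    mate₁-out : ∀ {v} → v ∉ sv → mate₁ v ≡ mate v
    mate₁-out {v} v∉ with v ∈? sv
    ... | yes i = ⊥-elim (v∉ i)
    ... | no  _ = refl

    free₁ : ∀ {v} → Free v → mate₁ v ≡ v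
    free₁ {v} f with v ∈? sv
    ... | yes _ = refl
    ... | no  _ = f

    mate-∉ : ∀ {v} → v ∉ sv → mate v ∉ sv
    mate-∉ v∉ i = v∉ (subst (_∈ sv) (mate² _) (starVs-closed stars i))

    mate₁² : ∀ v → mate₁ (mate₁ v) ≡ v
    mate₁² v with v ∈? sv
    ... | yes i = mate₁-in i
    ... | no v∉ = trans (mate₁-out (mate-∉ v∉)) (mate² v)

    residual : System n m
    residual = record
      { mate = mate₁ ; mate² = mate₁²
      ; edge = λ c a b → edge c a b × Alive a × Alive b
      ; edge-sym = λ (e , a , b) → edge-sym e , b , a }

    module ₁ = Alternating residual using (Augmenting; AugmentingIn; Free; Rainbow; Rich; Walk; covered-∈⁻; coveredVertices; coveredVertices!; edge; here; order; step; walk-length)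

    star-covered : ∀ {z} → z ∈ sv → ¬ Free z
    star-covered i = go stars vs! i
      where
      go : ∀ {z} ss → Unique (starVs ss) → z ∈ starVs ss → ¬ Free z
      go (s ∷ ss) ((a ∷ _) ∷ _) (here refl)         f = a (sym f)
      go (s ∷ ss) ((a ∷ _) ∷ _) (there (here refl)) f = a (sym (mate-injective f))
      go (s ∷ ss) (_ ∷ _ ∷ u)   (there (there i))     = go ss u i

    -- Root, leaf, tip and `y` form a path in two colours, unless `y` is the root itself.
    link : ∀ {s y c} → s ∈ stars → Free y → edge c (tip s) y → c ∈ rest → Outcome 𝒮 cs
    link {s} {y} {c} s∈ fy e c∈ with root s Fin.≟ y
    ... | no  ne = rainbow (root s , y , c ∷ colour s ∷ [] ,
        bridge (ray s) e here (root-free s) fy ne (pair-unique λ e → leafcov (sym e)) , sub , pair-unique c≢)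
      where
      leafcov = star-covered (leaf-∈ s∈)
      sub : (c ∷ colour s ∷ []) ⊑ cs
      sub (here refl)         = cs′⊑ (∈.∈-++⁺ʳ (starCs stars) c∈)
      sub (there (here refl)) = cs′⊑ (∈.∈-++⁺ˡ (∈.∈-map⁺ (λ s → colour s) s∈))
      c≢ : c ≢ colour s
      c≢ refl = proj₂ (proj₂ (Unique-++⁻ (starCs stars) cs′!)) (∈.∈-map⁺ (λ s → colour s) s∈) c∈
    ... | yes refl = triangle (record
      { r-free = fy ; u-cov = star-covered (leaf-∈ s∈)
      ; c≢d = λ { refl → proj₂ (proj₂ (Unique-++⁻ (starCs stars) cs′!)) (∈.∈-map⁺ (λ s → colour s) s∈) c∈ }
      ; c∈ = cs′⊑ (∈.∈-++⁺ˡ (∈.∈-map⁺ (λ s → colour s) s∈)) ; d∈ = cs′⊑ (∈.∈-++⁺ʳ (starCs stars) c∈)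
      ; ru = spoke s ; ru′ = edge-sym e })

    module _ {ds : List C} (ds⊑ : ds ⊑ rest) where

      -- Of the path followed so far only the stretch since its last passage from a leaf to the tip
      -- is kept: it is a walk of the residual system starting at that tip.
      data Current (x : V) : V → List V → Set where
        start   : ∀ {vs} → Current x x vs
        segment : ∀ {s p cs₁ vs₁ vs} → s ∈ stars → ₁.Walk (tip s) p cs₁ vs₁ → cs₁ ⊑ ds → vs₁ ⊑ vs →
                  Unique vs₁ → tip s ∈ vs → Alive p → Current x p vs

      -- From `x` the first edge is a sprout unless it meets a star; at a tip it is a link, and at a
      -- leaf the walk passes to the tip and a stretch begins. A stretch that reaches another leaf
      -- is replaced, and one that reaches another tip is an augmenting path of the residual system.
      follow : ∀ {x p cs₀ vs} → Walk x p cs₀ vs → Free x → cs₀ ⊑ ds → Unique vs →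
               Outcome 𝒮 cs ⊎ ₁.AugmentingIn ds ⊎ Current x p vs
      follow here f s u = inj₂ (inj₂ start)
      follow (step {q = q} {c = c} w e refl) f s u₀@((a ∷ a′) ∷ b ∷ u) with follow w f (λ i → s (there i)) u
      ... | inj₁ o        = inj₁ o
      ... | inj₂ (inj₁ g) = inj₂ (inj₁ g)
      ... | inj₂ (inj₂ cur) with q ∈? sv
      follow (step {q = q} {c = c} w e refl) f s u₀@((a ∷ a′) ∷ b ∷ u) | inj₂ (inj₂ start) | no q∉ =
        inj₁ (grow (record { x-free = f ; xq = e ; q∉ = q∉ ; q-cov = λ k → a (sym k) ; c∈ = ds⊑ (s (here refl)) }))
      follow (step {q = q} {c = c} w e refl) f s u₀@((a ∷ a′) ∷ b ∷ u)
        | inj₂ (inj₂ (segment {cs₁ = cs₁} {vs₁} s∈ w₁ cs₁⊑ vs₁⊑ u₁ tip∈ al)) | no q∉ =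
        inj₂ (inj₂ (segment s∈ (₁.step w₁ (e , al , inj₁ (q∉ , λ k → a (sym k))) (sym (mate₁-out q∉)))
          (λ { (here refl) → s (here refl) ; (there i) → cs₁⊑ i })
          (λ { (here refl) → here refl ; (there (here refl)) → there (here refl)
             ; (there (there i)) → there (there (vs₁⊑ i)) })
          ((a ∷ AllP.anti-mono vs₁⊑ a′) ∷ AllP.anti-mono vs₁⊑ b ∷ u₁) (there (there tip∈))
          (inj₁ (mate-∉ q∉ , λ k → a (sym (mate-injective k))))))
      follow (step {q = q} {c = c} w e refl) f s u₀@((a ∷ a′) ∷ b ∷ u) | inj₂ (inj₂ cur) | yes q∈ with find stars q∈
      ... | s′ , s′∈ , inj₁ refl =
        inj₂ (inj₂ (segment s′∈ ₁.here (λ ()) (λ ()) [] (there (here refl)) (inj₂ (s′ , s′∈ , refl))))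
      follow (step {q = q} {c = c} w e refl) f s u₀@((a ∷ a′) ∷ b ∷ u) | inj₂ (inj₂ start) | yes q∈ | s′ , s′∈ , inj₂ refl =
        inj₁ (link s′∈ f (edge-sym e) (ds⊑ (s (here refl))))
      follow (step {q = q} {c = c} w e refl) f s u₀@((a ∷ a′) ∷ b ∷ u)
        | inj₂ (inj₂ (segment {s₀} {cs₁ = cs₁} s∈ w₁ cs₁⊑ vs₁⊑ u₁ tip∈ al)) | yes q∈ | s′ , s′∈ , inj₂ refl =
        inj₂ (inj₁ (tip s₀ , tip s′ , c ∷ cs₁ , record { colours = ↭-refl ; walk = w₁
          ; last = e , al , inj₂ (s′ , s′∈ , refl) ; x-free = mate₁-in (tip-∈ s∈) ; y-free = mate₁-in (tip-∈ s′∈)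
          ; x≢y = λ k → All.lookup a′ tip∈ (sym k) ; simple = u₁ } ,
          λ { (here refl) → s (here refl) ; (there i) → cs₁⊑ i }))

      -- If no stretch has been completed, the last edge decides: read from `y` it is a sprout or a
      -- link, or it joins `x` to `y` directly.
      analyse : ∀ {x y es} → Augmenting x y es → es ⊑ ds → Outcome 𝒮 cs ⊎ ₁.AugmentingIn ds
      analyse {x} {y} P s = finish (follow walk x-free (λ i → s (↭.∈-resp-↭ (↭-sym colours) (there i))) simple) last
        where
        open Augmenting P renaming (cs to cs₀)
        c∈ : c ∈ rest
        c∈ = ds⊑ (s (↭.∈-resp-↭ (↭-sym colours) (here refl)))
        finish : ∀ {p} → Outcome 𝒮 cs ⊎ ₁.AugmentingIn ds ⊎ Current x p vs → edge c p y →
                 Outcome 𝒮 cs ⊎ ₁.AugmentingIn ds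
        finish (inj₁ o) _ = inj₁ o
        finish (inj₂ (inj₁ g)) _ = inj₂ g
        finish (inj₂ (inj₂ start)) e = inj₁ (rainbow (x , y , c ∷ [] ,
          bridge here e here x-free y-free x≢y [] ,
          (λ { (here refl) → cs′⊑ (∈.∈-++⁺ʳ (starCs stars) c∈) }) , [] ∷ []))
        finish (inj₂ (inj₂ (segment _ _ _ _ _ _ (inj₁ (p∉ , pc))))) e = inj₁ (grow (record
          { x-free = y-free ; xq = edge-sym e ; q∉ = p∉ ; q-cov = pc ; c∈ = c∈ }))
        finish (inj₂ (inj₂ (segment _ _ _ _ _ _ (inj₂ (s′ , s′∈ , refl))))) e = inj₁ (link s′∈ y-free e c∈)

    rest! : Unique rest
    rest! = proj₁ (proj₂ (Unique-++⁻ (starCs stars) cs′!))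

    rest⊑ : rest ⊑ cs
    rest⊑ i = cs′⊑ (∈.∈-++⁺ʳ (starCs stars) i)

    outcome-or-rich : Outcome 𝒮 cs ⊎ ₁.Rich t rest
    outcome-or-rich with sublist-choice {P = λ ds → t < length ds → ₁.AugmentingIn ds} rest try
      where
      try : ∀ ds → ds ⊆ rest → (t < length ds → ₁.AugmentingIn ds) ⊎ Outcome 𝒮 cs
      try ds sub with t ℕ.<? length ds
      ... | no ¬l = inj₁ λ l → ⊥-elim (¬l l)
      ... | yes l with rich ds (Unique-⊆ sub rest!) (λ i → rest⊑ (Sublist.lookup sub i)) l
      ... | x , y , es , P , s with analyse (Sublist.lookup sub) P s
      ... | inj₁ o = inj₂ o
      ... | inj₂ g = inj₁ λ _ → g
    ... | inj₂ o = inj₁ o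
    ... | inj₁ h = inj₂ λ ds ds! ds⊑ l →
      let ds′ = filter (λ c → mem? Fin._≟_ c ds) rest
          x , y , es , P , s = h ds′ (filter-⊆ _ rest) (ℕ.<-≤-trans l
            (length-⊆ ds! (λ i → ∈.∈-filter⁺ (λ c → mem? Fin._≟_ c ds) (ds⊑ i) i)))
      in x , y , es , P , λ i → proj₂ (∈.∈-filter⁻ (λ c → mem? Fin._≟_ c ds) {xs = rest} (s i))

    end-tip : ∀ {a} → Alive a → ₁.Free a → ∃[ s ] (s ∈ stars × a ≡ tip s)
    end-tip (inj₁ (a∉ , a-cov)) f = ⊥-elim (a-cov (trans (sym (mate₁-out a∉)) f))
    end-tip (inj₂ r) _ = r

    start-alive : ∀ {x p q c cs₀ vs} → ₁.Walk x p cs₀ vs → ₁.edge c p q → Alive x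
    start-alive ₁.here         (_ , al , _) = al
    start-alive (₁.step w e _) _            = start-alive w e

    lift-walk₁ : ∀ {x p cs₀ vs} → ₁.Walk x p cs₀ vs → Unique vs →
                 Walk x p cs₀ vs × (∀ {z} → z ∈ vs → z ∉ sv)
    lift-walk₁ ₁.here u = here , λ ()
    lift-walk₁ (₁.step {q = q} w e refl) ((a ∷ _) ∷ _ ∷ u) with lift-walk₁ w u
    ... | w′ , out = step w′ (proj₁ e) (mate₁-out q∉) , λ where
        (here refl)         → q∉
        (there (here refl)) → λ i → mate-∉ q∉ (subst (_∈ sv) (mate₁-out q∉) i)
        (there (there i))   → out i
      where
      q∉ : q ∉ sv
      q∉ i = a (sym (mate₁-in i))

    from-residual : ₁.Rainbow rest → Outcome 𝒮 cs
    from-residual (x , y , es , P , s , es!) =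
      finish (end-tip (start-alive walk last) x-free) (end-tip (proj₂ (proj₂ last)) y-free)
      where
      open ₁.Augmenting P renaming (cs to cs₀)
      w = proj₁ (lift-walk₁ walk simple)
      out = proj₂ (lift-walk₁ walk simple)
      finish : ∃[ a ] (a ∈ stars × x ≡ tip a) → ∃[ b ] (b ∈ stars × y ≡ tip b) → Outcome 𝒮 cs
      finish (a , a∈ , x≡) (b , b∈ , y≡) with remove₂ a∈ b∈ (λ { refl → x≢y (trans x≡ (sym y≡)) })
      ... | others , σ = close (root a Fin.≟ root b)
        where
        w₁ : Walk (root a) end (cs₀ ++ colour a ∷ []) (vs ++ leaf a ∷ tip a ∷ [])
        w₁ = ray a ⊙ subst (λ v → Walk v end cs₀ vs) x≡ w
        e₁ : edge c end (tip b)
        e₁ = subst (edge c end) y≡ (proj₁ last)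
        ends! : Unique (leaf a ∷ tip a ∷ leaf b ∷ tip b ∷ [])
        ends! = proj₁ (Unique-++⁻ (leaf a ∷ tip a ∷ leaf b ∷ tip b ∷ []) (Unique-↭ (starVs-↭ σ) vs!))
        ends⊑ : (leaf a ∷ tip a ∷ leaf b ∷ tip b ∷ []) ⊑ sv
        ends⊑ (here refl) = leaf-∈ a∈
        ends⊑ (there (here refl)) = tip-∈ a∈
        ends⊑ (there (there (here refl))) = leaf-∈ b∈
        ends⊑ (there (there (there (here refl)))) = tip-∈ b∈
        zs! : Unique ((vs ++ leaf a ∷ tip a ∷ []) ++ leaf b ∷ tip b ∷ [])
        zs! = subst Unique (sym (List.++-assoc vs _ _)) (Unique-++ simple ends! (λ i j → out i (ends⊑ j)))
        ab! : Unique (colour a ∷ colour b ∷ [])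
        ab! = proj₁ (Unique-++⁻ (colour a ∷ colour b ∷ [])
                (Unique-↭ (↭.map⁺ (λ s → colour s) σ) (proj₁ (Unique-++⁻ (starCs stars) cs′!))))
        ab⊑ : (colour a ∷ colour b ∷ []) ⊑ starCs stars
        ab⊑ (here refl) = ∈.∈-map⁺ (λ s → colour s) a∈
        ab⊑ (there (here refl)) = ∈.∈-map⁺ (λ s → colour s) b∈
        c∷cs₀⊑ : (c ∷ cs₀) ⊑ rest
        c∷cs₀⊑ i = s (↭.∈-resp-↭ (↭-sym colours) i)
        fs : List C
        fs = c ∷ (cs₀ ++ colour a ∷ []) ++ colour b ∷ []
        assoc : c ∷ (cs₀ ++ colour a ∷ []) ++ colour b ∷ [] ≡ (c ∷ cs₀) ++ colour a ∷ colour b ∷ []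
        assoc = cong (c ∷_) (List.++-assoc cs₀ _ _)
        fs! : Unique fs
        fs! = subst Unique (sym assoc) (Unique-++ (Unique-↭ colours es!) ab!
                (λ i j → proj₂ (proj₂ (Unique-++⁻ (starCs stars) cs′!)) (ab⊑ j) (c∷cs₀⊑ i)))
        fs⊑ : fs ⊑ cs
        fs⊑ {z} i with ∈.∈-++⁻ (c ∷ cs₀) (subst (z ∈_) assoc i)
        ... | inj₁ j = rest⊑ (c∷cs₀⊑ j)
        ... | inj₂ j = cs′⊑ (∈.∈-++⁺ˡ (ab⊑ j))
        len-fs : length fs ≡ 3 + length cs₀
        len-fs = trans (cong length assoc) (cong suc (trans (List.length-++ cs₀) (ℕ.+-comm (length cs₀) 2)))
        len-zs : length ((vs ++ leaf a ∷ tip a ∷ []) ++ leaf b ∷ tip b ∷ []) ≡ 4 + (length cs₀ + length cs₀)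
        len-zs = trans (cong length (List.++-assoc vs _ _)) (trans (List.length-++ vs)
                   (trans (ℕ.+-comm (length vs) 4) (cong (4 +_) (₁.walk-length walk))))
        close : Dec (root a ≡ root b) → Outcome 𝒮 cs
        close (no ne)   = rainbow (root a , root b , fs ,
          bridge w₁ e₁ (ray b) (root-free a) (root-free b) ne zs! , fs⊑ , fs!)
        -- With n the length of `cs₀`, the cycle has n + 3 colours and 2n + 4 covered vertices.
        close (yes req) = blossom (cycle-blossom (root-free a) w₁ e₁
            (subst (λ v → Walk v (tip b) (colour b ∷ []) (leaf b ∷ tip b ∷ [])) (sym req) (ray b)) fs! zs!)
          fs⊑ (subst₂ _<_ (sym len-fs) (sym len-zs) (ℕ.+-mono-≤ (ℕ.≤-refl {4}) (ℕ.m≤m+n (length cs₀) (length cs₀))))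

    residual-order : ₁.order + (length stars + length stars) ≤ order
    residual-order = subst (_≤ order)
      (trans (List.length-++ ₁.coveredVertices) (cong (₁.order +_) (starVs-length stars)))
      (length-⊆ (Unique-++ ₁.coveredVertices! vs! (λ i j → ₁.covered-∈⁻ i (mate₁-in j)))
        λ i → covered-∈ ([ (λ j → keep (₁.covered-∈⁻ j)) , star-covered ]′ (∈.∈-++⁻ ₁.coveredVertices i)))
      where
      keep : ∀ {v} → ¬ ₁.Free v → ¬ Free v
      keep nf f = nf (free₁ f)

    conclude : ₁.Rich t rest → Outcome 𝒮 cs
    conclude h = split stars refl
      where
      open ℕ.≤-Reasoning
      split : ∀ ss → stars ≡ ss → Outcome 𝒮 cs
      -- Without stars no vertex is both alive and uncovered in the residual system, so the path
      -- that `h` grants has no possible start.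
      split [] eq with h rest rest! (λ i → i) (subst (t <_) (trans (sym total) (cong (λ ss → length ss + length rest) eq)) t<)
      ... | x , y , es , P , s with end-tip (start-alive walk last) x-free
        where open ₁.Augmenting P
      ... | a , a∈ , _ with subst (a ∈_) eq a∈
      ... | ()
      split (s₀ ∷ ss) eq = from-residual (smaller residual order< rest! h room)
        where
        ℓ = length stars
        ℓ>0 : 0 < ℓ
        ℓ>0 = subst (λ ss → 0 < length ss) (sym eq) (s≤s z≤n)
        order< : ₁.order < order
        order< = begin-strict
          ₁.order               <⟨ ℕ.m<m+n ₁.order (ℕ.<-≤-trans ℓ>0 (ℕ.m≤m+n ℓ ℓ)) ⟩
          ₁.order + (ℓ + ℓ)     ≤⟨ residual-order ⟩
          order                 ∎
        -- The ℓ stars cost ℓ colours but 2ℓ covered vertices; the surplus ℓ > 0 makes the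
        -- inequality strict.
        room : ₁.order + t < length rest
        room = ℕ.+-cancelˡ-< ℓ _ _ (begin-strict
          ℓ + (₁.order + t)         <⟨ ℕ.m<m+n _ ℓ>0 ⟩
          (ℓ + (₁.order + t)) + ℓ   ≡⟨ solve 3 (λ l o t → (l :+ (o :+ t)) :+ l := (o :+ (l :+ l)) :+ t) refl ℓ ₁.order t ⟩
          (₁.order + (ℓ + ℓ)) + t   ≤⟨ ℕ.+-monoˡ-≤ t residual-order ⟩
          order + t                 ≤⟨ enough ⟩
          length cs                 ≡⟨ sym total ⟩
          ℓ + length rest           ∎)

  -- Every sprout spends one colour of `rest`, whose length therefore bounds the number of rounds.
  loop : ∀ fuel (Σ₀ : State) → length (State.rest Σ₀) ≤ fuel → Outcome 𝒮 cs
  grow : ∀ fuel (Σ₀ : State) → length (State.rest Σ₀) ≤ fuel →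
         Sprout (starVs (State.stars Σ₀)) (State.rest Σ₀) → Outcome 𝒮 cs
  loop fuel Σ₀ l with Residual.outcome-or-rich Σ₀ (grow fuel Σ₀ l)
  ... | inj₁ o = o
  ... | inj₂ h = Residual.conclude Σ₀ (grow fuel Σ₀ l) h
  grow fuel Σ₀ l b with remove (Sprout.c∈ b)
  grow zero Σ₀ l b | rest′ , σ = ⊥-elim (ℕ.<⇒≱ (s≤s z≤n) (subst (_≤ 0) (↭.↭-length σ) l))
  grow (suc fuel) Σ₀ l b | rest′ , σ = loop fuel (record
    { stars = record { root-free = x-free ; spoke = xq } ∷ stars
    ; rest = rest′
    ; vs! = Unique-∷ (λ { (here e) → q-cov (sym e) ; (there i) → q∉ i })
              (Unique-∷ (λ i → q∉ (subst (_∈ starVs stars) (mate² _) (starVs-closed stars i))) vs!)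
    ; cs′! = Unique-↭ τ cs′!
    ; cs′⊑ = λ i → cs′⊑ (↭.∈-resp-↭ (↭-sym τ) i)
    ; total = trans (sym (ℕ.+-suc (length stars) (length rest′)))
                (trans (cong (length stars +_) (sym (↭.↭-length σ))) total)
    }) (ℕ.≤-pred (subst (_≤ suc fuel) (↭.↭-length σ) l))
    where
    open State Σ₀
    open Sprout b
    τ : starCs stars ++ rest ↭ c ∷ starCs stars ++ rest′
    τ = ↭-trans (↭.++⁺ˡ (starCs stars) σ) (↭.shift c (starCs stars) rest′)

  outcome : Outcome 𝒮 cs
  outcome = loop (length cs) (record { stars = [] ; rest = cs ; vs! = [] ; cs′! = cs! ; cs′⊑ = λ i → i ; total = refl }) ℕ.≤-refl

-- The bound, by induction on the number of covered vertices

module _ {n m : ℕ} where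

  triangle-blossom : ∀ {𝒮 : System n m} {cs} (T : Triangle 𝒮 cs) → let open Triangle T in
    Alternating.Blossom 𝒮 r (d ∷ c ∷ []) (u ∷ System.mate 𝒮 u ∷ [])
  triangle-blossom {𝒮} T = cycle-blossom r-free (step here ru refl) (edge-sym ru′) here
      (pair-unique (λ e → c≢d (sym e))) (pair-unique (λ e → u-cov (sym e)))
    where
    open Alternating 𝒮 using (Augmenting; Blossom; cycle-blossom; edge-sym; here; mate; mate²; order; step)
    open Triangle T using (c; c∈; c≢d; d; r; r-free; ru; ru′; u; u-cov)

  contract-room : ∀ {o o′ t e z c c′ : ℕ} → o′ + z ≤ o → c ≡ e + c′ → (o + t) + e < c + z → o′ + t < c′
  contract-room {o} {o′} {t} {e} {z} {c} {c′} drop eq h = ℕ.+-cancelˡ-< (e + z) _ _ (begin-strict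
    (e + z) + (o′ + t)   ≡⟨ solve 4 (λ e z o t → (e :+ z) :+ (o :+ t) := ((o :+ z) :+ t) :+ e) refl e z o′ t ⟩
    ((o′ + z) + t) + e   ≤⟨ ℕ.+-monoˡ-≤ e (ℕ.+-monoˡ-≤ t drop) ⟩
    (o + t) + e          <⟨ h ⟩
    c + z                ≡⟨ cong (_+ z) eq ⟩
    (e + c′) + z         ≡⟨ solve 3 (λ e z c → (e :+ c) :+ z := (e :+ z) :+ c) refl e z c′ ⟩
    (e + z) + c′         ∎)
    where open ℕ.≤-Reasoning

  module _ {𝒮 : System n m} {cs : List (Fin m)} {t r es zs}
           (B : Alternating.Blossom 𝒮 r es zs) (es⊑ : es ⊑ cs) (cs! : Unique cs)
           (rich : Alternating.Rich 𝒮 t cs) where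
    open Alternating 𝒮 using (Blossom; Rainbow; Rich-⊑; order)
    open Blossom B using (closed; covered; es!; r-free; reach; zs!)
    open Contraction 𝒮 r zs r-free closed covered using (contracted; lift; order-drop; project-rich; module /)

    -- Both lengths occur in the hypothesis because the balance depends on the blossom: a triangle
    -- keeps it, while the cycles found by the growth improve it by at least one.
    contract-greedy : (order + t) + length es < length cs + length zs → Greedy contracted → Rainbow cs
    contract-greedy room g with split-off es es! es⊑
    ... | ds , σ with Unique-++⁻ es (Unique-↭ σ cs!)
    ... | _ , ds! , dis =
      lift reach (g ds! (project-rich (Rich-⊑ ds⊑ rich))
                   (contract-room (order-drop zs!) (trans (↭.↭-length σ) (List.length-++ es)) room))
        ds⊑ es⊑ (λ i j → dis j i)
      where
      ds⊑ : ds ⊑ cs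
      ds⊑ i = ↭.∈-resp-↭ (↭-sym σ) (∈.∈-++⁺ʳ es i)

    contract-order : 0 < length zs → /.order < order
    contract-order l = ℕ.<-≤-trans (ℕ.m<m+n /.order l) (order-drop zs!)

  greedy-below : ∀ f (𝒮 : System n m) → Alternating.order 𝒮 < f → Greedy 𝒮
  greedy-below (suc f) 𝒮 o<f {t} {cs} cs! rich room
    with Growth.outcome 𝒮 cs! rich (ℕ.<⇒≤ room) (ℕ.≤-<-trans (ℕ.m≤n+m t (Alternating.order 𝒮)) room)
           (λ 𝒯 l → greedy-below f 𝒯 (ℕ.<-≤-trans l (ℕ.≤-pred o<f)))
  ... | rainbow R = R
  ... | triangle T = contract-greedy (triangle-blossom T)
      (λ { (here refl) → d∈ ; (there (here refl)) → c∈ }) cs! rich (ℕ.+-monoˡ-< 2 room)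
      (greedy-below f _ (ℕ.<-≤-trans (contract-order (triangle-blossom T) (λ { (here refl) → d∈ ; (there (here refl)) → c∈ }) cs! rich (s≤s z≤n)) (ℕ.≤-pred o<f)))
    where open Triangle T
  ... | blossom B es⊑ l = contract-greedy B es⊑ cs! rich (ℕ.+-mono-<-≤ room (ℕ.<⇒≤ l))
      (greedy-below f _ (ℕ.<-≤-trans (contract-order B es⊑ cs! rich (ℕ.≤-<-trans z≤n l)) (ℕ.≤-pred o<f)))

  greedy : (𝒮 : System n m) → Greedy 𝒮
  greedy 𝒮 = greedy-below _ 𝒮 ℕ.≤-refl

-- Strips and their threads

verts-of : {V : Set} → (V → V) → List V → List V
verts-of mate []       = []
verts-of mate (u ∷ us) = u ∷ mate u ∷ verts-of mate us

-- `us` lists the interior vertices u₁, u₂, ... of an origamistrip, the v's being their mates. The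
-- A-path then enters the matching edges at `us` and the B-path at `map mate us`, so every statement
-- about the B-side is one about the A-side of the swapped strip.
record Strip (n m : ℕ) : Set where
  constructor strip
  field
    src tgt : Fin n
    us      : List (Fin n)
    as bs   : List (Fin m)
  cols : List (Fin m)
  cols = as ++ bs

module Threads {n : ℕ} (mate : Fin n → Fin n) (mate² : ∀ v → mate (mate v) ≡ v) where

  private
    V = Fin n

  verts : List V → List V
  verts = verts-of mate

  -- Inner p us lists the non-matching edges of the walk p, u₁, mate u₁, u₂, mate u₂, …;
  -- Thread p us y also contains the edge to the final vertex y.
  Inner : V → List V → V → V → Set
  Inner p []       a b = ⊥
  Inner p (u ∷ us) a b = (a ≡ p × b ≡ u) ⊎ Inner (mate u) us a b

  Thread : V → List V → V → V → V → Set
  Thread p []       y a b = a ≡ p × b ≡ y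
  Thread p (u ∷ us) y a b = (a ≡ p × b ≡ u) ⊎ Thread (mate u) us y a b

  Touch : V → List V → V → V → V → Set
  Touch p us y a b = Thread p us y a b ⊎ Thread p us y b a

  stop : V → List V → V
  stop p []       = p
  stop p (u ∷ us) = stop (mate u) us

  stop-snoc : ∀ {p} us {v} → stop p (us ++ v ∷ []) ≡ mate v
  stop-snoc []       = refl
  stop-snoc (u ∷ us) = stop-snoc us

  map-mate² : ∀ us → map mate (map mate us) ≡ us
  map-mate² []       = refl
  map-mate² (u ∷ us) = cong₂ _∷_ (mate² u) (map-mate² us)

  verts-++ : ∀ us ws → verts (us ++ ws) ≡ verts us ++ verts ws
  verts-++ []       ws = refl
  verts-++ (u ∷ us) ws = cong (λ l → u ∷ mate u ∷ l) (verts-++ us ws)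

  verts-map : ∀ us → verts (map mate us) ↭ verts us
  verts-map []       = ↭-refl
  verts-map (u ∷ us) = subst (λ v → mate u ∷ v ∷ verts (map mate us) ↭ u ∷ mate u ∷ verts us)
    (sym (mate² u)) (↭.swap _ _ (verts-map us))

  verts-↭ : ∀ {us ws} → us ↭ ws → verts us ↭ verts ws
  verts-↭ ↭.refl         = ↭-refl
  verts-↭ (↭.prep s p)   = prep _ (prep _ (verts-↭ p))
  verts-↭ (↭.swap s t p) =
    ↭-trans (↭.shifts (s ∷ mate s ∷ []) (t ∷ mate t ∷ [])) (prep _ (prep _ (prep _ (prep _ (verts-↭ p)))))
  verts-↭ (↭.trans p q)  = ↭-trans (verts-↭ p) (verts-↭ q)

  verts-length : ∀ us → length (verts us) ≡ length us + length us
  verts-length []       = refl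
  verts-length (u ∷ us) = cong suc (trans (cong suc (verts-length us)) (sym (ℕ.+-suc (length us) (length us))))

  verts-∈⁻ : ∀ {z} us → z ∈ verts us → z ∈ us ⊎ mate z ∈ us
  verts-∈⁻ (u ∷ us) (here refl)         = inj₁ (here refl)
  verts-∈⁻ (u ∷ us) (there (here refl)) = inj₂ (here (mate² u))
  verts-∈⁻ (u ∷ us) (there (there i))   with verts-∈⁻ us i
  ... | inj₁ j = inj₁ (there j)
  ... | inj₂ j = inj₂ (there j)

  verts-∈ : ∀ {z us} → z ∈ us → z ∈ verts us
  verts-∈ (here refl) = here refl
  verts-∈ (there i)   = there (there (verts-∈ i))

  verts-mate : ∀ {z us} → z ∈ verts us → mate z ∈ verts us
  verts-mate {us = u ∷ us} (here refl)         = there (here refl)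
  verts-mate {us = u ∷ us} (there (here refl)) = here (mate² u)
  verts-mate {us = u ∷ us} (there (there i))   = there (there (verts-mate i))

  verts-covered : ∀ {z us} → Unique (verts us) → z ∈ verts us → mate z ≢ z
  verts-covered {us = u ∷ us} ((a ∷ _) ∷ _) (here refl)         f = a (sym f)
  verts-covered {us = u ∷ us} ((a ∷ _) ∷ _) (there (here refl)) f = a (sym (trans (sym (mate² _)) (trans (cong mate f) (mate² _))))
  verts-covered {us = u ∷ us} (_ ∷ _ ∷ w)   (there (there i))     = verts-covered w i

  Inner⇒Thread : ∀ {p} us {v ws y a b} → Inner p (us ++ v ∷ []) a b → Thread p (us ++ v ∷ ws) y a b
  Inner⇒Thread []       (inj₁ e) = inj₁ e
  Inner⇒Thread (u ∷ us) (inj₁ e) = inj₁ e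
  Inner⇒Thread (u ∷ us) (inj₂ i) = inj₂ (Inner⇒Thread us i)

  Thread-++⁻ : ∀ {p} us {v ws y a b} → Thread p (us ++ v ∷ ws) y a b →
               Thread p us v a b ⊎ Thread (mate v) ws y a b
  Thread-++⁻ []       (inj₁ e) = inj₁ e
  Thread-++⁻ []       (inj₂ e) = inj₂ e
  Thread-++⁻ (u ∷ us) (inj₁ e) = inj₁ (inj₁ e)
  Thread-++⁻ (u ∷ us) (inj₂ t) with Thread-++⁻ us t
  ... | inj₁ s = inj₁ (inj₂ s)
  ... | inj₂ s = inj₂ s

  Thread-++ˡ : ∀ {p} us {v ws y a b} → Thread p us v a b → Thread p (us ++ v ∷ ws) y a b
  Thread-++ˡ []       e        = inj₁ e
  Thread-++ˡ (u ∷ us) (inj₁ e) = inj₁ e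
  Thread-++ˡ (u ∷ us) (inj₂ t) = inj₂ (Thread-++ˡ us t)

  Thread-++ʳ : ∀ {p} us {v ws y a b} → Thread (mate v) ws y a b → Thread p (us ++ v ∷ ws) y a b
  Thread-++ʳ []       t = inj₂ t
  Thread-++ʳ (u ∷ us) t = inj₂ (Thread-++ʳ us t)

  -- Backwards, each matching edge is entered at the end where it was left before.
  Thread-reverse : ∀ {p} us {y a b} → Thread p us y a b → Thread y (reverse (map mate us)) p b a
  Thread-reverse []       (refl , refl) = refl , refl
  Thread-reverse {p} (u ∷ us) {y} {a} {b} t =
    subst (λ l → Thread y l p b a) (sym (List.unfold-reverse (mate u) (map mate us))) (go t)
    where
    go : Thread p (u ∷ us) y a b → Thread y (reverse (map mate us) ++ mate u ∷ []) p b a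
    go (inj₁ (refl , refl)) = Thread-++ʳ (reverse (map mate us)) (sym (mate² u) , refl)
    go (inj₂ t′)            = Thread-++ˡ (reverse (map mate us)) (Thread-reverse us t′)

  reverse-map-mate : ∀ us → reverse (map mate (reverse us)) ≡ map mate us
  reverse-map-mate us = trans (cong reverse (List.reverse-map mate us)) (List.reverse-involutive (map mate us))

  Thread-reverse⁻ : ∀ {p} us {y a b} → Thread y (reverse us) p a b → Thread p (map mate us) y b a
  Thread-reverse⁻ {p} us {y} {a} {b} t =
    subst (λ l → Thread p l y b a) (reverse-map-mate us) (Thread-reverse (reverse us) t)

  Thread-source : ∀ {p} us {y a b} → Thread p us y a b → a ≡ p ⊎ a ∈ verts us
  Thread-source []       (refl , _)        = inj₁ refl
  Thread-source (u ∷ us) (inj₁ (refl , _)) = inj₁ refl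
  Thread-source (u ∷ us) (inj₂ t) with Thread-source us t
  ... | inj₁ refl = inj₂ (there (here refl))
  ... | inj₂ i    = inj₂ (there (there i))

  Thread-target : ∀ {p} us {y a b} → Thread p us y a b → b ≡ y ⊎ b ∈ us
  Thread-target []       (_ , refl)        = inj₁ refl
  Thread-target (u ∷ us) (inj₁ (_ , refl)) = inj₂ (here refl)
  Thread-target (u ∷ us) (inj₂ t) with Thread-target us t
  ... | inj₁ e = inj₁ e
  ... | inj₂ i = inj₂ (there i)

  module _ {m : ℕ} where

    record Valid (E : Fin m → V → V → Set) (S : Strip n m) : Set where
      open Strip S using (as; bs; cols; src; tgt; us)
      field
        src-free : mate src ≡ src
        tgt-free : mate tgt ≡ tgt
        src≢tgt  : src ≢ tgt
        verts!   : Unique (verts us)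
        0<us     : 0 < length us
        as#      : length as ≡ length us
        bs#      : length bs ≡ length us
        cols!    : Unique cols
        A-edges  : ∀ {c a b} → c ∈ as → Thread src us tgt a b → E c a b
        B-edges  : ∀ {c a b} → c ∈ bs → Thread src (map mate us) tgt a b → E c a b

    -- Loops are exempt because contractions create them, matching edges because a generalized badge
    -- may add and delete them at will. `Only` is separated from `Valid` because rainbow walks
    -- through a strip rely on `Valid` alone and are themselves the means of proving `Only`.
    record Only (E : Fin m → V → V → Set) (S : Strip n m) : Set where
      open Strip S using (as; bs; src; tgt; us)
      field
        A-only : ∀ {c a b} → c ∈ as → E c a b → a ≢ b → b ≢ mate a → Touch src us tgt a b
        B-only : ∀ {c a b} → c ∈ bs → E c a b → a ≢ b → b ≢ mate a → Touch src (map mate us) tgt a b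

    -- `flipStrip` reverses `us` without taking mates. The reversed A-thread enters at the mates, so
    -- the two families of colours change places.
    swapStrip flipStrip : Strip n m → Strip n m
    swapStrip S = strip src tgt (map mate us) bs as where open Strip S
    flipStrip S = strip tgt src (reverse us) bs as where open Strip S

    cols-comm : ∀ (S : Strip n m) → Strip.cols S ↭ Strip.bs S ++ Strip.as S
    cols-comm S = ↭.++-comm (Strip.as S) (Strip.bs S)

    module _ {E : Fin m → V → V → Set} {S : Strip n m} where
      open Strip S using (src; tgt; us)

      swap-valid : Valid E S → Valid E (swapStrip S)
      swap-valid v = record
        { src-free = src-free ; tgt-free = tgt-free ; src≢tgt = src≢tgt
        ; verts! = Unique-↭ (↭-sym (verts-map us)) verts!
        ; 0<us = subst (0 <_) (sym (List.length-map mate us)) 0<us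
        ; as# = trans bs# (sym (List.length-map mate us)) ; bs# = trans as# (sym (List.length-map mate us))
        ; cols! = Unique-↭ (cols-comm S) cols!
        ; A-edges = B-edges
        ; B-edges = λ {_} {a} {b} i t → A-edges i (subst (λ l → Thread src l tgt a b) (map-mate² us) t) }
        where open Valid v

      swap-only : Only E S → Only E (swapStrip S)
      swap-only o = record { A-only = B-only
        ; B-only = λ {_} {a} {b} i e ne nm → subst (λ l → Touch src l tgt a b) (sym (map-mate² us)) (A-only i e ne nm) }
        where open Only o

      flip-valid : (∀ {c a b} → E c a b → E c b a) → Valid E S → Valid E (flipStrip S)
      flip-valid E-sym v = record
        { src-free = tgt-free ; tgt-free = src-free ; src≢tgt = λ e → src≢tgt (sym e)
        ; verts! = Unique-↭ (verts-↭ (↭-sym (↭.↭-reverse us))) verts!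
        ; 0<us = subst (0 <_) (sym (List.length-reverse us)) 0<us
        ; as# = trans bs# (sym (List.length-reverse us)) ; bs# = trans as# (sym (List.length-reverse us))
        ; cols! = Unique-↭ (cols-comm S) cols!
        ; A-edges = λ i t → E-sym (B-edges i (Thread-reverse⁻ us t))
        ; B-edges = λ {_} {a} {b} i t → E-sym (A-edges i (subst (λ l → Thread src l tgt b a) (map-mate² us)
            (Thread-reverse⁻ (map mate us) (subst (λ l → Thread tgt l src a b) (List.reverse-map mate us) t)))) }
        where open Valid v

      flip-only : (∀ {c a b} → E c a b → E c b a) → Only E S → Only E (flipStrip S)
      flip-only E-sym o = record
        { A-only = λ i e ne nm → touch-A (B-only i e ne nm)
        ; B-only = λ i e ne nm → touch-B (A-only i e ne nm) }
        where
        open Only o using (A-only; B-only)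
        rev-A : ∀ {a b} → Thread src (map mate us) tgt a b → Thread tgt (reverse us) src b a
        rev-A {a} {b} t = subst (λ l → Thread tgt l src b a) (cong reverse (map-mate² us)) (Thread-reverse (map mate us) t)
        rev-B : ∀ {a b} → Thread src us tgt a b → Thread tgt (map mate (reverse us)) src b a
        rev-B {a} {b} t = subst (λ l → Thread tgt l src b a) (sym (List.reverse-map mate us)) (Thread-reverse us t)
        touch-A : ∀ {a b} → Touch src (map mate us) tgt a b → Touch tgt (reverse us) src a b
        touch-A (inj₁ t) = inj₂ (rev-A t)
        touch-A (inj₂ t) = inj₁ (rev-A t)
        touch-B : ∀ {a b} → Touch src us tgt a b → Touch tgt (map mate (reverse us)) src a b
        touch-B (inj₁ t) = inj₂ (rev-B t)
        touch-B (inj₂ t) = inj₁ (rev-B t)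

-- Rainbow walks inside strips

pick : {X : Set} {xs : List X} (k l : ℕ) → Unique xs → k + l ≤ length xs →
       ∃[ es ] ∃[ fs ] (Unique es × Unique fs × es ⊑ xs × fs ⊑ xs × length es ≡ k × length fs ≡ l ×
                        (∀ {z} → z ∈ es → z ∉ fs))
pick {xs = xs} k l u h with Unique-++⁻ (take k xs) (subst Unique (sym (List.take++drop≡id k xs)) u)
... | es! , ds! , dis with Unique-++⁻ (take l (drop k xs)) (subst Unique (sym (List.take++drop≡id l (drop k xs))) ds!)
... | fs! , _ = take k xs , take l (drop k xs) , es! , fs! , take⊑ k xs , (λ i → drop⊑ (take⊑ l (drop k xs) i)) ,
    trans (List.length-take k xs) (ℕ.m≤n⇒m⊓n≡m (ℕ.m+n≤o⇒m≤o k h)) ,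
    trans (List.length-take l (drop k xs)) (ℕ.m≤n⇒m⊓n≡m
      (subst (l ≤_) (sym (List.length-drop k xs)) (ℕ.m+n≤o⇒m≤o∸n l (subst (_≤ length xs) (ℕ.+-comm k l) h)))) ,
    λ i j → dis i (take⊑ l (drop k xs) j)
  where
  take⊑ : ∀ {X : Set} k (xs : List X) → take k xs ⊑ xs
  take⊑ k xs i = subst (_ ∈_) (List.take++drop≡id k xs) (∈.∈-++⁺ˡ i)
  drop⊑ : drop k xs ⊑ xs
  drop⊑ i = subst (_ ∈_) (List.take++drop≡id k xs) (∈.∈-++⁺ʳ (take k xs) i)

pick-avoid : ∀ {m} {xs : List (Fin m)} (j : Fin m) (k l : ℕ) → Unique xs → suc (k + l) ≤ length xs →
             ∃[ es ] ∃[ fs ] (Unique es × Unique fs × es ⊑ xs × fs ⊑ xs × length es ≡ k × length fs ≡ l ×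
                              (∀ {z} → z ∈ es → z ∉ fs) × j ∉ es × j ∉ fs)
pick-avoid {xs = xs} j k l u h with mem? Fin._≟_ j xs
... | no j∉ with pick k l u (ℕ.<⇒≤ h)
... | es , fs , a , b , c , d , e , f , g = es , fs , a , b , c , d , e , f , g , (λ i → j∉ (c i)) , (λ i → j∉ (d i))
pick-avoid {xs = xs} j k l u h | yes j∈ with remove j∈
... | ys , σ with Unique-↭ σ u
... | u′@(_ ∷ ys!) with pick k l ys! (ℕ.≤-pred (subst (suc (k + l) ≤_) (↭.↭-length σ) h))
... | es , fs , a , b , c , d , e , f , g =
  es , fs , a , b , (λ i → ↭.∈-resp-↭ (↭-sym σ) (there (c i))) , (λ i → ↭.∈-resp-↭ (↭-sym σ) (there (d i))) ,
  e , f , g , (λ i → ∉-head u′ (c i)) , (λ i → ∉-head u′ (d i))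

module Reaching {n m : ℕ} (𝒮 : System n m) where
  open Alternating 𝒮 using (Free; Rainbow; Reach; bridge; edge; edge-sym; here; mate; mate-injective; mate²; step)
  open Threads mate mate² using (Inner; Inner⇒Thread; Thread; Valid; cols-comm; flip-valid; stop; stop-snoc; swap-valid; verts; verts-++; verts-map; verts-↭; verts-∈⁻)

  private
    V = Fin n
    C = Fin m

  stay : ∀ {r} → Reach r r [] []
  stay = record { walk = here ; cs! = [] ; vs! = [] ; cs⊑ = ∈-[] ; vs⊑ = ∈-[] }

  widen : ∀ {r z es es′ zs zs′} → Reach r z es zs → es ⊑ es′ → zs ⊑ zs′ → Reach r z es′ zs′
  widen R s s′ = record { walk = walk ; cs! = cs! ; vs! = vs! ; cs⊑ = λ i → s (cs⊑ i) ; vs⊑ = λ i → s′ (vs⊑ i) }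
    where open Reach R

  extend : ∀ {r p q e es zs} → Reach r p es zs → edge e p q → e ∉ es → ¬ Free q → q ∉ zs → mate q ∉ zs →
           Reach r (mate q) (e ∷ es) (q ∷ mate q ∷ zs)
  extend R e e∉ q-cov q∉ q′∉ = record
    { walk = step walk e refl
    ; cs! = Unique-∷ (λ i → e∉ (cs⊑ i)) cs!
    ; vs! = Unique-∷ ((λ f → q-cov (sym f)) ∷∉ (λ i → q∉ (vs⊑ i))) (Unique-∷ (λ i → q′∉ (vs⊑ i)) vs!)
    ; cs⊑ = (here refl ∷⊑ (λ i → there (cs⊑ i)))
    ; vs⊑ = (here refl ∷⊑ there (here refl) ∷⊑ (λ i → there (there (vs⊑ i)))) }
    where open Reach R

  close : ∀ {cs x y p q e es fs zs ws} → Free x → Free y → x ≢ y →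
          Reach x p es zs → Reach y q fs ws → edge e p q → e ∈ cs → e ∉ es → e ∉ fs →
          es ⊑ cs → fs ⊑ cs → (∀ {c} → c ∈ es → c ∉ fs) → (∀ {z} → z ∈ zs → z ∉ ws) → Rainbow cs
  close {x = x} {y} fx fy x≢y R R′ e e∈ e∉ e∉′ s s′ dis dis′ =
    x , y , _ , bridge P.walk e Q.walk fx fy x≢y (Unique-++ P.vs! Q.vs! (λ i j → dis′ (P.vs⊑ i) (Q.vs⊑ j))) ,
    (e∈ ∷⊑ (λ i → [ (λ j → s (P.cs⊑ j)) , (λ j → s′ (Q.cs⊑ j)) ]′ (∈.∈-++⁻ P.cs i))) ,
    Unique-∷ (λ i → [ (λ j → e∉ (P.cs⊑ j)) , (λ j → e∉′ (Q.cs⊑ j)) ]′ (∈.∈-++⁻ P.cs i))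
      (Unique-++ P.cs! Q.cs! (λ i j → dis (P.cs⊑ i) (Q.cs⊑ j)))
    where
    module P = Reach R using (cs; cs!; cs⊑; vs!; vs⊑; walk)
    module Q = Reach R′ using (cs!; cs⊑; vs!; vs⊑; walk)

  along : ∀ {r p es₀ zs₀} us es → length es ≡ length us → Reach r p es₀ zs₀ →
          (∀ {e a b} → e ∈ es → Inner p us a b → edge e a b) → Unique es → (∀ {c} → c ∈ es → c ∉ es₀) →
          Unique (verts us) → (∀ {z} → z ∈ verts us → z ∉ zs₀) →
          Reach r (stop p us) (es ++ es₀) (verts us ++ zs₀)
  along []       []       l R E _ _ _ _ = R
  along {p = p} {es₀} {zs₀} (u ∷ us) (e ∷ es) l R E es!@(_ ∷ es′!) dis us!@((a ∷ a′) ∷ b ∷ us′!) dis′ =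
    widen (along us es (ℕ.suc-injective l)
            (extend R (E (here refl) (inj₁ (refl , refl))) (dis (here refl)) (λ f → a (sym f))
               (dis′ (here refl)) (dis′ (there (here refl))))
            (λ i t → E (there i) (inj₂ t)) es′!
            (λ { i (here refl) → ∉-head es! i ; i (there j) → dis (there i) j })
            us′!
            (λ { i (here refl) → All.lookup a′ i refl ; i (there (here refl)) → All.lookup b i refl
               ; i (there (there j)) → dis′ (there (there i)) j }))
      (λ i → ↭.∈-resp-↭ (↭.shift e es es₀) i)
      (λ i → ↭.∈-resp-↭ (↭.shifts (verts us) (u ∷ mate u ∷ [])) i)

  prefix : ∀ {r p es₀ zs₀} us v es → length es ≡ suc (length us) → Reach r p es₀ zs₀ →
           (∀ {e a b} → e ∈ es → Inner p (us ++ v ∷ []) a b → edge e a b) → Unique es → (∀ {c} → c ∈ es → c ∉ es₀) →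
           Unique (verts (us ++ v ∷ [])) → (∀ {z} → z ∈ verts (us ++ v ∷ []) → z ∉ zs₀) →
           Reach r (mate v) (es ++ es₀) (verts (us ++ v ∷ []) ++ zs₀)
  prefix {r} {p} us v es l R E es! dis us! dis′ =
    subst (λ w → Reach r w _ _) (stop-snoc us)
      (along (us ++ v ∷ []) es (trans l (trans (ℕ.+-comm 1 (length us)) (sym (List.length-++ us)))) R E es! dis us! dis′)

  verts-prefix : ∀ {us us₁ us₂ z} → us ≡ us₁ ++ z ∷ us₂ → verts us ≡ verts (us₁ ++ z ∷ []) ++ verts us₂
  verts-prefix {us₁ = us₁} {us₂} {z} refl =
    trans (cong verts (sym (List.++-assoc us₁ (z ∷ []) us₂))) (verts-++ (us₁ ++ z ∷ []) us₂)

  -- The B-thread enters every matching edge at its end outside `us` and leaves it at its end in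
  -- `us`. So it reaches `z` at the price of one colour of `bs` for each matching edge up to that of
  -- `z`.
  near : ∀ {S z us₁ us₂ es} → Valid edge S → let open Strip S in us ≡ us₁ ++ z ∷ us₂ →
         Unique es → es ⊑ bs → length es ≡ suc (length us₁) → Reach src z es (verts (us₁ ++ z ∷ []))
  near {S} {z} {us₁} {us₂} {es} v refl es! s l = widen
    (subst (λ w → Reach src w (es ++ []) (verts (map mate us₁ ++ mate z ∷ []) ++ [])) (mate² z)
      (prefix (map mate us₁) (mate z) es (trans l (cong suc (sym (List.length-map mate us₁)))) stay
        (λ {e} {a} {b} i t → B-edges (s i) (subst (λ l → Thread src l tgt a b) (sym map-eq)
            (Inner⇒Thread (map mate us₁) t)))
        es! (λ _ → ∈-[]) (Unique-↭ (↭-sym τ) zs!) (λ _ → ∈-[])))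
    (λ i → [ (λ j → j) , ∈-[] ]′ (∈.∈-++⁻ es i))
    (λ i → [ (λ j → ↭.∈-resp-↭ τ j) , ∈-[] ]′ (∈.∈-++⁻ (verts (map mate us₁ ++ mate z ∷ [])) i))
    where
    open Strip S using (bs; src; tgt; us)
    open Valid v using (B-edges; verts!)
    map-eq : map mate (us₁ ++ z ∷ us₂) ≡ map mate us₁ ++ mate z ∷ map mate us₂
    map-eq = List.map-++ mate us₁ (z ∷ us₂)
    τ : verts (map mate us₁ ++ mate z ∷ []) ↭ verts (us₁ ++ z ∷ [])
    τ = subst (λ l → verts l ↭ verts (us₁ ++ z ∷ [])) (List.map-++ mate us₁ (z ∷ [])) (verts-map (us₁ ++ z ∷ []))
    zs! : Unique (verts (us₁ ++ z ∷ []))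
    zs! = proj₁ (Unique-++⁻ (verts (us₁ ++ z ∷ [])) (subst Unique (verts-prefix {us₁ = us₁} refl) verts!))

  -- `near` on the flipped strip. From the far end it is the colours `as` that reach a vertex of
  -- `us`, hence walks to it from the two ends use different families.
  far : ∀ {S z us₁ us₂ es} → Valid edge S → let open Strip S in us ≡ us₁ ++ z ∷ us₂ →
        Unique es → es ⊑ as → length es ≡ suc (length us₂) → Reach tgt z es (verts (z ∷ us₂))
  far {S} {z} {us₁} {us₂} {es} v refl es! s l = widen
    (near {us₁ = reverse us₂} {us₂ = reverse us₁} (flip-valid edge-sym v) rev es! s
      (trans l (cong suc (sym (List.length-reverse us₂)))))
    (λ i → i) (λ i → ↭.∈-resp-↭ (verts-↭ σ) i)
    where
    rev : reverse (us₁ ++ z ∷ us₂) ≡ reverse us₂ ++ z ∷ reverse us₁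
    rev = trans (List.reverse-++ us₁ (z ∷ us₂)) (trans (cong (_++ reverse us₁) (List.unfold-reverse z us₂))
            (List.++-assoc (reverse us₂) (z ∷ []) (reverse us₁)))
    σ : reverse us₂ ++ z ∷ [] ↭ z ∷ us₂
    σ = ↭-trans (↭.++-comm (reverse us₂) (z ∷ [])) (prep z (↭.↭-reverse us₂))

  length-at : ∀ {us us₁ us₂ : List V} {z} → us ≡ us₁ ++ z ∷ us₂ → length us ≡ length us₁ + suc (length us₂)
  length-at {us₁ = us₁} refl = List.length-++ us₁

  -- The exceptional pairs: from the far end `z` is reached only with all colours of the family of
  -- `j`, so that `j` cannot be spared.
  HeadOf : Strip n m → C → V → Set
  HeadOf S j z = (j ∈ as × ∃[ us′ ] us ≡ z ∷ us′) ⊎ (j ∈ bs × ∃[ us′ ] map mate us ≡ z ∷ us′)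
    where open Strip S

  Avoiding : V → V → C → List C → List V → Set
  Avoiding r z j cs zs = ∃[ es ] (Reach r z es zs × es ⊑ cs × j ∉ es)

  verts-suffix : ∀ us₁ {z us₂} → verts (z ∷ us₂) ⊑ verts (us₁ ++ z ∷ us₂)
  verts-suffix us₁ i = subst (_ ∈_) (sym (verts-++ us₁ _)) (∈.∈-++⁺ʳ (verts us₁) i)

  module _ {S : Strip n m} (v : Valid edge S) where
    open Strip S using (as; bs; tgt; us)
    open Valid v using (as#; cols!)

    as! : Unique as
    as! = proj₁ (Unique-++⁻ as cols!)

    bs! : Unique bs
    bs! = proj₁ (proj₂ (Unique-++⁻ as cols!))

    as∩bs : ∀ {c} → c ∈ as → c ∉ bs
    as∩bs = proj₂ (proj₂ (Unique-++⁻ as cols!))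

    to-tgt-us : ∀ {z} j → z ∈ us → Avoiding tgt z j as (verts us) ⊎ (j ∈ as × ∃[ us′ ] us ≡ z ∷ us′)
    to-tgt-us {z} j z∈ with ∈.∈-∃++ z∈ | mem? Fin._≟_ j as
    ... | us₁ , us₂ , eq | no j∉ with pick {xs = as} (suc (length us₂)) 0 as!
          (subst₂ _≤_ (sym (ℕ.+-identityʳ _)) (sym (trans as# (length-at {us₁ = us₁} eq))) (ℕ.m≤n+m _ (length us₁)))
    ... | es , _ , es! , _ , s , _ , l , _ =
      inj₁ (es , widen (far v eq es! s l) (λ i → i) (λ i → subst (λ w → _ ∈ verts w) (sym eq) (verts-suffix us₁ i)) ,
            s , λ i → j∉ (s i))
    to-tgt-us {z} j z∈ | []       , us₂ , eq | yes j∈ = inj₂ (j∈ , us₂ , eq)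
    to-tgt-us {z} j z∈ | u₀ ∷ us₁ , us₂ , eq | yes j∈ with pick-avoid {xs = as} j (suc (length us₂)) 0 as!
          (subst₂ _≤_ (cong suc (sym (ℕ.+-identityʳ _))) (sym (trans as# (length-at {us₁ = u₀ ∷ us₁} eq)))
            (s≤s (ℕ.m≤n+m _ (length us₁))))
    ... | es , _ , es! , _ , s , _ , l , _ , _ , j∉ , _ =
      inj₁ (es , widen (far {us₁ = u₀ ∷ us₁} v eq es! s l) (λ i → i) (λ i → subst (λ w → _ ∈ verts w) (sym eq) (verts-suffix (u₀ ∷ us₁) i)) ,
            s , j∉)

    -- Behind the first matching edge at least one colour of the family is left over, and `j` can be
    -- the one.
    beyond-us : ∀ {u us′ z} j → us ≡ u ∷ us′ → z ∈ us′ → Avoiding tgt z j as (verts us′)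
    beyond-us {u} {us′} {z} j eq z∈ with ∈.∈-∃++ z∈
    ... | us₁ , us₂ , refl with pick-avoid {xs = as} j (suc (length us₂)) 0 as!
          (subst₂ _≤_ (cong suc (sym (ℕ.+-identityʳ _))) (sym (trans as# (length-at {us₁ = u ∷ us₁} eq)))
            (s≤s (ℕ.m≤n+m _ (length us₁))))
    ... | es , _ , es! , _ , s , _ , l , _ , _ , j∉ , _ =
      es , widen (far {us₁ = u ∷ us₁} v eq es! s l) (λ i → i) (λ i → verts-suffix us₁ i) , s , j∉

  private
    map-∈ : ∀ {z : V} {us} → mate z ∈ us → z ∈ map mate us
    map-∈ {z} {us} i = subst (_∈ map mate us) (mate² z) (∈.∈-map⁺ mate i)

  module _ {S : Strip n m} (v : Valid edge S) where
    open Strip S using (as; bs; cols; tgt; us)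
    open Valid v using (as#; bs#)

    to-tgt-avoid : ∀ {z} j → z ∈ verts us → Avoiding tgt z j cols (verts us) ⊎ HeadOf S j z
    to-tgt-avoid {z} j z∈ with verts-∈⁻ us z∈
    ... | inj₁ i with to-tgt-us v j i
    ... | inj₁ (es , R , s , j∉) = inj₁ (es , R , (λ k → ∈.∈-++⁺ˡ (s k)) , j∉)
    ... | inj₂ h = inj₂ (inj₁ h)
    to-tgt-avoid {z} j z∈ | inj₂ i with to-tgt-us (swap-valid v) j (map-∈ i)
    ... | inj₁ (es , R , s , j∉) =
      inj₁ (es , widen R (λ k → k) (λ k → ↭.∈-resp-↭ (verts-map us) k) , (λ k → ∈.∈-++⁺ʳ as (s k)) , j∉)
    ... | inj₂ h = inj₂ (inj₂ h)

    beyond : ∀ {u us′ z} j → us ≡ u ∷ us′ → z ∈ verts us′ → Avoiding tgt z j cols (verts us′)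
    beyond {u} {us′} {z} j eq z∈ with verts-∈⁻ us′ z∈
    ... | inj₁ i with beyond-us v j eq i
    ... | es , R , s , j∉ = es , R , (λ k → ∈.∈-++⁺ˡ (s k)) , j∉
    beyond {u} {us′} {z} j eq z∈ | inj₂ i with beyond-us (swap-valid v) j (cong (map mate) eq) (map-∈ i)
    ... | es , R , s , j∉ =
      es , widen R (λ k → k) (λ k → ↭.∈-resp-↭ (verts-map us′) k) , (λ k → ∈.∈-++⁺ʳ as (s k)) , j∉

    to-tgt : ∀ {z} → z ∈ verts us → Reach tgt z cols (verts us)
    to-tgt {z} z∈ with verts-∈⁻ us z∈
    ... | inj₁ i with ∈.∈-∃++ i
    ... | us₁ , us₂ , eq with pick {xs = as} (suc (length us₂)) 0 (as! v)
          (subst₂ _≤_ (sym (ℕ.+-identityʳ _)) (sym (trans as# (length-at {us₁ = us₁} eq))) (ℕ.m≤n+m _ (length us₁)))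
    ... | es , _ , es! , _ , s , _ , l , _ =
      widen (far v eq es! s l) (λ k → ∈.∈-++⁺ˡ (s k)) (λ k → subst (λ w → _ ∈ verts w) (sym eq) (verts-suffix us₁ k))
    to-tgt {z} z∈ | inj₂ i with ∈.∈-∃++ (map-∈ i)
    ... | us₁ , us₂ , eq with pick {xs = bs} (suc (length us₂)) 0 (bs! v)
          (subst₂ _≤_ (sym (ℕ.+-identityʳ _)) (sym (trans bs# (trans (sym (List.length-map mate us)) (length-at {us₁ = us₁} eq)))) (ℕ.m≤n+m _ (length us₁)))
    ... | es , _ , es! , _ , s , _ , l , _ =
      widen (far (swap-valid v) eq es! s l) (λ k → ∈.∈-++⁺ʳ as (s k))
        (λ k → ↭.∈-resp-↭ (verts-map us) (subst (λ w → _ ∈ verts w) (sym eq) (verts-suffix us₁ k)))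

  to-src : ∀ {S} (v : Valid edge S) {z} → let open Strip S in z ∈ verts us → Reach src z cols (verts us)
  to-src {S} v z∈ = widen (to-tgt (flip-valid edge-sym v) (↭.∈-resp-↭ (verts-↭ (↭-sym (↭.↭-reverse us))) z∈))
      (λ i → ↭.∈-resp-↭ (↭-sym (cols-comm S)) i) (λ i → ↭.∈-resp-↭ (verts-↭ (↭.↭-reverse us)) i)
    where open Strip S

  HeadOf-cols : ∀ S {j z} → HeadOf S j z → j ∈ Strip.cols S
  HeadOf-cols S (inj₁ (i , _)) = ∈.∈-++⁺ˡ i
  HeadOf-cols S (inj₂ (i , _)) = ∈.∈-++⁺ʳ (Strip.as S) i

  private
    pre : ∀ {z : V} {us} → verts (z ∷ []) ⊑ verts (z ∷ us)
    pre (here e)         = here e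
    pre (there (here e)) = there (here e)

  -- From the near end a head costs a single colour, and that of the other family.
  head-near : ∀ {S j z} → Valid edge S → HeadOf S j z → Avoiding (Strip.src S) z j (Strip.cols S) (verts (Strip.us S))
  head-near {S} {j} v (inj₁ (j∈ , us′ , eq)) with pick {xs = Strip.bs S} 1 0 (bs! v) (subst (1 ≤_) (sym (Valid.bs# v)) (Valid.0<us v))
  ... | es , _ , es! , _ , s , _ , l , _ =
    es , widen (near {us₁ = []} v eq es! s l) (λ i → i)
      (λ i → subst (λ w → _ ∈ verts w) (sym eq) (pre i)) ,
    (λ i → ∈.∈-++⁺ʳ (Strip.as S) (s i)) , λ i → as∩bs v j∈ (s i)
  head-near {S} {j} v (inj₂ (j∈ , us′ , eq)) with pick {xs = Strip.as S} 1 0 (as! v) (subst (1 ≤_) (sym (Valid.as# v)) (Valid.0<us v))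
  ... | es , _ , es! , _ , s , _ , l , _ =
    es , widen (near {us₁ = []} (swap-valid v) eq es! s l) (λ i → i)
      (λ i → ↭.∈-resp-↭ (verts-map (Strip.us S)) (subst (λ w → _ ∈ verts w) (sym eq) (pre i))) ,
    (λ i → ∈.∈-++⁺ˡ (s i)) , λ i → as∩bs v (s i) j∈

  -- Orders the matching edges of `p` and `q` along the strip; `p′` and `q′` are their ends in `us`,
  -- so each of `p` and `q` may lie on either side.
  record Ordered (us : List V) (p q : V) : Set where
    field
      {us₁ ws us₂} : List V
      {p′ q′}      : V
      split        : us ≡ us₁ ++ p′ ∷ ws ++ q′ ∷ us₂
      p≈           : p′ ≡ p ⊎ p′ ≡ mate p
      q≈           : q′ ≡ q ⊎ q′ ≡ mate q

  private
    rep : ∀ {z} us → z ∈ verts us → ∃[ z′ ] (z′ ∈ us × (z′ ≡ z ⊎ z′ ≡ mate z))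
    rep us i with verts-∈⁻ us i
    ... | inj₁ j = _ , j , inj₁ refl
    ... | inj₂ j = _ , j , inj₂ refl

    rep-≢ : ∀ {p q p′ q′} → q ≢ p → q ≢ mate p → (p′ ≡ p ⊎ p′ ≡ mate p) → (q′ ≡ q ⊎ q′ ≡ mate q) → q′ ≢ p′
    rep-≢ n n′ (inj₁ refl) (inj₁ refl) e = n e
    rep-≢ n n′ (inj₁ refl) (inj₂ refl) e = n′ (trans (sym (mate² _)) (cong mate e))
    rep-≢ n n′ (inj₂ refl) (inj₁ refl) e = n′ e
    rep-≢ n n′ (inj₂ refl) (inj₂ refl) e = n (mate-injective e)

  order-in : ∀ {us p q} → p ∈ verts us → q ∈ verts us → q ≢ p → q ≢ mate p → Ordered us p q ⊎ Ordered us q p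
  order-in {us} p∈ q∈ n n′ with rep us p∈ | rep us q∈
  ... | p′ , p′∈ , p≈ | q′ , q′∈ , q≈ with ∈.∈-∃++ p′∈
  ... | us₁ , us₂ , refl with ∈.∈-++⁻ us₁ q′∈
  ... | inj₂ (here e) = ⊥-elim (rep-≢ n n′ p≈ q≈ e)
  ... | inj₂ (there i) with ∈.∈-∃++ i
  ... | ws , us₃ , refl = inj₁ (record { split = refl ; p≈ = p≈ ; q≈ = q≈ })
  order-in {us} p∈ q∈ n n′ | p′ , p′∈ , p≈ | q′ , q′∈ , q≈ | us₁ , us₂ , refl | inj₁ i with ∈.∈-∃++ i
  ... | us₃ , ws , refl = inj₂ (record { split = List.++-assoc us₃ (q′ ∷ ws) _ ; p≈ = q≈ ; q≈ = p≈ })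

  split-disjoint : ∀ {us us₁ p ws q us₂} → Unique (verts us) → us ≡ us₁ ++ p ∷ ws ++ q ∷ us₂ →
                   ∀ {z} → z ∈ verts (us₁ ++ p ∷ []) → z ∉ verts (q ∷ us₂)
  split-disjoint {us₁ = us₁} {p} {ws} {q} {us₂} u refl i j =
    proj₂ (proj₂ (Unique-++⁻ (verts (us₁ ++ p ∷ [])) (subst Unique (verts-prefix {us₁ = us₁} refl) u))) i
      (verts-suffix ws j)

  split-length : ∀ {us us₁ ws us₂ : List V} {p q} → us ≡ us₁ ++ p ∷ ws ++ q ∷ us₂ →
                 length us ≡ suc (length us₁) + (length ws + suc (length us₂))
  split-length {us₁ = us₁} {ws} refl =
    trans (List.length-++ us₁) (trans (ℕ.+-suc (length us₁) _) (cong (λ k → suc (length us₁ + k)) (List.length-++ ws)))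

  ordered-swap : ∀ {us p q} → Ordered us p q → Ordered (map mate us) p q
  ordered-swap O = record
    { us₁ = map mate us₁ ; ws = map mate ws ; us₂ = map mate us₂ ; p′ = mate p′ ; q′ = mate q′
    ; split = trans (cong (map mate) split) (trans (List.map-++ mate us₁ _)
                (cong (λ l → map mate us₁ ++ mate p′ ∷ l) (List.map-++ mate ws _)))
    ; p≈ = flip≈ p≈ ; q≈ = flip≈ q≈ }
    where
    open Ordered O
    flip≈ : ∀ {a b} → a ≡ b ⊎ a ≡ mate b → mate a ≡ b ⊎ mate a ≡ mate b
    flip≈ (inj₁ refl) = inj₂ refl
    flip≈ (inj₂ refl) = inj₁ (mate² _)

  module _ {S : Strip n m} (v : Valid edge S) {cs : List C} (⊑cs : Strip.cols S ⊑ cs) where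
    open Strip S using (as; bs; cols; tgt; us)
    open Valid v using (as#; bs#; src-free; src≢tgt; tgt-free; verts!)

    -- For `p` in `us` the walk from the near end uses `bs`. The walk from the far end to `q` uses
    -- `as` or again `bs`; in the second case the two shares fit because the matching edges up to
    -- `p` and those from `q` on are disjoint.
    close-ordered-us : ∀ {p q e} (O : Ordered us p q) → Ordered.p′ O ≡ p → edge e p q → e ∈ cs → e ∉ cols → Rainbow cs
    close-ordered-us {p} {q} {e} record { us₁ = us₁ ; ws = ws ; us₂ = us₂ ; split = split ; q≈ = inj₁ refl } refl pq e∈ e∉
      with pick {xs = bs} (suc (length us₁)) 0 (bs! v)
             (subst₂ _≤_ (sym (ℕ.+-identityʳ _)) (sym (trans bs# (split-length {us₁ = us₁} {ws} split))) (ℕ.m≤m+n _ _))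
         | pick {xs = as} (suc (length us₂)) 0 (as! v)
             (subst₂ _≤_ (sym (ℕ.+-identityʳ _)) (sym (trans as# (split-length {us₁ = us₁} {ws} split)))
               (ℕ.≤-trans (ℕ.m≤n+m _ (length ws)) (ℕ.m≤n+m _ (suc (length us₁)))))
    ... | es , _ , es! , _ , s , _ , l , _ | fs , _ , fs! , _ , s′ , _ , l′ , _ =
      close src-free tgt-free src≢tgt (near v split es! s l) (far {us₁ = us₁ ++ p ∷ ws} v (trans split (sym (List.++-assoc us₁ (p ∷ ws) _))) fs! s′ l′)
        pq e∈ (λ i → e∉ (∈.∈-++⁺ʳ as (s i))) (λ i → e∉ (∈.∈-++⁺ˡ (s′ i)))
        (λ i → ⊑cs (∈.∈-++⁺ʳ as (s i))) (λ i → ⊑cs (∈.∈-++⁺ˡ (s′ i)))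
        (λ i j → as∩bs v (s′ j) (s i)) (split-disjoint {us₁ = us₁} {ws = ws} verts! split)
    close-ordered-us {p} {q} {e} record { us₁ = us₁ ; ws = ws ; us₂ = us₂ ; split = split ; q≈ = inj₂ refl } refl pq e∈ e∉
      with pick {xs = bs} (suc (length us₁)) (suc (length us₂)) (bs! v)
             (subst (_ ≤_) (sym (trans bs# (split-length {us₁ = us₁} {ws} split)))
               (ℕ.+-monoʳ-≤ (suc (length us₁)) (ℕ.m≤n+m _ (length ws))))
    ... | es , fs , es! , fs! , s , s′ , l , l′ , dis =
      close src-free tgt-free src≢tgt (near v split es! s l)
        (subst (λ w → Reach tgt w fs (verts (w ∷ map mate us₂))) (mate² q)
          (far {us₁ = map mate (us₁ ++ p ∷ ws)} (swap-valid v) split′ fs! s′ (trans l′ (cong suc (sym (List.length-map mate us₂))))))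
        pq e∈ (λ i → e∉ (∈.∈-++⁺ʳ as (s i))) (λ i → e∉ (∈.∈-++⁺ʳ as (s′ i)))
        (λ i → ⊑cs (∈.∈-++⁺ʳ as (s i))) (λ i → ⊑cs (∈.∈-++⁺ʳ as (s′ i)))
        dis (λ i j → split-disjoint {us₁ = us₁} {ws = ws} verts! split i (↭.∈-resp-↭ (verts-map (mate q ∷ us₂))
               (subst (λ w → _ ∈ verts (w ∷ map mate us₂)) (sym (mate² q)) j)))
      where
      split′ : map mate us ≡ map mate (us₁ ++ p ∷ ws) ++ mate (mate q) ∷ map mate us₂
      split′ = trans (cong (map mate) (trans split (sym (List.++-assoc us₁ (p ∷ ws) _)))) (List.map-++ mate (us₁ ++ p ∷ ws) _)

  close-ordered : ∀ {S p q e cs} → Valid edge S → Strip.cols S ⊑ cs → Ordered (Strip.us S) p q →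
                  edge e p q → e ∈ cs → e ∉ Strip.cols S → Rainbow cs
  close-ordered {S} v s O@record { p≈ = inj₁ p≡ } pq e∈ e∉ = close-ordered-us v s O p≡ pq e∈ e∉
  close-ordered {S} v s O@record { p≈ = inj₂ p≡ } pq e∈ e∉ =
    close-ordered-us (swap-valid v) (λ i → s (↭.∈-resp-↭ (↭-sym (cols-comm S)) i)) (ordered-swap O)
      (trans (cong mate p≡) (mate² _)) pq e∈ (λ i → e∉ (↭.∈-resp-↭ (↭-sym (cols-comm S)) i))

  close-within : ∀ {S p q e cs} → Valid edge S → Strip.cols S ⊑ cs → p ∈ verts (Strip.us S) → q ∈ verts (Strip.us S) →
                 p ≢ q → q ≢ mate p → edge e p q → e ∈ cs → e ∉ Strip.cols S → Rainbow cs
  close-within v s p∈ q∈ n n′ pq e∈ e∉ with order-in p∈ q∈ (λ e → n (sym e)) n′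
  ... | inj₁ O = close-ordered v s O pq e∈ e∉
  ... | inj₂ O = close-ordered v s O (edge-sym pq) e∈ e∉

-- Decompositions into strips, and the situation after contracting a triangle

weight : ∀ {n m h} → (Fin h → Strip n m) → ℕ
weight {h = h} S = sum (map (λ i → length (Strip.us (S i))) (allFin h))

-- The badge together with the colours `Js` of J. The field `total`, combined with m = 2k + t,
-- yields that the badge has size k.
record Decomposition {n m : ℕ} (𝒮 : System n m) (cs : List (Fin m)) (t : ℕ) : Set where
  open Alternating 𝒮 using (Free; edge; mate; mate²)
  open Threads mate mate² using (Only; Valid; verts)
  field
    Js    : List (Fin m)
    Js!   : Unique Js
    Js#   : length Js ≡ t
    Js⊑   : Js ⊑ cs
    Js-pure : ∀ {j a b} → j ∈ Js → edge j a b → a ≢ b → b ≡ mate a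
    h     : ℕ
    S     : Fin h → Strip n m
    valid : ∀ i → Valid edge (S i)
    only  : ∀ i → Only edge (S i)
  vertsOf : Fin h → List (Fin n)
  vertsOf i = verts (Strip.us (S i))
  colsOf : Fin h → List (Fin m)
  colsOf i = Strip.cols (S i)
  field
    verts-disjoint : ∀ {i j z} → z ∈ vertsOf i → z ∈ vertsOf j → i ≡ j
    cols-disjoint  : ∀ {i j e} → e ∈ colsOf i → e ∈ colsOf j → i ≡ j
    cover   : ∀ {z} → ¬ Free z → ∃[ i ] z ∈ vertsOf i
    cols⊑   : ∀ i → colsOf i ⊑ cs
    Js∩cols : ∀ {i e} → e ∈ Js → e ∉ colsOf i
    palette : ∀ {e} → e ∈ cs → e ∈ Js ⊎ ∃[ i ] e ∈ colsOf i
    total   : length cs ≡ t + (weight S + weight S)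

-- The situation after contracting the triangle x, u, v = mate u, whose edges xu and xv
-- have the colours c and d: the strips of the badge of the contraction (π maps the
-- triangle to x), oriented so that x can only be their first end.
record Setup {n m : ℕ} (𝒮 : System n m) (cs : List (Fin m)) (t : ℕ)
             (x u v : Fin n) (c d : Fin m) : Set where
  no-eta-equality
  open Alternating 𝒮 using (Free; Rainbow; Rich; edge; mate; mate²)
  open Threads mate mate² using (Only; Valid; verts)
  field
    rich  : Rich t cs
    none  : ¬ Rainbow cs
    x-free : Free x
    uv    : mate u ≡ v
    vu    : mate v ≡ u
    u-cov : ¬ Free u
    v-cov : ¬ Free v
    c≢d   : c ≢ d
    c∈    : c ∈ cs
    d∈    : d ∈ cs
    xu    : edge c x u
    xv    : edge d x v
    π     : Fin n → Fin n
    π-u   : π u ≡ x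
    π-v   : π v ≡ x
    π-out : ∀ {a} → a ≢ u → a ≢ v → π a ≡ a
  L : Fin m → Fin n → Fin n → Set
  L e a b = ∃[ a′ ] ∃[ b′ ] (π a′ ≡ a × π b′ ≡ b × edge e a′ b′)
  field
    Js    : List (Fin m)
    Js!   : Unique Js
    Js#   : length Js ≡ t
    Js⊑   : Js ⊑ cs
    c∉Js  : c ∉ Js
    d∉Js  : d ∉ Js
    Js-pure : ∀ {j a b} → j ∈ Js → edge j a b → π a ≢ π b → π b ≡ mate (π a)
    h     : ℕ
    S     : Fin h → Strip n m
    valid : ∀ i → Valid L (S i)
    only  : ∀ i → Only L (S i)
    tgt≢x : ∀ i → Strip.tgt (S i) ≢ x
  vertsOf : Fin h → List (Fin n)
  vertsOf i = verts (Strip.us (S i))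
  colsOf : Fin h → List (Fin m)
  colsOf i = Strip.cols (S i)
  field
    u∉verts : ∀ i → u ∉ vertsOf i
    v∉verts : ∀ i → v ∉ vertsOf i
    verts-disjoint : ∀ {i j z} → z ∈ vertsOf i → z ∈ vertsOf j → i ≡ j
    cols-disjoint  : ∀ {i j e} → e ∈ colsOf i → e ∈ colsOf j → i ≡ j
    cover   : ∀ {z} → ¬ Free z → z ≢ u → z ≢ v → ∃[ i ] z ∈ vertsOf i
    cols⊑   : ∀ i → colsOf i ⊑ cs
    c∉cols  : ∀ i → c ∉ colsOf i
    d∉cols  : ∀ i → d ∉ colsOf i
    Js∩cols : ∀ {i e} → e ∈ Js → e ∉ colsOf i
    palette : ∀ {e} → e ∈ cs → (e ≡ c ⊎ e ≡ d) ⊎ e ∈ Js ⊎ ∃[ i ] e ∈ colsOf i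
    total   : length cs ≡ 2 + (t + (weight S + weight S))

mirror : ∀ {n m} {𝒮 : System n m} {cs t x u v c d} → Setup 𝒮 cs t x u v c d → Setup 𝒮 cs t x v u d c
mirror s = record
  { rich = rich ; none = none ; x-free = x-free ; uv = vu ; vu = uv ; u-cov = v-cov ; v-cov = u-cov
  ; c≢d = λ e → c≢d (sym e) ; c∈ = d∈ ; d∈ = c∈ ; xu = xv ; xv = xu
  ; π = π ; π-u = π-v ; π-v = π-u ; π-out = λ a b → π-out b a
  ; Js = Js ; Js! = Js! ; Js# = Js# ; Js⊑ = Js⊑ ; c∉Js = d∉Js ; d∉Js = c∉Js ; Js-pure = Js-pure
  ; h = h ; S = S ; valid = valid ; only = only ; tgt≢x = tgt≢x ; u∉verts = v∉verts ; v∉verts = u∉verts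
  ; verts-disjoint = verts-disjoint ; cols-disjoint = cols-disjoint ; cover = λ f a b → cover f b a
  ; cols⊑ = cols⊑ ; c∉cols = d∉cols ; d∉cols = c∉cols ; Js∩cols = Js∩cols
  ; palette = λ i → [ (λ k → inj₁ (swap k)) , inj₂ ]′ (palette i) ; total = total }
  where open Setup s

-- Where the colours c and d enter the triangle

module Work {n m : ℕ} {𝒮 : System n m} {cs t x u v c d} (s : Setup 𝒮 cs t x u v c d) where
  open Setup s using (Js; Js!; Js#; Js-pure; Js∩cols; Js⊑; L; S; cols-disjoint; colsOf; cols⊑; cover; c∈; c∉Js; c∉cols; c≢d; d∈; d∉cols; none; rich; tgt≢x; u-cov; uv; u∉verts; v-cov; valid; verts-disjoint; vertsOf; vu; v∉verts; x-free; xv; π; π-out; π-u; π-v)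
  open Alternating 𝒮 using (Augmenting; AugmentingIn; Free; Free?; Reach; Walk; edge; edge-sym; edge-≡; here; mate; mate²; reverseAug; step; step-nonmatching; walk-covered; walk-end)
  open Threads mate mate² using (Valid; verts-covered; verts-mate)
  open Reaching 𝒮 using (HeadOf; HeadOf-cols; close; extend; head-near; stay; to-src; to-tgt; to-tgt-avoid; widen)

  private
    V = Fin n
    C = Fin m

  -- The original matching is kept here: `π` never takes the values `u` and `v`, so the edges of `L`
  -- avoid these two vertices and the strips do not notice that they are still matched.
  lifted : System n m
  lifted = record { mate = mate ; mate² = mate² ; edge = L
                  ; edge-sym = λ (a , b , πa , πb , e) → b , a , πb , πa , edge-sym e }

  module 𝓛 = Alternating lifted using (Reach; Walk; here; step; walk-covered; walk-end)
  module 𝓡 = Reaching lifted using (HeadOf; HeadOf-cols; as!; as∩bs; beyond; bs!; far; head-near; to-src; to-tgt; to-tgt-avoid)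

  Outer : V → Set
  Outer z = z ≢ x × z ≢ u × z ≢ v

  π-x : π x ≡ x
  π-x = π-out (λ { refl → u-cov x-free }) (λ { refl → v-cov x-free })

  π-id : ∀ {a′ a} → π a′ ≡ a → a ≢ x → a′ ≡ a
  π-id {a′} refl a≢x with a′ Fin.≟ u | a′ Fin.≟ v
  ... | yes refl | _        = ⊥-elim (a≢x π-u)
  ... | no _     | yes refl = ⊥-elim (a≢x π-v)
  ... | no p     | no q     = sym (π-out p q)

  π-≢x : ∀ {a} → Outer a → π a ≡ a
  π-≢x (_ , p , q) = π-out p q

  L⇒edge : ∀ {e a b} → L e a b → a ≢ x → b ≢ x → edge e a b
  L⇒edge (a′ , b′ , πa , πb , e) a≢ b≢ = edge-≡ (π-id πa a≢) (π-id πb b≢) e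

  -- Off `x` the edges of `L` are original edges, and a simple walk from elsewhere never comes to
  -- the uncovered vertex `x` by a matching edge.
  lower-walk : ∀ {y p es vs} → 𝓛.Walk y p es vs → y ≢ x → Unique vs → Walk y p es vs
  lower-walk 𝓛.here y≢ _ = here
  lower-walk (𝓛.step {q = q} w e refl) y≢ ((a ∷ _) ∷ _ ∷ vs!) =
    step (lower-walk w y≢ vs!) (L⇒edge e (end≢ (𝓛.walk-end w)) λ { refl → a (sym x-free) }) refl
    where
    end≢ : ∀ {p} → (p ≡ _) ⊎ (p ∈ _) → p ≢ x
    end≢ (inj₁ refl) = y≢
    end≢ (inj₂ i) refl = 𝓛.walk-covered w vs! i x-free

  lower : ∀ {y z es zs} → 𝓛.Reach y z es zs → y ≢ x → Reach y z es zs
  lower R y≢ = record { walk = lower-walk walk y≢ vs! ; cs! = cs! ; vs! = vs! ; cs⊑ = cs⊑ ; vs⊑ = vs⊑ }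
    where open 𝓛.Reach R

  locate : ∀ {z} → z ≢ u → z ≢ v → Free z ⊎ ∃[ i ] z ∈ vertsOf i
  locate {z} p q with Free? z
  ... | yes f = inj₁ f
  ... | no ¬f = inj₂ (cover ¬f p q)

  verts-outer : ∀ {i z} → z ∈ vertsOf i → Outer z
  verts-outer {i} z∈ = (λ { refl → verts-covered (Valid.verts! (valid i)) z∈ x-free }) ,
    (λ { refl → u∉verts i z∈ }) , (λ { refl → v∉verts i z∈ })

  -- A walk to `z` made to be combined with short walks from `x` through the triangle, which use
  -- `u`, `v` and the colours `c`, `d` and `j`.
  record Away (z : V) (j : C) : Set where
    field
      {y}    : V
      {es}   : List C
      {zs}   : List V
      y-free : Free y
      y≢x    : y ≢ x
      reach  : Reach y z es zs
      es⊑    : es ⊑ cs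
      c∉     : c ∉ es
      d∉     : d ∉ es
      j∉     : j ∉ es
      u∉     : u ∉ zs
      v∉     : v ∉ zs

  away-in : ∀ {i y z j es zs} → Reach y z es zs → Free y → y ≢ x → es ⊑ colsOf i → zs ⊑ vertsOf i → j ∉ es → Away z j
  away-in {i} R f ne s⊑ z⊑ j∉ = record { y-free = f ; y≢x = ne ; reach = R ; es⊑ = λ k → cols⊑ i (s⊑ k)
    ; c∉ = λ k → c∉cols i (s⊑ k) ; d∉ = λ k → d∉cols i (s⊑ k) ; j∉ = j∉
    ; u∉ = λ k → u∉verts i (z⊑ k) ; v∉ = λ k → v∉verts i (z⊑ k) }

  away-free : ∀ {z j} → Free z → z ≢ x → Away z j
  away-free f ne = record { y-free = f ; y≢x = ne ; reach = stay ; es⊑ = ∈-[] ; c∉ = ∈-[] ; d∉ = ∈-[]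
    ; j∉ = ∈-[] ; u∉ = ∈-[] ; v∉ = ∈-[] }

  -- A vertex of a strip is reached from the far end without `j` unless it is a head; a head is
  -- reached from the near end, which is allowed unless that end is `x`.
  away-avoid : ∀ {z} j → Outer z → Away z j ⊎ ∃[ i ] (Strip.src (S i) ≡ x × 𝓡.HeadOf (S i) j z)
  away-avoid j (z≢x , z≢u , z≢v) with locate z≢u z≢v
  ... | inj₁ f = inj₁ (away-free f z≢x)
  ... | inj₂ (i , z∈) with 𝓡.to-tgt-avoid (valid i) j z∈
  ... | inj₁ (es , R , s⊑ , j∉) =
    inj₁ (away-in (lower R (tgt≢x i)) (Valid.tgt-free (valid i)) (tgt≢x i) s⊑ (λ k → k) j∉)
  ... | inj₂ H with Strip.src (S i) Fin.≟ x
  ... | yes e = inj₂ (i , e , H)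
  ... | no ne = let es , R , s⊑ , j∉ = 𝓡.head-near (valid i) H in
    inj₁ (away-in (lower R ne) (Valid.src-free (valid i)) ne s⊑ (λ k → k) j∉)

  away : ∀ {z} → Outer z → Away z c
  away o with away-avoid c o
  ... | inj₁ a = a
  ... | inj₂ (i , _ , H) = ⊥-elim (c∉cols i (𝓡.HeadOf-cols (S i) H))

  toV : ∀ {j} → edge j x u → Reach x v (j ∷ []) (u ∷ v ∷ [])
  toV {j} e = subst (λ w → Reach x w (j ∷ []) (u ∷ w ∷ [])) uv (extend stay e ∈-[] u-cov ∈-[] ∈-[])

  toU : ∀ {j} → edge j x v → Reach x u (j ∷ []) (v ∷ u ∷ [])
  toU {j} e = subst (λ w → Reach x w (j ∷ []) (v ∷ w ∷ [])) vu (extend stay e ∈-[] v-cov ∈-[] ∈-[])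

  hit : ∀ {q e b fs} (W : Away q e) → edge e q b → Reach x b fs (u ∷ v ∷ []) → e ∈ cs → e ∉ fs → fs ⊑ cs →
        (∀ {k} → k ∈ fs → k ∉ Away.es W) → ⊥
  hit W e R e∈ e∉ fs⊑ dis = none (close y-free x-free y≢x reach R e e∈ j∉ e∉ es⊑ fs⊑ (λ p q → dis q p)
      λ p → (λ e → u∉ (subst (_∈ zs) e p)) ∷∉ (λ e → v∉ (subst (_∈ zs) e p)) ∷∉ ∈-[])
    where open Away W

  retarget : ∀ {z e j} (W : Away z e) → j ∉ Away.es W → Away z j
  retarget W j∉ = record { y-free = y-free ; y≢x = y≢x ; reach = reach ; es⊑ = es⊑ ; c∉ = c∉ ; d∉ = d∉ ; j∉ = j∉
    ; u∉ = u∉ ; v∉ = v∉ }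
    where open Away W hiding (j∉)

  hit-x : ∀ {q e} → Away q e → edge e q x → e ∈ cs → ⊥
  hit-x W e e∈ = hit {fs = []} W e (widen stay ∈-[] ∈-[]) e∈ ∈-[] ∈-[] ∈-[]

  -- The forbidden path is x -d- v u -e- q, continued away from the triangle.
  hit-u : ∀ {q e} → Away q e → edge e q u → e ∈ cs → e ≢ d → ⊥
  hit-u W e e∈ e≢d = hit W e (widen (toU xv) (λ k → k) swap₂)
    e∈ (e≢d ∷∉ ∈-[]) (d∈ ∷⊑ ∈-[]) (Away.d∉ W ∷# ∈-[])

  -- Here the forbidden path is x -j- u v -e- q.
  hit-v : ∀ {q e j} (W : Away q e) → edge e q v → edge j x u → e ∈ cs → j ∈ cs → e ≢ j → j ∉ Away.es W → ⊥
  hit-v W e f e∈ j∈ e≢j j∉ = hit W e (toV f) e∈ (e≢j ∷∉ ∈-[]) (j∈ ∷⊑ ∈-[]) (j∉ ∷# ∈-[])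

  -- The path x -j- u v -c- q becomes rainbow as soon as `q` can be left without `j`; heads of
  -- strips at `x` are the only exception.
  head-unless : ∀ {j q} → j ∈ cs → j ≢ c → edge j x u → Outer q → edge c q v →
                ∃[ i ] (Strip.src (S i) ≡ x × 𝓡.HeadOf (S i) j q)
  head-unless {j} j∈ j≢c xu′ o e with away-avoid j o
  ... | inj₂ r = r
  ... | inj₁ W = ⊥-elim (hit-v (retarget W c∉) e xu′ c∈ j∈ (λ p → j≢c (sym p)) j∉)
    where open Away W

  -- An entry of `c` into the triangle from outside. `prev` remembers the edge of colour `c` before
  -- the matching edge of `q`; it decides later whether `q` is uncovered or belongs to a strip that
  -- continues in `c`.
  record Hit : Set where
    field
      {q}   : V
      outer : Outer q
      qv    : edge c q v
      prev  : Free q ⊎ ∃[ r ] (Outer r × r ≢ q × r ≢ mate q × edge c r (mate q))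

  mate-outer : ∀ {q} → Outer q → Outer (mate q)
  mate-outer (a , b , e) = (λ p → a (trans (sym (mate² _)) (trans (cong mate p) x-free))) ,
    (λ p → e (trans (sym (mate² _)) (trans (cong mate p) uv))) ,
    (λ p → b (trans (sym (mate² _)) (trans (cong mate p) vu)))

  free-outer : ∀ {z} → Free z → z ≢ x → Outer z
  free-outer f ne = ne , (λ { refl → u-cov f }) , (λ { refl → v-cov f })

  Js-edge : ∀ {j p q} → j ∈ Js → edge j p q → Outer p → p ≢ q → q ≢ mate p → ⊥
  Js-edge {j} {p} {q} j∈ e o p≢q q≢ = q≢ (π-id (trans (Js-pure j∈ e ne) (cong mate (π-≢x o))) (proj₁ (mate-outer o)))
    where
    ne : π p ≢ π q
    ne k = p≢q (sym (π-id (trans (sym k) (π-≢x o)) (proj₁ o)))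

  module _ {x₀ : V} (x₀-free : Free x₀) (x₀≢x : x₀ ≢ x) where

    -- A path in `c` from `x₀` can only visit strips joining `x` to `x₀`: any other strip has an
    -- uncovered end different from `x` and `x₀`, or can be entered so that its edge of colour `c`
    -- closes a rainbow path with a walk from `x₀`.
    data Home (p : V) : Set where
      root    : p ≡ x₀ → Home p
      instrip : ∀ i → p ∈ vertsOf i → Strip.src (S i) ≡ x → Strip.tgt (S i) ≡ x₀ →
                (∃[ r ] (Outer r × r ≢ p × r ≢ mate p × edge c r (mate p))) → Home p

    home-away : ∀ {p} → Home p → ∃[ W ] (Away.y {p} {c} W ≡ x₀)
    home-away (root refl) = away-free x₀-free x₀≢x , refl
    home-away (instrip i p∈ _ refl _) =
      away-in (lower (𝓡.to-tgt (valid i) p∈) (tgt≢x i)) x₀-free (tgt≢x i) (λ k → k) (λ k → k) (c∉cols i) , refl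

    home-hit : ∀ {p} → Outer p → Home p → edge c p v → Hit
    home-hit o (root refl) e            = record { outer = o ; qv = e ; prev = inj₁ x₀-free }
    home-hit o (instrip _ _ _ _ prev) e = record { outer = o ; qv = e ; prev = inj₂ prev }

    ends-check : ∀ i → (Strip.src (S i) ≡ x × Strip.tgt (S i) ≡ x₀) ⊎
      ∃[ r ] (Free r × r ≢ x₀ × (∀ {z} → z ∈ vertsOf i → Reach r z (colsOf i) (vertsOf i)))
    ends-check i with Strip.tgt (S i) Fin.≟ x₀ | Strip.src (S i) Fin.≟ x
    ... | no ne | _ = inj₂ (_ , Valid.tgt-free (valid i) , ne , λ z∈ → lower (𝓡.to-tgt (valid i) z∈) (tgt≢x i))
    ... | yes e | yes e′ = inj₁ (e′ , e)
    ... | yes e | no ne = inj₂ (_ , Valid.src-free (valid i) , (λ k → Valid.src≢tgt (valid i) (trans k (sym e))) ,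
      λ z∈ → lower (𝓡.to-src (valid i) z∈) ne)

    home-step : ∀ {p q} → Outer p → Home p → edge c p q → Outer q → p ≢ q → q ≢ mate p → ¬ Free q → Home (mate q)
    home-step {p} {q} op hp e oq p≢q q≢ q-cov with cover q-cov (proj₁ (proj₂ oq)) (proj₂ (proj₂ oq))
    ... | i , q∈ = go hp (ends-check i)
      where
      arrive : Strip.src (S i) ≡ x → Strip.tgt (S i) ≡ x₀ → Home (mate q)
      arrive e₁ e₂ = instrip i (verts-mate q∈) e₁ e₂ (p , op , (λ k → q≢ (trans (sym (mate² q)) (cong mate (sym k)))) ,
        (λ k → p≢q (trans k (mate² q))) , subst (edge c p) (sym (mate² q)) e)
      go : Home p → _ → Home (mate q)
      go _ (inj₁ (e₁ , e₂)) = arrive e₁ e₂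
      go (root refl) (inj₂ (r , fr , r≢ , R)) = ⊥-elim (none (close x₀-free fr (λ k → r≢ (sym k)) stay (R q∈) e c∈
        ∈-[] (c∉cols i) ∈-[] (cols⊑ i) ∈-[] ∈-[]))
      go (instrip i′ p∈ e₁ e₂ _) (inj₂ (r , fr , r≢ , R)) with i′ Fin.≟ i
      ... | yes refl = arrive e₁ e₂
      ... | no i≢ = ⊥-elim (none (close (Valid.tgt-free (valid i′)) fr (λ k → r≢ (trans (sym k) e₂))
        (lower (𝓡.to-tgt (valid i′) p∈) (tgt≢x i′)) (R q∈) e c∈
        (c∉cols i′) (c∉cols i) (cols⊑ i′) (cols⊑ i) (λ a b → i≢ (cols-disjoint a b)) (λ a b → i≢ (verts-disjoint a b))))

    walk-hit : ∀ {p es vs} → Walk x₀ p es vs → es ⊑ (c ∷ Js) → Unique vs → Hit ⊎ (Outer p × Home p)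
    walk-hit here _ _ = inj₂ (free-outer x₀-free x₀≢x , root refl)
    walk-hit (step {p = p} {q} w e refl) s⊑ vs!@((a ∷ a′) ∷ _ ∷ vs′!) with walk-hit w (λ i → s⊑ (there i)) vs′!
    ... | inj₁ H = inj₁ H
    ... | inj₂ (op , hp) = go (s⊑ (here refl)) e
      where
      q-cov : ¬ Free q
      q-cov k = a (sym k)
      q≢mp : q ≢ mate p
      q≢mp = step-nonmatching w x₀-free refl vs!
      p≢q : p ≢ q
      p≢q refl with walk-end w
      ... | inj₁ refl = q-cov x₀-free
      ... | inj₂ i    = All.lookup a′ i refl
      go : ∀ {e} → e ∈ c ∷ Js → edge e p q → Hit ⊎ (Outer (mate q) × Home (mate q))
      go (there j) e   = ⊥-elim (Js-edge j e op p≢q q≢mp)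
      go (here refl) e with q Fin.≟ u | q Fin.≟ v
      ... | yes refl | _ = ⊥-elim (hit-u (proj₁ (home-away hp)) e c∈ c≢d)
      ... | no _ | yes refl = inj₁ (home-hit op hp e)
      ... | no q≢u | no q≢v = inj₂ (mate-outer oq , home-step op hp e oq p≢q q≢mp q-cov)
        where
        oq : Outer q
        oq = (λ { refl → q-cov x-free }) , q≢u , q≢v

    -- If `v` were never entered, the last edge, of colour `c`, would join a vertex that is
    -- reachable from `x₀` without `c` to a second uncovered vertex.
    aug-hit : ∀ {y es} → Augmenting x₀ y es → es ⊑ (c ∷ Js) → Hit
    aug-hit {y} P s⊑ with walk-hit walk (λ i → s⊑ (↭.∈-resp-↭ (↭-sym colours) (there i))) simple
      where open Augmenting P
    ... | inj₁ H = H
    ... | inj₂ (op , hp) = ⊥-elim (go (s⊑ (↭.∈-resp-↭ (↭-sym colours) (here refl))) last)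
      where
      open Augmenting P renaming (c to e₀)
      end≢y : end ≢ y
      end≢y refl with walk-end walk
      ... | inj₁ refl = x≢y refl
      ... | inj₂ i    = walk-covered walk simple i y-free
      y≢mate : y ≢ mate end
      y≢mate k = end≢y (trans (sym (mate² end)) (trans (cong mate (sym k)) y-free))
      W = proj₁ (home-away hp)
      go : ∀ {e} → e ∈ c ∷ Js → edge e end y → ⊥
      go (there j) e = Js-edge j e op end≢y y≢mate
      go (here refl) e with y Fin.≟ x
      ... | yes refl = hit-x W e c∈
      ... | no y≢x = none (close x₀-free y-free x≢y (subst (λ r → Reach r end (Away.es W) (Away.zs W)) (proj₂ (home-away hp)) (Away.reach W)) stay e c∈
        (Away.c∉ W) ∈-[] (Away.es⊑ W) ∈-[] (λ _ → ∈-[]) (λ _ → ∈-[]))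

  -- Outside the triangle the t colours `Js` have only matching edges. Hence the path granted to
  -- these t + 1 colours runs in `c` until it meets the triangle.
  c-rich : AugmentingIn (c ∷ Js)
  c-rich = rich (c ∷ Js) (Unique-∷ c∉Js Js!) (c∈ ∷⊑ Js⊑) (s≤s (ℕ.≤-reflexive (sym Js#)))

  hitC : Hit
  hitC with c-rich
  ... | x₀ , y , es , P , s⊑ with x₀ Fin.≟ x
  ... | no ne    = aug-hit (Augmenting.x-free P) ne P s⊑
  ... | yes refl = aug-hit (Augmenting.y-free P) (λ e → Augmenting.x≢y P (sym e)) (reverseAug P) s⊑

-- How a colour of a strip at x passes through the triangle

module FreeEnds {n m : ℕ} (mate : Fin n → Fin n) (mate² : ∀ v → mate (mate v) ≡ v)
                {E : Fin m → Fin n → Fin n → Set} {S : Strip n m}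
                (v : Threads.Valid mate mate² E S) where
  open Threads mate mate² using (Thread; Thread-source; Thread-target; Valid; verts-covered; verts-∈)
  open Strip S using (src; tgt; us)
  open Valid v using (verts!)

  free-source : ∀ {w b} → mate w ≡ w → Thread src us tgt w b → w ≡ src
  free-source f th with Thread-source us th
  ... | inj₁ e = e
  ... | inj₂ i = ⊥-elim (verts-covered verts! i f)

  free-target : ∀ {w a} → mate w ≡ w → Thread src us tgt a w → w ≡ tgt
  free-target f th with Thread-target us th
  ... | inj₁ e = e
  ... | inj₂ i = ⊥-elim (verts-covered verts! (verts-∈ i) f)

  after-head : ∀ {z us′ w b} → us ≡ z ∷ us′ → mate w ≡ w → Thread src us tgt w b → b ≡ z
  after-head refl f (inj₁ (_ , e)) = e
  after-head {z} {us′} refl f (inj₂ th) with Thread-source us′ th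
  ... | inj₁ refl = ⊥-elim (verts-covered verts! (there (here refl)) f)
  ... | inj₂ i    = ⊥-elim (verts-covered verts! (there (there i)) f)

module Modes {n m : ℕ} {𝒮 : System n m} {cs t x u v c d} (s : Setup 𝒮 cs t x u v c d) where
  open Setup s using (Js; Js!; Js#; Js-pure; Js∩cols; Js⊑; L; S; c∉Js; d∉Js; rich; u-cov; uv; v-cov; vu; x-free; π; π-u; π-v)
  open Alternating 𝒮 using (Augmenting; Free; Walk; edge; edge-sym; edge-≡; here; mate; mate²; reverseAug; step; step-nonmatching; walk-covered; walk-end)
  open Threads mate mate² using (Only; Thread; Touch; Valid)
  open Reaching 𝒮 using (HeadOf-cols)
  open Work s using (Hit; Outer; free-outer; head-unless; hitC; mate-outer; π-id; π-x; π-≢x; module 𝓡)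
  module M = Work (mirror s) using (Hit; Outer; head-unless; hitC; toV)

  private
    V = Fin n
    C = Fin m

  turn : ∀ {z} → Outer z → M.Outer z
  turn (a , b , e) = a , e , b

  unturn : ∀ {z} → M.Outer z → Outer z
  unturn (a , b , e) = a , e , b

  data Class (a : V) : Set where
    is-x  : a ≡ x → Class a
    is-u  : a ≡ u → Class a
    is-v  : a ≡ v → Class a
    outer : Outer a → Class a

  classify : ∀ a → Class a
  classify a with a Fin.≟ x | a Fin.≟ u | a Fin.≟ v
  ... | yes p | _     | _     = is-x p
  ... | no _  | yes p | _     = is-u p
  ... | no _  | no _  | yes p = is-v p
  ... | no p  | no q  | no r  = outer (p , q , r)

  Spoke : V → V → V → Set
  Spoke w a b = (a ≡ x × b ≡ w) ⊎ (a ≡ w × b ≡ x)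

  spoke-edge : ∀ {w a b e} → Spoke w a b → edge e a b → edge e x w
  spoke-edge (inj₁ (refl , refl)) e = e
  spoke-edge (inj₂ (refl , refl)) e = edge-sym e

  inside : ∀ {a b} → π a ≡ π b → a ≢ b → b ≢ mate a → Spoke u a b ⊎ Spoke v a b
  inside {a} {b} eq ne nm with classify a | classify b
  ... | outer o  | _ = ⊥-elim (ne (sym (π-id (trans (sym eq) (π-≢x o)) (proj₁ o))))
  ... | _ | outer o = ⊥-elim (ne (π-id (trans eq (π-≢x o)) (proj₁ o)))
  ... | is-x refl | is-x refl = ⊥-elim (ne refl)
  ... | is-x refl | is-u refl = inj₁ (inj₁ (refl , refl))
  ... | is-x refl | is-v refl = inj₂ (inj₁ (refl , refl))
  ... | is-u refl | is-x refl = inj₁ (inj₂ (refl , refl))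
  ... | is-u refl | is-u refl = ⊥-elim (ne refl)
  ... | is-u refl | is-v refl = ⊥-elim (nm (sym uv))
  ... | is-v refl | is-x refl = inj₂ (inj₂ (refl , refl))
  ... | is-v refl | is-u refl = ⊥-elim (nm (sym vu))
  ... | is-v refl | is-v refl = ⊥-elim (ne refl)

  π-in : ∀ {a} → Class a → π a ≡ x ⊎ Outer a
  π-in (is-x refl) = inj₁ π-x
  π-in (is-u refl) = inj₁ π-u
  π-in (is-v refl) = inj₁ π-v
  π-in (outer o)   = inj₂ o

  unproject : ∀ {a b} → π a ≢ π b → π b ≡ mate (π a) → b ≡ mate a
  unproject {a} ne eq with π-in (classify a)
  ... | inj₁ πa = ⊥-elim (ne (trans πa (trans (sym x-free) (trans (cong mate (sym πa)) (sym eq)))))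
  ... | inj₂ o  = π-id (trans eq (cong mate (π-≢x o))) (proj₁ (mate-outer o))

  -- By `head-unless`, at the vertex where `c` enters, `j` would be a colour of a strip.
  Js-no-u : ∀ {j} → j ∈ Js → ¬ edge j x u
  Js-no-u j∈ e with head-unless (Js⊑ j∈) (λ { refl → c∉Js j∈ }) e (Hit.outer hitC) (Hit.qv hitC)
  ... | i , _ , H = Js∩cols j∈ (𝓡.HeadOf-cols (S i) H)

  Js-no-v : ∀ {j} → j ∈ Js → ¬ edge j x v
  Js-no-v j∈ e with M.head-unless (Js⊑ j∈) (λ { refl → d∉Js j∈ }) e (M.Hit.outer M.hitC) (M.Hit.qv M.hitC)
  ... | i , _ , H = Js∩cols j∈ (𝓡.HeadOf-cols (S i) H)

  Js-mate : ∀ {j a b} → j ∈ Js → edge j a b → a ≢ b → b ≡ mate a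
  Js-mate {j} {a} {b} j∈ e ne with b Fin.≟ mate a | π a Fin.≟ π b
  ... | yes p | _     = p
  ... | no nm | no q  = unproject q (Js-pure j∈ e q)
  ... | no nm | yes q with inside q ne nm
  ... | inj₁ sp = ⊥-elim (Js-no-u j∈ (spoke-edge sp e))
  ... | inj₂ sp = ⊥-elim (Js-no-v j∈ (spoke-edge sp e))

  touch-π : ∀ {T j a b} → Only L T → j ∈ Strip.as T → edge j a b → π a ≢ π b → b ≢ mate a →
            Touch (Strip.src T) (Strip.us T) (Strip.tgt T) (π a) (π b)
  touch-π o j∈ e ne nm = Only.A-only o j∈ (_ , _ , refl , refl , e) ne (λ k → nm (unproject ne k))

  -- This makes the augmenting path granted to `k ∷ Js` monochromatic, now also inside the triangle.
  own-colour : ∀ {e k a b} → e ∈ k ∷ Js → edge e a b → a ≢ b → b ≢ mate a → edge k a b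
  own-colour (here refl) e _ _   = e
  own-colour (there i) e ne nm   = ⊥-elim (nm (Js-mate i e ne))

  last-edge : ∀ {k y z es} (P : Augmenting y z es) → es ⊑ (k ∷ Js) → let open Augmenting P in
              edge k end z × end ≢ z × z ≢ mate end
  last-edge {z = z} P s⊑ = own-colour (s⊑ (↭.∈-resp-↭ (↭-sym colours) (here refl))) last end≢z nm , end≢z , nm
    where
    open Augmenting P using (colours; end; last; simple; walk; x-free; x≢y; y-free)
    end≢z : end ≢ z
    end≢z refl with walk-end walk
    ... | inj₁ refl = x≢y refl
    ... | inj₂ i    = walk-covered walk simple i y-free
    nm : z ≢ mate end
    nm k = end≢z (trans (sym (mate² end)) (trans (cong mate (sym k)) y-free))

  last-step : ∀ {k y w w′ es vs} → Walk y w es vs → Free y → y ≢ x → Unique vs → es ⊑ (k ∷ Js) → ¬ Free w →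
              mate w ≡ w′ → ∃[ p ] (edge k p w′ × p ≢ x × p ≢ w × p ≢ w′ × w′ ≢ mate p)
  last-step here fy _ _ _ wc _ = ⊥-elim (wc fy)
  last-step (step {p = p} {q} w e refl) fy y≢x vs!@((a ∷ a′) ∷ b ∷ vs′!) s⊑ wc refl =
    p , subst (edge _ p) (sym (mate² q)) (own-colour (s⊑ (here refl)) e p≢q q≢) , p≢x , p≢w ,
      (λ k → p≢q (trans k (mate² q))) , λ k → q≢ (trans (sym (mate² q)) k)
    where
    q≢ = step-nonmatching w fy refl vs!
    p≢q : p ≢ q
    p≢q refl with walk-end w
    ... | inj₁ refl = a (sym fy)
    ... | inj₂ i    = All.lookup a′ i refl
    p≢x : p ≢ x
    p≢x refl with walk-end w
    ... | inj₁ refl = y≢x refl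
    ... | inj₂ i    = walk-covered w vs′! i x-free
    p≢w : p ≢ mate q
    p≢w refl with walk-end w
    ... | inj₁ refl = a (trans (sym (mate² q)) (fy))
    ... | inj₂ i    = All.lookup b i refl

  -- How colour j, belonging to a strip of the contraction starting at x, enters the triangle.
  data Mode (j : C) (z : V) : Set where
    via-x : edge j z x → Mode j z
    via-v : edge j z v → edge j u x → Mode j z
    via-u : edge j z u → edge j v x → Mode j z

  module _ {T : Strip n m} (val : Valid L T) (onl : Only L T) {j z us′} (j∈ : j ∈ Strip.as T) (j∈cs : j ∈ cs)
           (j∉Js : j ∉ Js) (src≡ : Strip.src T ≡ x) (tgt≢ : Strip.tgt T ≢ x) (head : Strip.us T ≡ z ∷ us′) where
    open Strip T using (src; tgt; us)
    open FreeEnds mate mate² val using (after-head; free-source; free-target)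

    -- After projection the edge lies on the thread and contains `x`; only the first edge of the
    -- thread does, as the far end is another vertex.
    touch-x : ∀ {p b} → Outer p → π b ≡ x → edge j p b → b ≢ mate p → p ≡ z
    touch-x {p} {b} o πb e nm with touch-π onl j∈ e (λ k → proj₁ o (trans (sym (π-≢x o)) (trans k πb))) nm
    ... | inj₁ th = ⊥-elim (tgt≢ (sym (free-target x-free (subst (Thread src us tgt (π p)) πb th))))
    ... | inj₂ th = after-head head x-free (subst₂ (Thread src us tgt) πb (π-≢x o) th)

    end-at : ∀ {y z es} → Augmenting y z es → es ⊑ (j ∷ Js) → z ≢ x → z ≡ tgt
    end-at {z = w} P s⊑ w≢x with last-edge P s⊑
    ... | e , ne , nm with π-≢x (free-outer (Augmenting.y-free P) w≢x)
    ... | πw with touch-π onl j∈ e (λ k → ne (π-id (trans k πw) w≢x)) nm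
    ... | inj₁ th = free-target (Augmenting.y-free P) (subst (Thread src us tgt _) πw th)
    ... | inj₂ th = ⊥-elim (w≢x (trans (free-source (Augmenting.y-free P) (subst (λ w → Thread src us tgt w (π (Augmenting.end P))) πw th)) src≡))

    -- The last edge comes to `x` from outside or from `u` or `v`. In the latter case the preceding
    -- non-matching edge enters the triangle at the other corner, and it too projects to the first
    -- edge of the thread.
    enter : ∀ {y es} → Augmenting y x es → es ⊑ (j ∷ Js) → Mode j z
    enter P s⊑ with last-edge P s⊑ | classify (Augmenting.end P)
    ... | e , ne , nm | is-x p = ⊥-elim (ne p)
    ... | e , ne , nm | outer o = via-x (edge-≡ (touch-x o π-x e nm) refl e)
    ... | e , ne , nm | is-u refl with last-step walk x-free′ x≢y simple (λ i → s⊑ (↭.∈-resp-↭ (↭-sym colours) (there i))) u-cov uv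
      where open Augmenting P renaming (x-free to x-free′)
    ... | p , e′ , p≢x , p≢u , p≢v , nm′ =
      via-v (edge-≡ (touch-x (p≢x , p≢u , p≢v) π-v e′ nm′) refl e′) e
    enter P s⊑ | e , ne , nm | is-v refl with last-step walk x-free′ x≢y simple (λ i → s⊑ (↭.∈-resp-↭ (↭-sym colours) (there i))) v-cov vu
      where open Augmenting P renaming (x-free to x-free′)
    ... | p , e′ , p≢x , p≢v , p≢u , nm′ =
      via-u (edge-≡ (touch-x (p≢x , p≢u , p≢v) π-u e′ nm′) refl e′) e

    -- The monochromatic path in `j` can end only at `x` and at the far end of the strip, so one of
    -- its two ends is `x`.
    mode : Mode j z
    mode with rich (j ∷ Js) (Unique-∷ j∉Js Js!) (j∈cs ∷⊑ (λ i → Js⊑ i)) (s≤s (ℕ.≤-reflexive (sym Js#)))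
    ... | x₀ , y₀ , es , P , s⊑ with x₀ Fin.≟ x | y₀ Fin.≟ x
    ... | _        | yes refl = enter P s⊑
    ... | yes refl | no _     = enter (reverseAug P) s⊑
    ... | no p     | no q     = ⊥-elim (Augmenting.x≢y P (trans (end-at (reverseAug P) s⊑ p) (sym (end-at P s⊑ q))))

-- The i-th strip of the contraction, or its reflection exchanging the two families
-- of colours, when x is its first end.
record At {n m : ℕ} {𝒮 : System n m} {cs t x u v c d} (s : Setup 𝒮 cs t x u v c d) (i : Fin (Setup.h s))
          (y z : Fin n) (us : List (Fin n)) (as bs : List (Fin m)) : Set where
  open Setup s using (L; S; colsOf; vertsOf)
  open Alternating 𝒮 using (mate; mate²)
  open Threads mate mate² using (Only; Valid; verts)
  T : Strip n m
  T = strip x y (z ∷ us) as bs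
  field
    val   : Valid L T
    onl   : Only L T
    y≢x   : y ≢ x
    verts⊑ : verts (z ∷ us) ⊑ vertsOf i
    ⊑verts : vertsOf i ⊑ verts (z ∷ us)
    cols⊑T : (as ++ bs) ⊑ colsOf i
    ⊑colsT : colsOf i ⊑ (as ++ bs)
    width  : length (Strip.us (S i)) ≡ suc (length us)
    heads : ∀ {j q} → Reaching.HeadOf 𝒮 (S i) j q → Reaching.HeadOf 𝒮 T j q

module _ {n m : ℕ} {𝒮 : System n m} {cs t x u v c d} {s : Setup 𝒮 cs t x u v c d} where
  open Setup s using (L; S; only; tgt≢x; valid)
  open Alternating 𝒮 using (mate; mate²)
  open Threads mate mate² using (Only; Valid; map-mate²; swap-only; swap-valid; swapStrip; verts; verts-map)

  mirrorAt : ∀ {i y z us as bs} → At s i y z us as bs → At (mirror s) i y z us as bs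
  mirrorAt a = record { val = val ; onl = onl ; y≢x = y≢x ; verts⊑ = verts⊑ ; ⊑verts = ⊑verts ; cols⊑T = cols⊑T ; ⊑colsT = ⊑colsT
    ; width = width ; heads = heads }
    where open At a using (T; cols⊑T; heads; onl; val; verts⊑; width; y≢x; ⊑colsT; ⊑verts)

  swapAt : ∀ {i y z us as bs} → At s i y z us as bs → At s i y (mate z) (map mate us) bs as
  swapAt {z = z} {us} {as} {bs} a = record
    { val = swap-valid val ; onl = swap-only onl ; y≢x = y≢x
    ; verts⊑ = λ k → verts⊑ (↭.∈-resp-↭ (verts-map (z ∷ us)) k)
    ; ⊑verts = λ k → ↭.∈-resp-↭ (↭-sym (verts-map (z ∷ us))) (⊑verts k)
    ; cols⊑T = λ k → cols⊑T (↭.∈-resp-↭ (↭.++-comm bs as) k)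
    ; ⊑colsT = λ k → ↭.∈-resp-↭ (↭.++-comm as bs) (⊑colsT k)
    ; width = trans width (cong suc (sym (List.length-map mate us)))
    ; heads = λ H → flip (heads H) }
    where
    open At a using (T; cols⊑T; heads; onl; val; verts⊑; width; y≢x; ⊑colsT; ⊑verts)
    flip : ∀ {j q} → Reaching.HeadOf 𝒮 T j q → Reaching.HeadOf 𝒮 (swapStrip T) j q
    flip (inj₁ (j∈ , us′ , eq)) = inj₂ (j∈ , us′ , trans (map-mate² (z ∷ us)) eq)
    flip (inj₂ (j∈ , us′ , eq)) = inj₁ (j∈ , us′ , eq)

  at : ∀ i → Strip.src (S i) ≡ x → ∃[ y ] ∃[ z ] ∃[ us ] ∃[ as ] ∃[ bs ] (S i ≡ strip x y (z ∷ us) as bs × At s i y z us as bs)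
  at i e = go (S i) refl e
    where
    go : ∀ R → R ≡ S i → Strip.src R ≡ x → ∃[ y ] ∃[ z ] ∃[ us ] ∃[ as ] ∃[ bs ] (S i ≡ strip x y (z ∷ us) as bs × At s i y z us as bs)
    go (strip _ y [] as bs) eq refl with subst (λ R → 0 < length (Strip.us R)) (sym eq) (Valid.0<us (valid i))
    ... | ()
    go (strip _ y (z ∷ us) as bs) eq refl = y , z , us , as , bs , sym eq , record
      { val = subst (Valid L) (sym eq) (valid i) ; onl = subst (Only L) (sym eq) (only i)
      ; y≢x = λ k → tgt≢x i (trans (cong Strip.tgt (sym eq)) k)
      ; verts⊑ = λ k → subst (λ R → _ ∈ verts (Strip.us R)) eq k
      ; ⊑verts = λ k → subst (λ R → _ ∈ verts (Strip.us R)) (sym eq) k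
      ; cols⊑T = λ k → subst (λ R → _ ∈ Strip.cols R) eq k
      ; ⊑colsT = λ k → subst (λ R → _ ∈ Strip.cols R) (sym eq) k
      ; width = sym (cong (λ R → length (Strip.us R)) eq)
      ; heads = λ H → subst (λ R → Reaching.HeadOf 𝒮 R _ _) (sym eq) H }

-- Strips whose colours run through the triangle

module Entry {n m : ℕ} {𝒮 : System n m} {cs t x u v c d} {s : Setup 𝒮 cs t x u v c d}
             {i y z us as bs} (a : At s i y z us as bs) where
  open Setup s using (Js; Js∩cols; S; cols-disjoint; cols⊑; c∈; c∉cols; d∈; d∉cols; none; tgt≢x; valid; verts-disjoint; vertsOf; x-free)
  open Alternating 𝒮 using (Free; Reach; edge; here; mate; mate²)
  open Threads mate mate² using (Thread; Thread-source; Thread-target; Valid; verts; verts-covered; verts-mate; verts-∈)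
  open Reaching 𝒮 using (close)
  open Work s using (Away; L⇒edge; Outer; away-free; away-in; head-unless; locate; lower; verts-outer; module 𝓡)
  open At a using (cols⊑T; heads; onl; val; verts⊑; y≢x; ⊑verts)

  z̄ : Fin n
  z̄ = mate z

  z∈ : z ∈ vertsOf i
  z∈ = verts⊑ (here refl)

  z-outer : Outer z
  z-outer = verts-outer z∈

  z-cov : ¬ Free z
  z-cov = verts-covered (Valid.verts! (valid i)) z∈

  ∈cs : ∀ {j} → j ∈ as ++ bs → j ∈ cs
  ∈cs k = cols⊑ i (cols⊑T k)

  ≢c : ∀ {j} → j ∈ as ++ bs → j ≢ c
  ≢c k refl = c∉cols i (cols⊑T k)

  ≢d : ∀ {j} → j ∈ as ++ bs → j ≢ d
  ≢d k refl = d∉cols i (cols⊑T k)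

  ∉Js : ∀ {j} → j ∈ as ++ bs → j ∉ Js
  ∉Js k l = Js∩cols l (cols⊑T k)

  tail-edges : ∀ {j p q} → j ∈ as → Thread z̄ us y p q → edge j p q
  tail-edges j∈ th = L⇒edge (Valid.A-edges val j∈ (inj₂ th)) source target
    where
    inner : ∀ {w} → w ∈ verts (z ∷ us) → w ≢ x
    inner k refl = verts-covered (Valid.verts! val) k x-free
    source : _ ≢ x
    source with Thread-source us th
    ... | inj₁ refl = inner (there (here refl))
    ... | inj₂ k    = inner (there (there k))
    target : _ ≢ x
    target with Thread-target us th
    ... | inj₁ refl = y≢x
    ... | inj₂ k    = inner (there (there (verts-∈ k)))

  record Clear (r : Fin n) (k : Fin m) : Set where
    field
      way : Away r k
      z∉   : z ∉ Away.zs way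
      z̄∉   : z̄ ∉ Away.zs way

  -- Either `r` is uncovered, or it lies in another strip, whose colours exclude `k`, or behind the
  -- first matching edge of this one, where `k` can be spared.
  clear : ∀ {r k} → k ∈ as ++ bs → Outer r → r ≢ z → r ≢ z̄ → Clear r k
  clear {r} {k} k∈ (r≢x , r≢u , r≢v) r≢z r≢z̄ with locate r≢u r≢v
  ... | inj₁ f = record { way = away-free f r≢x ; z∉ = ∈-[] ; z̄∉ = ∈-[] }
  ... | inj₂ (i′ , r∈) with i Fin.≟ i′
  ... | no ne = record
    { way = away-in (lower (𝓡.to-tgt (valid i′) r∈) (tgt≢x i′)) (Valid.tgt-free (valid i′)) (tgt≢x i′)
        (λ p → p) (λ p → p) (λ p → ne (cols-disjoint (cols⊑T k∈) p))
    ; z∉ = λ p → ne (verts-disjoint z∈ p) ; z̄∉ = λ p → ne (verts-disjoint (verts-mate z∈) p) }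
  ... | yes refl = inside (⊑verts r∈)
    where
    inside : r ∈ verts (z ∷ us) → Clear r k
    inside (here e)          = ⊥-elim (r≢z e)
    inside (there (here e))  = ⊥-elim (r≢z̄ e)
    inside (there (there q)) with 𝓡.beyond val k refl q | Valid.verts! val
    ... | es , R , s⊑ , k∉ | (a₁ ∷ a₂) ∷ b ∷ _ = record
      { way = away-in (lower R y≢x) (Valid.tgt-free val) y≢x (λ p → cols⊑T (s⊑ p)) (λ p → verts⊑ (there (there p))) k∉
      ; z∉ = λ p → All.lookup a₂ p refl ; z̄∉ = λ p → All.lookup b p refl }

  -- The walk from `x` is confined to the triangle and the first matching edge of the strip, with
  -- colours among `c`, `d` and `k`; exactly these are kept free by `Clear`.
  shoot : ∀ {r k p e fs ws} → Clear r k → k ∈ cs → Reach x p fs ws → edge e p r →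
          (e ∷ fs) ⊑ (c ∷ d ∷ k ∷ []) → e ∉ fs → ws ⊑ (u ∷ v ∷ z ∷ z̄ ∷ []) → ⊥
  shoot {k = k} {e = e} C k∈ R pr ⊑3 e∉ ⊑4 = none (close x-free y-free (λ q → y≢x′ (sym q)) R reach pr (in-cs (⊑3 (here refl))) e∉
      (out (⊑3 (here refl))) (λ p → in-cs (⊑3 (there p))) es⊑ (λ p → out (⊑3 (there p))) (λ p → vout (⊑4 p)))
    where
    open Clear C
    open Away way renaming (y≢x to y≢x′)
    in-cs : (c ∷ d ∷ k ∷ []) ⊑ cs
    in-cs (here refl) = c∈
    in-cs (there (here refl)) = d∈
    in-cs (there (there (here refl))) = k∈
    out : ∀ {f} → f ∈ c ∷ d ∷ k ∷ [] → f ∉ es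
    out (here refl) = c∉
    out (there (here refl)) = d∉
    out (there (there (here refl))) = j∉
    vout : ∀ {w} → w ∈ u ∷ v ∷ z ∷ z̄ ∷ [] → w ∉ zs
    vout (here refl) = u∉
    vout (there (here refl)) = v∉
    vout (there (there (here refl))) = z∉
    vout (there (there (there (here refl)))) = z̄∉

  -- `head-unless` makes `q` a head for `j`; since `j` belongs to the A-side of this strip and to no
  -- other strip, the head is `z`.
  head-v : ∀ {j q} → j ∈ as → edge j x u → Outer q → edge c q v → q ≡ z
  head-v {j} j∈ xu′ o qv with head-unless (∈cs (∈.∈-++⁺ˡ j∈)) (≢c (∈.∈-++⁺ˡ j∈)) xu′ o qv
  ... | i′ , _ , H with cols-disjoint {i} {i′} (cols⊑T (∈.∈-++⁺ˡ j∈)) (𝓡.HeadOf-cols (S i′) H)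
  ... | refl with heads H
  ... | inj₁ (_ , _ , refl) = refl
  ... | inj₂ (j∈′ , _)      = ⊥-elim (𝓡.as∩bs val j∈ j∈′)

  modeA : ∀ {j} → j ∈ as → Modes.Mode s j z
  modeA j∈ = Modes.mode s val onl j∈ (∈cs (∈.∈-++⁺ˡ j∈)) (∉Js (∈.∈-++⁺ˡ j∈)) refl y≢x refl

  PrevC : Set
  PrevC = ∃[ r ] (Outer r × r ≢ z × r ≢ z̄ × edge c r z̄)

-- The colours of the strip run through the triangle: those of as along x u v z and those
-- of bs along x v u (mate z).
record Full {n m : ℕ} {𝒮 : System n m} {cs t x u v c d} (s : Setup 𝒮 cs t x u v c d) (i : Fin (Setup.h s))
            (y z : Fin n) (us : List (Fin n)) (as bs : List (Fin m)) : Set where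
  open Alternating 𝒮 using (edge; mate)
  open Work s using (Outer)
  field
    a      : At s i y z us as bs
    as-all : ∀ {j} → j ∈ as → edge j z v × edge j x u
    bs-all : ∀ {j} → j ∈ bs → edge j (mate z) u × edge j x v
    cz     : edge c z v
    dz     : edge d (mate z) u
    c-prev : ∃[ r ] (Outer r × r ≢ z × r ≢ mate z × edge c r (mate z))
    d-prev : ∃[ r ] (Outer r × r ≢ mate z × r ≢ z × edge d r z)

module Fork {n m : ℕ} {𝒮 : System n m} {cs t x u v c d} {s : Setup 𝒮 cs t x u v c d}
            {i y z us as bs} (a : At s i y z us as bs) {j₀} (j₀∈ : j₀ ∈ as)
            (j₀v : Alternating.edge 𝒮 j₀ z v) (j₀u : Alternating.edge 𝒮 j₀ x u) where
  open Setup s using (c≢d; v-cov; vu)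
  open Alternating 𝒮 using (Free; Reach; edge; edge-sym; edge-≡; here; mate; mate²)
  open Threads mate mate² using (Valid)
  open Reaching 𝒮 using (extend; stay)
  open Work s using (Hit; Outer; hitC; mate-outer; toV)
  open Modes s using (module M; unturn; via-x; via-u; via-v)
  open At a using (val)
  open Entry a using (PrevC; clear; head-v; modeA; shoot; z-cov; z-outer; z̄; ∈cs; ≢c; ≢d)
  module B = Entry (swapAt a) using (head-v; modeA; z-cov; z-outer)

  private
    j₀∈T : j₀ ∈ as ++ bs
    j₀∈T = ∈.∈-++⁺ˡ j₀∈

  q≡z : Hit.q hitC ≡ z
  q≡z = head-v j₀∈ j₀u (Hit.outer hitC) (Hit.qv hitC)

  cz : edge c z v
  cz = edge-≡ q≡z refl (Hit.qv hitC)

  c-prev : PrevC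
  c-prev with hitC | q≡z
  ... | record { prev = inj₁ f } | refl = ⊥-elim (z-cov f)
  ... | record { prev = inj₂ p } | refl = p

  q′ : Fin n
  q′ = M.Hit.q M.hitC

  uq′ : edge d u q′
  uq′ = edge-sym (M.Hit.qv M.hitC)

  q′-outer : Outer q′
  q′-outer = unturn (M.Hit.outer M.hitC)

  through-z : Reach x z̄ (c ∷ j₀ ∷ []) (z ∷ z̄ ∷ u ∷ v ∷ [])
  through-z = extend (toV j₀u) (edge-sym cz) ((λ e → ≢c j₀∈T (sym e)) ∷∉ ∈-[]) z-cov
    ((λ e → proj₁ (proj₂ z-outer) e) ∷∉ (λ e → proj₂ (proj₂ z-outer) e) ∷∉ ∈-[])
    ((λ e → proj₁ (proj₂ (mate-outer z-outer)) e) ∷∉ (λ e → proj₂ (proj₂ (mate-outer z-outer)) e) ∷∉ ∈-[])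

  d-next : ∀ {w} → q′ ≡ w → ¬ Free w → ∃[ r ] (Outer r × r ≢ w × r ≢ mate w × edge d r (mate w))
  d-next eq w-cov with M.Hit.prev M.hitC
  ... | inj₁ f = ⊥-elim (w-cov (subst Free eq f))
  ... | inj₂ (r , o , r≢ , r≢′ , e) =
    r , unturn o , (λ k → r≢ (trans k (sym eq))) , (λ k → r≢′ (trans k (cong mate (sym eq)))) , edge-≡ refl (cong mate eq) e

  -- Otherwise x –j₀– u v –c– z z̄ –d– r continues to a rainbow path.
  q′≢z : q′ ≢ z
  q′≢z eq with d-next eq z-cov
  ... | r , o , r≢ , r≢′ , e = shoot (clear j₀∈T o r≢ r≢′) (∈cs j₀∈T) through-z (edge-sym e)
    (there (here refl) ∷⊑ here refl ∷⊑ there (there (here refl)) ∷⊑ ∈-[])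
    ((λ e → c≢d (sym e)) ∷∉ (λ e → ≢d j₀∈T (sym e)) ∷∉ ∈-[])
    (there (there (here refl)) ∷⊑ there (there (there (here refl))) ∷⊑ here refl ∷⊑ there (here refl) ∷⊑ ∈-[])

  -- The path starts with x –b– z̄ z –d– if q′ = z̄ and with x –b– z̄ z –c– v u –d– q′ otherwise.
  not-direct : ∀ {b} → b ∈ bs → ¬ edge b x z̄
  not-direct {b} b∈ xz̄ with q′ Fin.≟ z | q′ Fin.≟ z̄
  ... | yes p | _ = q′≢z p
  ... | no _ | yes p = direct (d-next p B.z-cov)
    where
    b∈T : b ∈ as ++ bs
    b∈T = ∈.∈-++⁺ʳ as b∈
    R : Reach x z (b ∷ []) (z̄ ∷ z ∷ [])
    R = subst (λ w → Reach x w (b ∷ []) (z̄ ∷ w ∷ [])) (mate² z) (extend stay xz̄ ∈-[] B.z-cov ∈-[] ∈-[])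
    direct : ∃[ r ] (Outer r × r ≢ z̄ × r ≢ mate z̄ × edge d r (mate z̄)) → ⊥
    direct (r , o , r≢ , r≢′ , e) = shoot (clear b∈T o (λ k → r≢′ (trans k (sym (mate² z)))) r≢) (∈cs b∈T) R
      (edge-sym (edge-≡ refl (mate² z) e))
      (there (here refl) ∷⊑ there (there (here refl)) ∷⊑ ∈-[])
      ((λ e → ≢d b∈T (sym e)) ∷∉ ∈-[])
      (there (there (there (here refl))) ∷⊑ there (there (here refl)) ∷⊑ ∈-[])
  ... | no p | no p′ = shoot (clear b∈T q′-outer p p′) (∈cs b∈T)
      (subst (λ w → Reach x w (c ∷ b ∷ []) (v ∷ w ∷ z̄ ∷ z ∷ [])) vu
        (extend R cz ((λ e → ≢c b∈T (sym e)) ∷∉ ∈-[]) v-cov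
          ((λ e → proj₂ (proj₂ B.z-outer) (sym e)) ∷∉ (λ e → proj₂ (proj₂ z-outer) (sym e)) ∷∉ ∈-[])
          ((λ e → proj₁ (proj₂ B.z-outer) (trans (sym e) vu)) ∷∉ (λ e → proj₁ (proj₂ z-outer) (trans (sym e) vu)) ∷∉ ∈-[])))
      uq′
      (there (here refl) ∷⊑ here refl ∷⊑ there (there (here refl)) ∷⊑ ∈-[])
      ((λ e → c≢d (sym e)) ∷∉ (λ e → ≢d b∈T (sym e)) ∷∉ ∈-[])
      (there (here refl) ∷⊑ here refl ∷⊑ there (there (there (here refl))) ∷⊑ there (there (here refl)) ∷⊑ ∈-[])
    where
    b∈T : b ∈ as ++ bs
    b∈T = ∈.∈-++⁺ʳ as b∈
    R : Reach x z (b ∷ []) (z̄ ∷ z ∷ [])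
    R = subst (λ w → Reach x w (b ∷ []) (z̄ ∷ w ∷ [])) (mate² z) (extend stay xz̄ ∈-[] B.z-cov ∈-[] ∈-[])

  bs-all : ∀ {b} → b ∈ bs → edge b z̄ u × edge b x v
  bs-all b∈ with B.modeA b∈
  ... | via-x e    = ⊥-elim (not-direct b∈ (edge-sym e))
  ... | via-u e e′ = e , edge-sym e′
  -- Then `b` also uses the edge xu, and `head-v` on the other side would place the entry of `c` at
  -- `z̄` instead of `z`.
  ... | via-v e e′ = ⊥-elim (z-cov (sym (trans (sym q≡z) (B.head-v b∈ (edge-sym e′) (Hit.outer hitC) (Hit.qv hitC)))))

  b₀ : ∃[ b ] b ∈ bs
  b₀ = inhabited (subst (0 <_) (sym (Valid.bs# val)) (s≤s z≤n))

-- `Fork` leads from one colour on one side to all colours on the other. It is used from `j₀`, and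
-- then, mirrored, back from some colour of `bs`.
full : ∀ {n m : ℕ} {𝒮 : System n m} {cs t x u v c d} {s : Setup 𝒮 cs t x u v c d}
       {i y z us as bs} (a : At s i y z us as bs) {j₀} → j₀ ∈ as →
       Alternating.edge 𝒮 j₀ z v → Alternating.edge 𝒮 j₀ x u → Full s i y z us as bs
full {𝒮 = 𝒮} {u = u} {v = v} {d = d} {s} {z = z} {as = as} a j₀∈ e e′ = record
  { a = a ; as-all = λ j∈ → let e₁ , e₂ = G.bs-all j∈ in edge-≡ (mate² _) refl e₁ , e₂
  ; bs-all = F.bs-all ; cz = F.cz ; c-prev = F.c-prev
  ; dz = G.cz
  ; d-prev = let r , o , r≢ , r≢′ , e = G.c-prev in
      r , Modes.unturn s o , r≢ , (λ k → r≢′ (trans k (sym (mate² _)))) , edge-≡ refl (mate² _) e }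
  where
  open Alternating 𝒮 using (Reach; edge; edge-sym; edge-≡; here; mate; mate²)
  module F = Fork {s = s} a j₀∈ e e′ using (bs-all; b₀; c-prev; cz)
  b₀ = F.b₀
  module G = Fork {s = mirror s} (mirrorAt {s = s} (swapAt {s = s} a)) (proj₂ b₀) (proj₁ (F.bs-all (proj₂ b₀))) (proj₂ (F.bs-all (proj₂ b₀))) using (bs-all; c-prev; cz)

-- Strips that the triangle leaves unchanged

module _ {n m : ℕ} {𝒮 : System n m} {cs t x u v c d} (s : Setup 𝒮 cs t x u v c d) (i : Fin (Setup.h s)) where
  open Setup s using (colsOf; cols⊑; c∈; c∉cols; none; vertsOf; x-free)
  open Alternating 𝒮 using (Free; Reach; edge; edge-sym; here; mate; mate²)
  open Reaching 𝒮 using (close)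

  -- A continuation from `v` by `c` to an uncovered vertex, disjoint from strip `i`. It forbids
  -- every rainbow walk from `x` to `v` in the colours of that strip.
  record Escape : Set where
    field
      {q y}  : Fin n
      {es}   : List (Fin m)
      {zs}   : List (Fin n)
      qv     : edge c q v
      y-free : Free y
      y≢x    : y ≢ x
      reach  : Reach y q es zs
      es⊑    : es ⊑ cs
      c∉     : c ∉ es
      u∉     : u ∉ zs
      v∉     : v ∉ zs
      es∩    : ∀ {e} → e ∈ colsOf i → e ∉ es
      zs∩    : ∀ {w} → w ∈ vertsOf i → w ∉ zs

  escape : Escape → ∀ {fs ws} → Reach x v fs ws → fs ⊑ colsOf i → ws ⊑ (u ∷ v ∷ vertsOf i) → ⊥
  escape E R fs⊑ ws⊑ = none (close x-free y-free (λ e → y≢x (sym e)) R reach (edge-sym qv) c∈ (λ k → c∉cols i (fs⊑ k)) c∉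
      (λ k → cols⊑ i (fs⊑ k)) es⊑ (λ k → es∩ (fs⊑ k)) (λ k → out (ws⊑ k)))
    where
    open Escape E using (c∉; es; es∩; es⊑; q; qv; reach; u∉; v∉; y; y-free; y≢x; zs; zs∩)
    out : ∀ {w} → w ∈ u ∷ v ∷ vertsOf i → w ∉ zs
    out (here refl)         = u∉
    out (there (here refl)) = v∉
    out (there (there k))   = zs∩ k

module Real {n m : ℕ} (𝒮 : System n m) where
  open Alternating 𝒮 using (edge; mate; mate²)
  open Threads mate mate² using (Only; Thread; Touch; Valid; swapStrip)

  -- The A-side of `Valid` and `Only` in the system itself; the B-side is the same statement for the
  -- swapped strip.
  record Half (T : Strip n m) : Set where
    open Strip T using (as; src; tgt; us)
    field
      edges : ∀ {j a b} → j ∈ as → Thread src us tgt a b → edge j a b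
      only  : ∀ {j a b} → j ∈ as → edge j a b → a ≢ b → b ≢ mate a → Touch src us tgt a b

  join-valid : ∀ {E T} → Valid E T → Half T → Half (swapStrip T) → Valid edge T
  join-valid v h h′ = record
    { src-free = src-free ; tgt-free = tgt-free ; src≢tgt = src≢tgt ; verts! = verts! ; 0<us = 0<us
    ; as# = as# ; bs# = bs# ; cols! = cols! ; A-edges = Half.edges h ; B-edges = Half.edges h′ }
    where open Valid v

  join-only : ∀ {T} → Half T → Half (swapStrip T) → Only edge T
  join-only h h′ = record { A-only = Half.only h ; B-only = Half.only h′ }

module Off {n m : ℕ} {𝒮 : System n m} {cs t x u v c d} (s : Setup 𝒮 cs t x u v c d) (i : Fin (Setup.h s)) where
  open Setup s using (L; S; cols-disjoint; colsOf; cols⊑; c∉cols; d∉cols; only; tgt≢x; valid; x-free; π)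
  open Alternating 𝒮 using (edge; mate; mate²)
  open Threads mate mate² using (Only; Thread; Thread-source; Thread-target; Touch; Valid; swap-only; swap-valid; verts; verts-covered; verts-∈)
  open Reaching 𝒮 using (HeadOf-cols)
  open Work s using (Hit; L⇒edge; head-unless; hitC; π-id; module 𝓡)
  open Modes s using (module M; inside; touch-π; spoke-edge; outer)
  open Real 𝒮 using (Half; join-only; join-valid)

  -- Away from `x` edges and their projections coincide. An edge inside the triangle would, by
  -- `head-unless`, make its colour belong to a strip at `x`.
  half : ∀ {T} → Valid L T → Only L T → Strip.cols T ⊑ colsOf i → Strip.src T ≢ x → Strip.tgt T ≢ x →
         Strip.src (S i) ≢ x → Half T
  half {T} val onl cols⊑T src≢x tgt≢ off = record
    { edges = λ j∈ th → L⇒edge (Valid.A-edges val j∈ th) (source th) (target th)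
    ; only  = λ j∈ e ne nm → lower-only j∈ e ne nm }
    where
    open Strip T using (as; cols; src; tgt; us)
    inner : ∀ {w} → w ∈ verts us → w ≢ x
    inner k refl = verts-covered (Valid.verts! val) k x-free
    source : ∀ {a b} → Thread src us tgt a b → a ≢ x
    source th with Thread-source us th
    ... | inj₁ refl = src≢x
    ... | inj₂ k    = inner k
    target : ∀ {a b} → Thread src us tgt a b → b ≢ x
    target th with Thread-target us th
    ... | inj₁ refl = tgt≢
    ... | inj₂ k    = inner (verts-∈ k)
    ends : ∀ {a b} → Touch src us tgt a b → a ≢ x × b ≢ x
    ends (inj₁ th) = source th , target th
    ends (inj₂ th) = target th , source th
    own : ∀ {j i′} → j ∈ as → j ∈ colsOf i′ → Strip.src (S i′) ≢ x
    own {j} {i′} j∈ k with cols-disjoint {i} {i′} (cols⊑T (∈.∈-++⁺ˡ j∈)) k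
    ... | refl = off
    lower-only : ∀ {j a b} → j ∈ as → edge j a b → a ≢ b → b ≢ mate a → Touch src us tgt a b
    lower-only {j} {a} {b} j∈ e ne nm with π a Fin.≟ π b
    ... | no q = let th = touch-π onl j∈ e q nm ; p₁ , p₂ = ends th in
      subst₂ (Touch src us tgt) (sym (π-id refl p₁)) (sym (π-id refl p₂)) th
    ... | yes q with inside q ne nm
    ... | inj₁ sp with head-unless (cols⊑ i (cols⊑T (∈.∈-++⁺ˡ j∈))) (λ { refl → c∉cols i (cols⊑T (∈.∈-++⁺ˡ j∈)) })
                         (spoke-edge sp e) (Hit.outer hitC) (Hit.qv hitC)
    ... | i′ , src≡ , H = ⊥-elim (own {i′ = i′} j∈ (𝓡.HeadOf-cols (S i′) H) src≡)
    lower-only {j} {a} {b} j∈ e ne nm | yes q | inj₂ sp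
      with M.head-unless (cols⊑ i (cols⊑T (∈.∈-++⁺ˡ j∈))) (λ { refl → d∉cols i (cols⊑T (∈.∈-++⁺ˡ j∈)) })
             (spoke-edge sp e) (M.Hit.outer M.hitC) (M.Hit.qv M.hitC)
    ... | i′ , src≡ , H = ⊥-elim (own {i′ = i′} j∈ (𝓡.HeadOf-cols (S i′) H) src≡)

  off-strip : Strip.src (S i) ≢ x → Valid edge (S i) × Only edge (S i)
  off-strip ne = join-valid (valid i) h₁ h₂ , join-only h₁ h₂
    where
    h₁ = half (valid i) (only i) (λ k → k) ne (tgt≢x i) ne
    h₂ = half (swap-valid (valid i)) (swap-only (only i)) (λ k → ↭.∈-resp-↭ (↭.++-comm (Strip.bs (S i)) (Strip.as (S i))) k) ne (tgt≢x i) ne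

module _ {n m : ℕ} {𝒮 : System n m} {cs t x u v c d} {s : Setup 𝒮 cs t x u v c d}
         {i y z us as bs} (a : At s i y z us as bs)
         (direct : ∀ {j} → j ∈ as → Alternating.edge 𝒮 j x z) where
  open Alternating 𝒮 using (edge; mate; mate²)
  open Threads mate mate² using (Thread)

  direct-edges : ∀ {j a b} → j ∈ as → Thread x (z ∷ us) y a b → edge j a b
  direct-edges j∈ (inj₁ (refl , refl)) = direct j∈
  direct-edges j∈ (inj₂ th) = Entry.tail-edges a j∈ th

module Beside {n m : ℕ} {𝒮 : System n m} {cs t x u v c d} {s : Setup 𝒮 cs t x u v c d}
              {i y z us as bs} (a : At s i y z us as bs)
              (direct : ∀ {j} → j ∈ as → Alternating.edge 𝒮 j x z)
              (direct′ : ∀ {j} → j ∈ bs → Alternating.edge 𝒮 j x (Alternating.mate 𝒮 z))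
              (E : Escape s i) (E′ : Escape (mirror s) i) where
  open Setup s using (colsOf; only; u-cov; uv; u∉verts; v-cov; vertsOf; vu; v∉verts; π; π-u; π-v)
  open Alternating 𝒮 using (Free; Reach; edge; edge-sym; here; mate; mate-injective; mate²)
  open Threads mate mate² using (Touch; Valid; verts-mate)
  open Reaching 𝒮 using (as∩bs; extend; stay)
  open Work s using (Outer; toV; π-x; π-≢x; module 𝓡)
  open Modes s using (module M; inside; touch-π; spoke-edge; Class; is-x; is-u; is-v; outer; classify; touch-x)
  open Real 𝒮 using (Half)
  open At a using (T; cols⊑T; onl; val; y≢x)
  open Entry a using (z-cov; z̄; z∈; ∈cs; ∉Js)

  -- x -j- u v is a walk in one colour of the strip, which the escape completes.
  no-u : ∀ {j} → j ∈ as ++ bs → ¬ edge j x u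
  no-u j∈ e = escape s i E (toV e) (cols⊑T j∈ ∷⊑ ∈-[]) (here refl ∷⊑ there (here refl) ∷⊑ ∈-[])

  no-v : ∀ {j} → j ∈ as ++ bs → ¬ edge j x v
  no-v j∈ e = escape (mirror s) i E′ (M.toV e) (cols⊑T j∈ ∷⊑ ∈-[]) (here refl ∷⊑ there (here refl) ∷⊑ ∈-[])

  private
    some-b : ∃[ b ] b ∈ bs
    some-b = inhabited (subst (0 <_) (sym (Valid.bs# val)) (s≤s z≤n))
    b₀ = proj₁ some-b
    b₀∈ = proj₂ some-b

  z̄-cov : ¬ Free z̄
  z̄-cov f = z-cov (mate-injective f)

  to-z : Reach x z (b₀ ∷ []) (z̄ ∷ z ∷ [])
  to-z = subst (λ w → Reach x w (b₀ ∷ []) (z̄ ∷ w ∷ [])) (mate² z) (extend stay (direct′ b₀∈) ∈-[] z̄-cov ∈-[] ∈-[])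

  -- The walk is x -b₀- z̄ z -j- w w̄. It reaches the corner opposite to `w`, from which one of the
  -- two escapes continues.
  on-from-z : ∀ {j w w̄} → j ∈ as → edge j z w → mate w ≡ w̄ → ¬ Free w → w ∉ vertsOf i → w̄ ∉ vertsOf i →
              ∃[ fs ] ∃[ ws ] (Reach x w̄ fs ws × fs ⊑ colsOf i × ws ⊑ (w ∷ w̄ ∷ vertsOf i))
  on-from-z j∈ e refl w-cov w∉ w̄∉ = _ , _ ,
    extend to-z e ((λ e → 𝓡.as∩bs val j∈ (subst (_∈ bs) (sym e) b₀∈)) ∷∉ ∈-[]) w-cov (λ k → w∉ (old k)) (λ k → w̄∉ (old k)) ,
    (cols⊑T (∈.∈-++⁺ˡ j∈) ∷⊑ cols⊑T (∈.∈-++⁺ʳ as b₀∈) ∷⊑ ∈-[]) ,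
    (here refl ∷⊑ there (here refl) ∷⊑ (λ k → there (there (old k))))
    where
    old : (z̄ ∷ z ∷ []) ⊑ vertsOf i
    old (here refl)         = verts-mate z∈
    old (there (here refl)) = z∈

  no-zu : ∀ {j} → j ∈ as → ¬ edge j z u
  no-zu j∈ e = let _ , _ , R , f , w = on-from-z j∈ e uv u-cov (u∉verts i) (v∉verts i) in escape s i E R f w

  no-zv : ∀ {j} → j ∈ as → ¬ edge j z v
  no-zv j∈ e = let _ , _ , R , f , w = on-from-z j∈ e vu v-cov (v∉verts i) (u∉verts i) in escape (mirror s) i E′ R f w

  no-corner : ∀ {j p b} → j ∈ as → Outer p → (b ≡ u) ⊎ (b ≡ v) → edge j p b → b ≢ mate p → ⊥
  no-corner {j} {p} j∈ o eq e nm = go (touch-x val onl j∈ (∈cs j∈T) (∉Js j∈T) refl y≢x refl o (πb eq) e nm) eq e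
    where
    j∈T : j ∈ as ++ bs
    j∈T = ∈.∈-++⁺ˡ j∈
    πb : ∀ {b} → (b ≡ u) ⊎ (b ≡ v) → π b ≡ x
    πb (inj₁ refl) = π-u
    πb (inj₂ refl) = π-v
    go : ∀ {b} → p ≡ z → (b ≡ u) ⊎ (b ≡ v) → edge j p b → ⊥
    go refl (inj₁ refl) e = no-zu j∈ e
    go refl (inj₂ refl) e = no-zv j∈ e

  beside-half : Half T
  beside-half = record { edges = direct-edges a direct ; only = only′ }
    where
    only′ : ∀ {j a b} → j ∈ as → edge j a b → a ≢ b → b ≢ mate a → Touch x (z ∷ us) y a b
    only′ {j} {a} {b} j∈ e ne nm with π a Fin.≟ π b
    ... | yes q with inside q ne nm
    ... | inj₁ sp = ⊥-elim (no-u (∈.∈-++⁺ˡ j∈) (spoke-edge sp e))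
    ... | inj₂ sp = ⊥-elim (no-v (∈.∈-++⁺ˡ j∈) (spoke-edge sp e))
    only′ {j} {a} {b} j∈ e ne nm | no q = go (classify a) (classify b)
      where
      th = touch-π onl j∈ e q nm
      nm′ : a ≢ mate b
      nm′ k = nm (trans (sym (mate² b)) (cong mate (sym k)))
      corner : ∀ {w} → π w ≡ x → (w ≡ u) ⊎ (w ≡ v) → ∀ {p} → Class p → π p ≢ x → edge j p w → w ≢ mate p → ⊥
      corner _ eq (is-x refl) np _ _ = np π-x
      corner _ eq (is-u refl) np _ _ = np π-u
      corner _ eq (is-v refl) np _ _ = np π-v
      corner _ eq (outer o) np e nm = no-corner j∈ o eq e nm
      go : Class a → Class b → Touch x (z ∷ us) y a b
      go (is-u refl) cb = ⊥-elim (corner π-u (inj₁ refl) cb (λ k → q (trans π-u (sym k))) (edge-sym e) nm′)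
      go (is-v refl) cb = ⊥-elim (corner π-v (inj₂ refl) cb (λ k → q (trans π-v (sym k))) (edge-sym e) nm′)
      go ca (is-u refl) = ⊥-elim (corner π-u (inj₁ refl) ca (λ k → q (trans k (sym π-u))) e nm)
      go ca (is-v refl) = ⊥-elim (corner π-v (inj₂ refl) ca (λ k → q (trans k (sym π-v))) e nm)
      go (is-x refl) (is-x refl) = ⊥-elim (ne refl)
      go (is-x refl) (outer o)   = subst₂ (Touch x (z ∷ us) y) π-x (π-≢x o) th
      go (outer o) (is-x refl)   = subst₂ (Touch x (z ∷ us) y) (π-≢x o) π-x th
      go (outer o) (outer o′)    = subst₂ (Touch x (z ∷ us) y) (π-≢x o) (π-≢x o′) th

-- Edges of colour c off the triangle

module Cross {n m : ℕ} {𝒮 : System n m} {cs t x u v c d} (s : Setup 𝒮 cs t x u v c d) where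
  open Setup s using (S; cols-disjoint; colsOf; cols⊑; c∈; c∉cols; none; tgt≢x; valid; verts-disjoint; vertsOf)
  open Alternating 𝒮 using (Free; Reach; edge; mate; mate²)
  open Threads mate mate² using (Valid; verts-covered)
  open Reaching 𝒮 using (close; close-within; far; stay; to-src; to-tgt)
  open Work s using (Outer; lower; module 𝓡)

  data Place (p : Fin n) : Set where
    free  : Free p → Place p
    strip : ∀ i → p ∈ vertsOf i → Valid edge (S i) → Place p

  record Rooted (p e : Fin n) : Set where
    field
      {r}    : Fin n
      {es}   : List (Fin m)
      {zs}   : List (Fin n)
      r-free : Free r
      r≢e    : r ≢ e
      reach  : Reach r p es zs
      es⊑    : ∀ {k} → k ∈ es → ∃[ i ] (p ∈ vertsOf i × k ∈ colsOf i)
      zs⊑    : ∀ {w} → w ∈ zs → ∃[ i ] (p ∈ vertsOf i × w ∈ vertsOf i)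

  root-tgt : ∀ {p e} i → p ∈ vertsOf i → Strip.tgt (S i) ≢ e → Rooted p e
  root-tgt i p∈ ne = record { r-free = Valid.tgt-free (valid i) ; r≢e = ne
    ; reach = lower (𝓡.to-tgt (valid i) p∈) (tgt≢x i) ; es⊑ = λ k → i , p∈ , k ; zs⊑ = λ k → i , p∈ , k }

  -- A strip that is valid in the system itself is entered from both of its ends, possibly from `x`;
  -- one of them differs from the prescribed `e`.
  root-of : ∀ {p} → Place p → ∀ e → (Free p → p ≢ e) → Rooted p e
  root-of (free f) e ne = record { r-free = f ; r≢e = ne f ; reach = stay ; es⊑ = ∈-[] ; zs⊑ = ∈-[] }
  root-of (strip i p∈ val) e _ with Strip.tgt (S i) Fin.≟ e
  ... | no ne    = root-tgt i p∈ ne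
  ... | yes refl = record { r-free = Valid.src-free val ; r≢e = Valid.src≢tgt val ; reach = to-src val p∈
    ; es⊑ = λ k → i , p∈ , k ; zs⊑ = λ k → i , p∈ , k }

  apart : ∀ {p q e} (P : Rooted p e) → Rooted q (Rooted.r P) → (∀ {i} → p ∈ vertsOf i → q ∉ vertsOf i) → edge c p q → ⊥
  apart P Q far pq = none (close P.r-free Q.r-free (λ k → Q.r≢e (sym k)) P.reach Q.reach pq c∈
      (λ k → let i , _ , l = P.es⊑ k in c∉cols i l) (λ k → let i , _ , l = Q.es⊑ k in c∉cols i l)
      (λ k → let i , _ , l = P.es⊑ k in cols⊑ i l) (λ k → let i , _ , l = Q.es⊑ k in cols⊑ i l)
      (λ k k′ → let i , p∈ , l = P.es⊑ k ; i′ , q∈ , l′ = Q.es⊑ k′ in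
        far p∈ (subst (λ i → _ ∈ vertsOf i) (sym (cols-disjoint {i} {i′} l l′)) q∈))
      (λ k k′ → let i , p∈ , l = P.zs⊑ k ; i′ , q∈ , l′ = Q.zs⊑ k′ in
        far p∈ (subst (λ i → _ ∈ vertsOf i) (sym (verts-disjoint {i} {i′} l l′)) q∈)))
    where
    module P = Rooted P
    module Q = Rooted Q

  free-apart : ∀ {p q} → Free p → ∀ {i} → p ∈ vertsOf i → q ∉ vertsOf i
  free-apart f {i} p∈ _ = verts-covered (Valid.verts! (valid i)) p∈ f

  -- For different places two distinct roots are chosen and the edge joins their walks; within one
  -- strip `close-within` does it.
  cross : ∀ {p q} → Outer p → p ≢ q → q ≢ mate p → edge c p q → Place p → Place q → ⊥
  cross {p} {q} o p≢q q≢ pq (free f) Q =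
    apart (root-of (free f) x (λ _ → proj₁ o)) (root-of Q _ (λ _ k → p≢q (sym k))) (λ {i} → free-apart f {i}) pq
  cross {p} {q} o p≢q q≢ pq P@(strip i p∈ val) (free f) =
    apart (root-of P q (λ g → ⊥-elim (verts-covered (Valid.verts! val) p∈ g)))
      (root-of (free f) _ (λ _ k → Rooted.r≢e (root-of P q (λ g → ⊥-elim (verts-covered (Valid.verts! val) p∈ g))) (sym k)))
      (λ {i} p∈ q∈ → free-apart {q} {p} f {i} q∈ p∈) pq
  cross {p} {q} o p≢q q≢ pq P@(strip i p∈ val) Q@(strip i′ q∈ val′) with i Fin.≟ i′
  ... | yes refl = none (close-within val (cols⊑ i) p∈ q∈ p≢q q≢ pq c∈ (c∉cols i))
  ... | no ne = apart (root-of P q (λ g → ⊥-elim (verts-covered (Valid.verts! val) p∈ g)))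
      (root-of Q _ (λ g → ⊥-elim (verts-covered (Valid.verts! val′) q∈ g)))
      (λ {k} p∈′ q∈′ → ne (trans (verts-disjoint p∈ p∈′) (verts-disjoint {k} {i′} q∈′ q∈))) pq

-- Prolonging a strip by the matching edge uv

module _ {n m : ℕ} {𝒮 : System n m} {cs t x u v c d} {s : Setup 𝒮 cs t x u v c d} where
  open Alternating 𝒮 using (edge-≡; mate; mate²)

  flipFull : ∀ {i y z us as bs} → Full s i y z us as bs → Full (mirror s) i y (mate z) (map mate us) bs as
  flipFull F = record
    { a = mirrorAt {s = s} (swapAt {s = s} a) ; as-all = bs-all ; bs-all = λ j∈ → let e , e′ = as-all j∈ in edge-≡ (sym (mate² _)) refl e , e′
    ; cz = dz ; dz = edge-≡ (sym (mate² _)) refl cz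
    ; c-prev = let r , o , p , q , e = d-prev in r , Modes.turn s o , p , (λ k → q (trans k (mate² _))) , edge-≡ refl (sym (mate² _)) e
    ; d-prev = let r , o , p , q , e = c-prev in r , Modes.turn s o , (λ k → p (trans k (mate² _))) , q , e }
    where open Full F using (a; as-all; bs-all; c-prev; cz; d-prev; dz)

module Extend {n m : ℕ} {𝒮 : System n m} {cs t x u v c d} {s : Setup 𝒮 cs t x u v c d}
              {i y z us as bs} (F : Full s i y z us as bs) where
  open Setup s using (u∉verts; vertsOf; v∉verts)
  open Alternating 𝒮 using (Free; Reach; edge; edge-sym; mate; mate²)
  open Threads mate mate² using (Inner⇒Thread; Thread; Valid; verts)
  open Reaching 𝒮 using (far; prefix; verts-prefix; widen)
  open Work s using (lower; toV; module 𝓡)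
  open Full F using (a; as-all)
  open Entry a using (tail-edges)
  open At a using (val; verts⊑; y≢x)

  y-free : Free y
  y-free = Valid.tgt-free val

  us⁺ : List (Fin n)
  us⁺ = u ∷ z ∷ us

  as-edges : ∀ {j a b} → j ∈ as → Thread v (z ∷ us) y a b → edge j a b
  as-edges j∈ (inj₁ (refl , refl)) = edge-sym (proj₁ (as-all j∈))
  as-edges j∈ (inj₂ th) = tail-edges j∈ th

  -- The walk x -k- u v replaces the step to `x` in the contraction; the thread from `v` onwards is
  -- real. The detour costs one extra colour.
  nearA : ∀ {p us₁ us₂ es k} → z ∷ us ≡ us₁ ++ p ∷ us₂ → Unique es → es ⊑ as → length es ≡ suc (length us₁) →
          edge k x u → k ∉ es → Reach x (mate p) (k ∷ es) (u ∷ v ∷ verts (us₁ ++ p ∷ []))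
  nearA {p} {us₁} {us₂} {es} {k} eq es! es⊑ l e k∉ =
    widen (prefix us₁ p es l (toV e)
             (λ {e} {a} {b} j th → as-edges (es⊑ j) (subst (λ l → Thread v l y a b) (sym eq) (Inner⇒Thread us₁ th)))
             es! (λ j → (λ e → k∉ (subst (_∈ es) e j)) ∷∉ ∈-[])
             (proj₁ (Unique-++⁻ (verts (us₁ ++ p ∷ [])) (subst Unique (verts-prefix {us₁ = us₁} eq) (Valid.verts! val))))
             (λ j → (λ e → u∉verts i (subst (_∈ vertsOf i) e (verts⊑ (old j)))) ∷∉ (λ e → v∉verts i (subst (_∈ vertsOf i) e (verts⊑ (old j)))) ∷∉ ∈-[]))
      (λ j → [ there , (here refl ∷⊑ ∈-[]) ]′ (∈.∈-++⁻ es j))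
      (λ j → [ (λ q → there (there q)) , (here refl ∷⊑ there (here refl) ∷⊑ ∈-[]) ]′ (∈.∈-++⁻ (verts (us₁ ++ p ∷ [])) j))
    where
    old : verts (us₁ ++ p ∷ []) ⊑ verts (z ∷ us)
    old j = subst (_ ∈_) (sym (verts-prefix {us₁ = us₁} eq)) (∈.∈-++⁺ˡ j)

  farA : ∀ {q us₁ us₂ es} → z ∷ us ≡ us₁ ++ q ∷ us₂ → Unique es → es ⊑ as → length es ≡ suc (length us₂) →
         Reach y q es (verts (q ∷ us₂))
  farA {us₁ = us₁} eq es! es⊑ l = lower (𝓡.far {us₁ = us₁} val eq es! es⊑ l) y≢x

module Extended {n m : ℕ} {𝒮 : System n m} {cs t x u v c d} {s : Setup 𝒮 cs t x u v c d}
                {i y z us as bs} (F : Full s i y z us as bs)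
                (others : ∀ i′ → i′ ≢ i → Threads.Valid (System.mate 𝒮) (System.mate² 𝒮) (System.edge 𝒮) (Setup.S s i′)) where
  open Setup s using (c≢d; d∈; d∉cols; none; uv; u∉verts; v∉verts; x-free; xv; π)
  open Alternating 𝒮 using (Reach; edge; edge-sym; here; mate; mate²)
  open Threads mate mate² using (Thread; Touch; Valid; verts; verts-map)
  open Reaching 𝒮 using (as∩bs; bs!; close; extend; stay; widen)
  open Work s using (Outer; mate-outer; toU; π-≢x; module 𝓡)
  open Full F using (a; c-prev; dz)
  open At a using (cols⊑T; onl; val; verts⊑; y≢x)
  open Entry a using (clear; shoot; z-cov; z-outer; ∈cs; ∉Js; ≢c; ≢d)
  open Extend F using (farA; nearA; us⁺; y-free)
  open Modes s using (inside; touch-π; classify; is-x; is-u; is-v; outer; touch-x; Spoke; Class)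
  module X = Extend (flipFull F) using (farA; nearA)

  private
    zs! : Unique (verts (z ∷ us))
    zs! = Valid.verts! val

  nearB : ∀ {p us₁ us₂ es k} → z ∷ us ≡ us₁ ++ p ∷ us₂ → Unique es → es ⊑ bs → length es ≡ suc (length us₁) →
          edge k x v → k ∉ es → Reach x p (k ∷ es) (u ∷ v ∷ verts (us₁ ++ p ∷ []))
  nearB {p} {us₁} {us₂} {es} {k} eq es! es⊑ l e k∉ =
    widen (subst (λ w → Reach x w (k ∷ es) (v ∷ u ∷ verts (map mate us₁ ++ mate p ∷ []))) (mate² p)
            (X.nearA {us₁ = map mate us₁} (trans (cong (map mate) eq) (List.map-++ mate us₁ _)) es! es⊑
              (trans l (cong suc (sym (List.length-map mate us₁)))) e k∉))
      (λ j → j)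
      (there (here refl) ∷⊑ here refl ∷⊑ (λ j → there (there (↭.∈-resp-↭ (verts-map (us₁ ++ p ∷ []))
        (subst (λ l → _ ∈ verts l) (sym (List.map-++ mate us₁ (p ∷ []))) j)))))

  farB : ∀ {q us₁ us₂ es} → z ∷ us ≡ us₁ ++ q ∷ us₂ → Unique es → es ⊑ bs → length es ≡ suc (length us₂) →
         Reach y (mate q) es (verts (q ∷ us₂))
  farB {q} {us₁} {us₂} eq es! es⊑ l =
    widen (X.farA {us₁ = map mate us₁} (trans (cong (map mate) eq) (List.map-++ mate us₁ _)) es! es⊑
            (trans l (cong suc (sym (List.length-map mate us₂)))))
      (λ j → j) (λ j → ↭.∈-resp-↭ (verts-map (q ∷ us₂)) j)

  -- Otherwise x -k- v u -d- (mate z) would meet the walk that the whole of `bs` provides from `y`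
  -- to `mate z`.
  no-xv : ∀ {k} → k ∈ cs → k ≢ d → k ∉ bs → ¬ edge k x v
  no-xv {k} k∈ k≢d k∉ e with pick {xs = bs} (suc (length us)) 0 (𝓡.bs! val)
      (subst₂ _≤_ (sym (ℕ.+-identityʳ _)) (sym (Valid.bs# val)) ℕ.≤-refl)
  ... | es , _ , es! , _ , es⊑ , _ , l , _ =
    none (close x-free y-free (λ q → y≢x (sym q)) (toU e) (farB {us₁ = []} refl es! es⊑ l) (edge-sym dz) d∈
      ((λ q → k≢d (sym q)) ∷∉ ∈-[]) (λ j → d∉cols i (cols⊑T (∈.∈-++⁺ʳ as (es⊑ j)))) (k∈ ∷⊑ ∈-[])
      (λ j → ∈cs (∈.∈-++⁺ʳ as (es⊑ j))) ((λ j → k∉ (es⊑ j)) ∷# ∈-[])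
      ((λ j → v∉verts i (verts⊑ j)) ∷# (λ j → u∉verts i (verts⊑ j)) ∷# ∈-[]))

  swapTouch : ∀ {p us y a b} → Touch p us y a b → Touch p us y b a
  swapTouch (inj₁ th) = inj₂ th
  swapTouch (inj₂ th) = inj₁ th

  shift-thread : ∀ {a b} → a ≢ x → Thread x (z ∷ us) y a b → Thread x us⁺ y a b
  shift-thread ne (inj₁ (p , _)) = ⊥-elim (ne p)
  shift-thread ne (inj₂ th)      = inj₂ (inj₂ th)

  shift-touch : ∀ {a b} → a ≢ x → b ≢ x → Touch x (z ∷ us) y a b → Touch x us⁺ y a b
  shift-touch p q (inj₁ th) = inj₁ (shift-thread p th)
  shift-touch p q (inj₂ th) = inj₂ (shift-thread q th)

  spoke-touch : ∀ {a b} → Spoke u a b → Touch x us⁺ y a b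
  spoke-touch (inj₁ (p , q)) = inj₁ (inj₁ (p , q))
  spoke-touch (inj₂ (p , q)) = inj₂ (inj₁ (q , p))

  as-only : ∀ {j a b} → j ∈ as → edge j a b → a ≢ b → b ≢ mate a → Touch x us⁺ y a b
  as-only {j} {a} {b} j∈ e ne nm with π a Fin.≟ π b
  ... | yes q with inside q ne nm
  ... | inj₁ sp = spoke-touch sp
  ... | inj₂ sp = ⊥-elim (no-xv (∈cs j∈T) (≢d j∈T) (𝓡.as∩bs val j∈) (Modes.spoke-edge s sp e))
    where
    j∈T : j ∈ as ++ bs
    j∈T = ∈.∈-++⁺ˡ j∈
  as-only {j} {a} {b} j∈ e ne nm | no q = go (classify a) (classify b)
    where
    j∈T : j ∈ as ++ bs
    j∈T = ∈.∈-++⁺ˡ j∈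
    at-z : ∀ {p w} → Outer p → π w ≡ x → edge j p w → w ≢ mate p → p ≡ z
    at-z = touch-x val onl j∈ (∈cs j∈T) (∉Js j∈T) refl y≢x refl
    nm′ : a ≢ mate b
    nm′ k = nm (trans (sym (mate² b)) (cong mate (sym k)))
    corner : ∀ {p w} → Outer p → Class w → π w ≡ x → edge j p w → w ≢ mate p → Touch x us⁺ y w p
    corner o cw πw e nm with at-z o πw e nm | cw
    ... | refl | outer o′ = ⊥-elim (proj₁ o′ (trans (sym (π-≢x o′)) πw))
    ... | refl | is-v refl = inj₁ (inj₂ (inj₁ (sym uv , refl)))
    -- The forbidden path is x -j- z (mate z) -c- r.
    ... | refl | is-x refl = let r , o , r≢ , r≢′ , e′ = c-prev in
      ⊥-elim (shoot (clear j∈T o r≢ r≢′) (∈cs j∈T) (extend stay (edge-sym e) ∈-[] z-cov ∈-[] ∈-[]) (edge-sym e′)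
        (here refl ∷⊑ there (there (here refl)) ∷⊑ ∈-[])
        ((λ k → ≢c j∈T (sym k)) ∷∉ ∈-[])
        (there (there (here refl)) ∷⊑ there (there (there (here refl))) ∷⊑ ∈-[]))
    -- The forbidden path is x -d- v u -j- z (mate z) -c- r.
    ... | refl | is-u refl = let r , o , r≢ , r≢′ , e′ = c-prev in
      ⊥-elim (shoot (clear j∈T o r≢ r≢′) (∈cs j∈T)
        (extend (toU xv) (edge-sym e) ((λ k → ≢d j∈T k) ∷∉ ∈-[]) z-cov
          ((λ k → proj₂ (proj₂ z-outer) k) ∷∉ (λ k → proj₁ (proj₂ z-outer) k) ∷∉ ∈-[])
          ((λ k → proj₂ (proj₂ (mate-outer z-outer)) k) ∷∉ (λ k → proj₁ (proj₂ (mate-outer z-outer)) k) ∷∉ ∈-[]))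
        (edge-sym e′)
        (here refl ∷⊑ there (there (here refl)) ∷⊑ there (here refl) ∷⊑ ∈-[])
        ((λ k → ≢c j∈T (sym k)) ∷∉ (λ k → c≢d k) ∷∉ ∈-[])
        (there (there (here refl)) ∷⊑ there (there (there (here refl))) ∷⊑ there (here refl) ∷⊑ here refl ∷⊑ ∈-[]))
    at-x : ∀ {w} → Class w → (π w ≡ x) ⊎ Outer w
    at-x = Modes.π-in s
    go : Class a → Class b → Touch x us⁺ y a b
    go ca cb with at-x ca | at-x cb
    ... | inj₁ p | inj₁ p′ = ⊥-elim (q (trans p (sym p′)))
    ... | inj₁ p | inj₂ o  = corner o ca p (edge-sym e) nm′
    ... | inj₂ o | inj₁ p  = swapTouch (corner o cb p e nm)
    ... | inj₂ o | inj₂ o′ = shift-touch (proj₁ o) (proj₁ o′)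
      (subst₂ (Touch x (z ∷ us) y) (π-≢x o) (π-≢x o′) (touch-π onl j∈ e q nm))

module Following {n : ℕ} (mate : Fin n → Fin n) (mate² : ∀ v → mate (mate v) ≡ v) where
  open Threads mate mate² using (Inner; Thread; Thread-source; Thread-target; stop; verts; verts-++; verts-covered; verts-∈)

  private
    V = Fin n

  First : List V → V → V → Set
  First []      y b = b ≡ y
  First (w ∷ _) y b = b ≡ w

  stop-∈ : ∀ {p} us → stop p us ≡ p ⊎ stop p us ∈ verts us
  stop-∈ []       = inj₁ refl
  stop-∈ (u ∷ us) with stop-∈ {mate u} us
  ... | inj₁ e = inj₂ (there (here e))
  ... | inj₂ k = inj₂ (there (there k))

  stop-mate : ∀ {p} us → stop p us ≡ p ⊎ mate (stop p us) ∈ us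
  stop-mate []       = inj₁ refl
  stop-mate (u ∷ us) with stop-mate {mate u} us
  ... | inj₁ e = inj₂ (here (trans (cong mate e) (mate² u)))
  ... | inj₂ k = inj₂ (there k)

  first-edge : ∀ {p} us₁ {us₂ y b} → Unique (p ∷ verts (us₁ ++ us₂)) → Thread p (us₁ ++ us₂) y (stop p us₁) b → First us₂ y b
  first-edge [] {[]}     _ (_ , e)        = e
  first-edge [] {w ∷ us} _ (inj₁ (_ , e)) = e
  first-edge [] {w ∷ us} (a ∷ _) (inj₂ th) with Thread-source us th
  ... | inj₁ e = ⊥-elim (All.lookup a (there (here refl)) e)
  ... | inj₂ k = ⊥-elim (All.lookup a (there (there k)) refl)
  first-edge {p} (w ∷ us₁) {us₂} (a ∷ _) (inj₁ (e , _)) with stop-∈ {mate w} us₁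
  ... | inj₁ e′ = ⊥-elim (All.lookup a (there (here refl)) (trans (sym e) e′))
  ... | inj₂ k  = ⊥-elim (All.lookup a (there (there (subst (stop (mate w) us₁ ∈_) (sym (verts-++ us₁ us₂)) (∈.∈-++⁺ˡ k)))) (sym e))
  first-edge (w ∷ us₁) (_ ∷ _ ∷ u) (inj₂ th) = first-edge us₁ u th

  mate-∉ : ∀ {w us} → Unique (verts us) → w ∈ us → mate w ∉ us
  mate-∉ {us = u ∷ us} ((a ∷ _) ∷ b ∷ _) (here refl) (here e)  = a (sym e)
  mate-∉ {us = u ∷ us} ((a ∷ _) ∷ b ∷ _) (here refl) (there k) = All.lookup b (verts-∈ k) refl
  mate-∉ {us = u ∷ us} ((a ∷ _) ∷ b ∷ _) (there k) (here e)    = All.lookup b (verts-∈ k) (trans (cong mate (sym e)) (mate² _))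
  mate-∉ {us = u ∷ us} (_ ∷ _ ∷ c) (there k) (there l)         = mate-∉ c k l

  -- Thread edges point to vertices of the list or to `y`, whereas a walk along the thread stands at
  -- `p` or at the mate of a listed vertex.
  not-back : ∀ {p} us₁ {us₂ y a} → Unique (verts (us₁ ++ us₂)) → p ∉ us₁ ++ us₂ → mate p ≡ p → mate y ≡ y → p ≢ y →
             Thread p (us₁ ++ us₂) y a (stop p us₁) → ⊥
  not-back {p} us₁ {us₂} u p∉ fp fy p≢y th with Thread-target (us₁ ++ us₂) th | stop-mate {p} us₁
  ... | inj₁ e | inj₁ e′ = p≢y (trans (sym e′) e)
  ... | inj₁ e | inj₂ k  = verts-covered u (verts-∈ (∈.∈-++⁺ˡ {ys = us₂} (subst (_∈ us₁) (trans (cong mate e) fy) k))) fy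
  ... | inj₂ l | inj₁ e′ = p∉ (subst (_∈ us₁ ++ us₂) e′ l)
  ... | inj₂ l | inj₂ k  = mate-∉ u l (∈.∈-++⁺ˡ k)

  Inner-snoc : ∀ {p} us {w a b} → Inner p (us ++ w ∷ []) a b → Inner p us a b ⊎ (a ≡ stop p us × b ≡ w)
  Inner-snoc []       (inj₁ e) = inj₂ e
  Inner-snoc (u ∷ us) (inj₁ e) = inj₁ (inj₁ e)
  Inner-snoc (u ∷ us) (inj₂ t) with Inner-snoc us t
  ... | inj₁ s = inj₁ (inj₂ s)
  ... | inj₂ s = inj₂ s

  Thread-last : ∀ {p} us {y a b} → Thread p us y a b → Inner p us a b ⊎ (a ≡ stop p us × b ≡ y)
  Thread-last []       e        = inj₂ e
  Thread-last (u ∷ us) (inj₁ e) = inj₁ (inj₁ e)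
  Thread-last (u ∷ us) (inj₂ t) with Thread-last us t
  ... | inj₁ s = inj₁ (inj₂ s)
  ... | inj₂ s = inj₂ s


module NewColour {n m : ℕ} {𝒮 : System n m} {cs t x u v c d} {s : Setup 𝒮 cs t x u v c d}
                 {i y z us as bs} (F : Full s i y z us as bs)
                 (others : ∀ i′ → i′ ≢ i → Threads.Valid (System.mate 𝒮) (System.mate² 𝒮) (System.edge 𝒮) (Setup.S s i′)) where
  open Setup s using (c∈; c≢d; d∈; none; uv; u∉verts; verts-disjoint; vertsOf; vu; v∉verts; x-free; xv)
  open Alternating 𝒮 using (Reach; edge; edge-sym; here; mate; mate²)
  open Threads mate mate² using (Thread; Thread-++ʳ; Touch; Valid; verts; verts-∈⁻)
  open Reaching 𝒮 using (Ordered; as!; as∩bs; bs!; close; length-at; order-in; split-disjoint; split-length; stay; to-tgt; verts-suffix)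
  open Work s using (Outer; away; hit-u; hit-x; locate; lower; module 𝓡)
  open Full F using (a; as-all)
  open At a using (cols⊑T; val; verts⊑; y≢x; ⊑verts)
  open Entry a using (head-v; ∈cs; ≢c; ≢d)
  open Extend F using (farA; nearA; us⁺; y-free)
  open Extended F others using (farB; nearB; no-xv; shift-thread; swapTouch)
  open Cross s using (Place; Rooted; apart; cross; free; root-of; strip)
  open Modes s using (classify; is-x; is-u; is-v; outer; Class)

  -- The colour `k` pays for the detour from `x` through the triangle. Towards the B-side it is `d`;
  -- towards the A-side it has to be a colour of `as`, since `c` is spent on `pq`.
  finish : ∀ {p q k es fs zs ws} → Reach x p (k ∷ es) (u ∷ v ∷ zs) → Reach y q fs ws → edge c p q → k ∈ cs → k ≢ c → k ∉ fs →
           es ⊑ (as ++ bs) → fs ⊑ (as ++ bs) → (∀ {e} → e ∈ es → e ∉ fs) → (∀ {w} → w ∈ zs → w ∉ ws) →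
           ws ⊑ verts (z ∷ us) → ⊥
  finish {k = k} {es} {fs} {zs} {ws} R R′ pq k∈ k≢c k∉ es⊑ fs⊑ dis dis′ ws⊑ =
    none (close x-free y-free (λ q → y≢x (sym q)) R R′ pq c∈
      ((λ q → k≢c (sym q)) ∷∉ (λ j → ≢c (es⊑ j) refl)) (λ j → ≢c (fs⊑ j) refl)
      (k∈ ∷⊑ (λ j → ∈cs (es⊑ j))) (λ j → ∈cs (fs⊑ j))
      (k∉ ∷# dis)
      ((λ j → u∉verts i (verts⊑ (ws⊑ j))) ∷# (λ j → v∉verts i (verts⊑ (ws⊑ j))) ∷# dis′))

  inA : ∀ {es} → es ⊑ as → es ⊑ (as ++ bs)
  inA s j = ∈.∈-++⁺ˡ (s j)

  inB : ∀ {es} → es ⊑ bs → es ⊑ (as ++ bs)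
  inB s j = ∈.∈-++⁺ʳ as (s j)

  A! : Unique as
  A! = 𝓡.as! val

  B! : Unique bs
  B! = 𝓡.bs! val

  AB : ∀ {e} → e ∈ as → e ∉ bs
  AB = 𝓡.as∩bs val

  as# : length as ≡ length (z ∷ us)
  as# = Valid.as# val

  bs# : length bs ≡ length (z ∷ us)
  bs# = Valid.bs# val

  -- Entering p from x and q from y uses too many colours of as only when p and q are
  -- consecutive on the thread.
  ordered : ∀ {p q} → Outer p → (O : Ordered (z ∷ us) p q) → edge c p q → Thread x us⁺ y p q
  ordered {p} {q} o record { us₁ = us₁ ; ws = ws ; us₂ = us₂ ; p′ = p′ ; q′ = q′ ; split = split ; p≈ = p≈ ; q≈ = q≈ } pq = go p≈ q≈
    where
    split′ : z ∷ us ≡ (us₁ ++ p′ ∷ ws) ++ q′ ∷ us₂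
    split′ = trans split (sym (List.++-assoc us₁ (p′ ∷ ws) _))
    len : length (z ∷ us) ≡ suc (length us₁) + (length ws + suc (length us₂))
    len = split-length {us₁ = us₁} {ws} split
    apart′ : ∀ {w} → w ∈ verts (us₁ ++ p′ ∷ []) → w ∉ verts (q′ ∷ us₂)
    apart′ = split-disjoint {us₁ = us₁} {ws = ws} (Valid.verts! val) split
    tail⊑ : verts (q′ ∷ us₂) ⊑ verts (z ∷ us)
    tail⊑ j = subst (λ l → _ ∈ verts l) (sym split′) (verts-suffix (us₁ ++ p′ ∷ ws) j)
    mate-back : ∀ {a b} → a ≡ mate b → mate a ≡ b
    mate-back e = trans (cong mate e) (mate² _)
    a≤ : ∀ {k} → k ≤ length (z ∷ us) → k ≤ length as
    a≤ = subst (_ ≤_) (sym as#)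
    b≤ : ∀ {k} → k ≤ length (z ∷ us) → k ≤ length bs
    b≤ = subst (_ ≤_) (sym bs#)
    ≤len : ∀ {k} → k ≤ suc (length us₁) + (length ws + suc (length us₂)) → k ≤ length (z ∷ us)
    ≤len l = ℕ.≤-trans l (ℕ.≤-reflexive (sym len))
    first≤ : suc (length us₁) + 0 ≤ length (z ∷ us)
    first≤ = subst₂ _≤_ (sym (ℕ.+-identityʳ _)) (sym len) (ℕ.m≤m+n _ _)
    first+1≤ : suc (length us₁) + 1 ≤ length (z ∷ us)
    first+1≤ = ≤len (ℕ.+-monoʳ-≤ (suc (length us₁)) (ℕ.≤-trans (s≤s z≤n) (ℕ.m≤n+m _ (length ws))))
    last≤ : suc (length us₂) + 0 ≤ length (z ∷ us)
    last≤ = subst₂ _≤_ (sym (ℕ.+-identityʳ _)) (sym len) (ℕ.≤-trans (ℕ.m≤n+m _ (length ws)) (ℕ.m≤n+m _ (suc (length us₁))))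
    both≤ : suc (length us₁) + suc (length us₂) ≤ length (z ∷ us)
    both≤ = ≤len (ℕ.+-monoʳ-≤ (suc (length us₁)) (ℕ.m≤n+m _ (length ws)))
    go : p′ ≡ p ⊎ p′ ≡ mate p → q′ ≡ q ⊎ q′ ≡ mate q → Thread x us⁺ y p q
    go (inj₁ refl) (inj₁ refl) with pick {xs = bs} _ 0 B! (b≤ first≤) | pick {xs = as} _ 0 A! (a≤ last≤)
    ... | es , _ , es! , _ , es⊑ , _ , l , _ | fs , _ , fs! , _ , fs⊑ , _ , l′ , _ =
      ⊥-elim (finish (nearB split es! es⊑ l xv (λ j → ≢d (inB es⊑ j) refl)) (farA {us₁ = us₁ ++ p ∷ ws} split′ fs! fs⊑ l′) pq d∈
        (λ k → c≢d (sym k)) (λ j → ≢d (inA fs⊑ j) refl) (inB es⊑) (inA fs⊑) (λ j j′ → AB (fs⊑ j′) (es⊑ j)) apart′ tail⊑)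
    go (inj₁ refl) (inj₂ eq) with pick {xs = bs} _ _ B! (b≤ both≤)
    ... | es , fs , es! , fs! , es⊑ , fs⊑ , l , l′ , dis =
      ⊥-elim (finish (nearB split es! es⊑ l xv (λ j → ≢d (inB es⊑ j) refl))
        (subst (λ w → Reach y w fs (verts (q′ ∷ us₂))) (mate-back eq) (farB {us₁ = us₁ ++ p ∷ ws} split′ fs! fs⊑ l′)) pq d∈
        (λ k → c≢d (sym k)) (λ j → ≢d (inB fs⊑ j) refl) (inB es⊑) (inB fs⊑) dis apart′ tail⊑)
    go (inj₂ eq) (inj₂ eq′) with pick {xs = as} _ 1 A! (a≤ first+1≤) | pick {xs = bs} _ 0 B! (b≤ last≤)
    ... | es , k ∷ [] , es! , _ , es⊑ , k⊑ , l , _ , dis | fs , _ , fs! , _ , fs⊑ , _ , l′ , _ =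
      ⊥-elim (finish (subst (λ w → Reach x w (k ∷ es) (u ∷ v ∷ verts (us₁ ++ p′ ∷ []))) (mate-back eq)
          (nearA split es! es⊑ l (proj₂ (as-all (k⊑ (here refl)))) (λ j → dis j (here refl))))
        (subst (λ w → Reach y w fs (verts (q′ ∷ us₂))) (mate-back eq′) (farB {us₁ = us₁ ++ p′ ∷ ws} split′ fs! fs⊑ l′)) pq
        (∈cs (inA k⊑ (here refl))) (≢c (inA k⊑ (here refl))) (λ j → AB (k⊑ (here refl)) (fs⊑ j))
        (inA es⊑) (inB fs⊑) (λ j j′ → AB (es⊑ j) (fs⊑ j′)) apart′ tail⊑)
    go (inj₂ eq) (inj₁ refl) = consecutive ws refl
      where
      consecutive : ∀ ws′ → ws ≡ ws′ → Thread x us⁺ y p q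
      consecutive [] w≡ = shift-thread (proj₁ o) (subst (λ l → Thread x l y p q) (sym (trans split (cong (λ l → us₁ ++ p′ ∷ l ++ q ∷ us₂) w≡)))
        (Thread-++ʳ us₁ (inj₁ (sym (mate-back eq) , refl))))
      consecutive (w ∷ ws′) w≡ with pick {xs = as} (suc (length us₁)) (suc (suc (length us₂))) A!
          (a≤ (≤len (ℕ.+-monoʳ-≤ (suc (length us₁))
            (subst (λ l → suc (suc (length us₂)) ≤ length l + suc (length us₂)) (sym w≡) (s≤s (ℕ.m≤n+m _ (length ws′)))))))
      ... | es , k ∷ fs , es! , k∉fs ∷ fs! , es⊑ , kfs⊑ , l , l′ , dis =
        ⊥-elim (finish (subst (λ w → Reach x w (k ∷ es) (u ∷ v ∷ verts (us₁ ++ p′ ∷ []))) (mate-back eq)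
            (nearA split es! es⊑ l (proj₂ (as-all (kfs⊑ (here refl)))) (λ j → dis j (here refl))))
          (farA {us₁ = us₁ ++ p′ ∷ ws} split′ fs! (λ j → kfs⊑ (there j)) (ℕ.suc-injective l′)) pq
          (∈cs (inA kfs⊑ (here refl))) (≢c (inA kfs⊑ (here refl))) (λ j → All.lookup k∉fs j refl)
          (inA es⊑) (inA (λ j → kfs⊑ (there j))) (λ j j′ → dis j (there j′)) apart′ tail⊑)

  -- Only from the last matching edge, left as the A-thread leaves it, would the walk from `x` need
  -- one colour of `as` more than there are; that case is the last edge of the thread.
  to-end : ∀ {p} → Outer p → p ∈ verts (z ∷ us) → edge c p y → Thread x us⁺ y p y
  to-end {p} o p∈ py with verts-∈⁻ (z ∷ us) p∈
  ... | inj₁ k with ∈.∈-∃++ k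
  ... | us₁ , us₂ , eq with pick {xs = bs} (suc (length us₁)) 0 B!
        (subst₂ _≤_ (sym (ℕ.+-identityʳ _)) (sym (trans bs# (length-at {us₁ = us₁} eq)))
          (subst (_≤ length us₁ + suc (length us₂)) (ℕ.+-comm (length us₁) 1) (ℕ.+-monoʳ-≤ (length us₁) (s≤s z≤n))))
  ... | es , _ , es! , _ , es⊑ , _ , l , _ =
    ⊥-elim (finish {fs = []} {ws = []} (nearB eq es! es⊑ l xv (λ j → ≢d (inB es⊑ j) refl)) stay py d∈ (λ k → c≢d (sym k)) ∈-[]
      (inB es⊑) ∈-[] (λ _ → ∈-[]) (λ _ → ∈-[]) ∈-[])
  to-end {p} o p∈ py | inj₂ k with ∈.∈-∃++ k
  ... | us₁ , [] , eq = shift-thread (proj₁ o) (subst (λ l → Thread x l y p y) (sym eq) (Thread-++ʳ us₁ (sym (mate² p) , refl)))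
  ... | us₁ , w ∷ us₂ , eq with pick {xs = as} (suc (length us₁)) 1 A!
        (subst (_ ≤_) (sym (trans as# (length-at {us₁ = us₁} eq)))
          (subst (_≤ length us₁ + suc (suc (length us₂))) (trans (ℕ.+-comm (length us₁) 2) (cong suc (ℕ.+-comm 1 (length us₁))))
            (ℕ.+-monoʳ-≤ (length us₁) (s≤s (s≤s z≤n)))))
  ... | es , k ∷ [] , es! , _ , es⊑ , k⊑ , l , _ , dis =
    ⊥-elim (finish {fs = []} {ws = []} (subst (λ w → Reach x w (k ∷ es) (u ∷ v ∷ verts (us₁ ++ mate p ∷ []))) (mate² p)
        (nearA eq es! es⊑ l (proj₂ (as-all (k⊑ (here refl)))) (λ j → dis j (here refl))))
      stay py (∈cs (inA k⊑ (here refl))) (≢c (inA k⊑ (here refl))) ∈-[] (inA es⊑) ∈-[] (λ _ → ∈-[]) (λ _ → ∈-[]) ∈-[])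

  within : ∀ {p q} → Outer p → Outer q → p ∈ verts (z ∷ us) → q ∈ verts (z ∷ us) → p ≢ q → q ≢ mate p → edge c p q → Touch x us⁺ y p q
  within o o′ p∈ q∈ ne nm pq with order-in p∈ q∈ (λ k → ne (sym k)) nm
  ... | inj₁ O = inj₁ (ordered o O pq)
  ... | inj₂ O = inj₂ (ordered o′ O (edge-sym pq))

  Spot : Fin n → Set
  Spot p = Place p ⊎ p ∈ vertsOf i

  spot : ∀ {p} → Outer p → Spot p
  spot (_ , p≢u , p≢v) with locate p≢u p≢v
  ... | inj₁ f = inj₁ (free f)
  ... | inj₂ (i′ , k) with i′ Fin.≟ i
  ... | yes refl = inj₂ k
  ... | no ne    = inj₁ (strip i′ k (others i′ ne))

  y≡tgt : ∀ {p} → p ∈ vertsOf i → ∀ {e} → y ≢ e → Rooted p e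
  y≡tgt p∈ ne = record { r-free = y-free ; r≢e = ne ; reach = lower (𝓡.to-tgt val (⊑verts p∈)) y≢x
    ; es⊑ = λ k → i , p∈ , cols⊑T k ; zs⊑ = λ k → i , p∈ , verts⊑ k }

  one-side : ∀ {p q} → Outer p → p ∈ vertsOf i → Place q → (q ∉ vertsOf i) → edge c p q → Thread x us⁺ y p q
  one-side {p} {q} o p∈ Q q∉ pq with q Fin.≟ y
  ... | yes refl = to-end o (⊑verts p∈) pq
  ... | no ne = ⊥-elim (apart P (root-of Q y (λ _ → ne)) (λ {i′} k l → q∉ (subst (λ i → q ∈ vertsOf i) (verts-disjoint k p∈) l)) pq)
    where
    P : Rooted p x
    P = y≡tgt p∈ y≢x

  inner-only : ∀ {p q} → Outer p → Outer q → edge c p q → p ≢ q → q ≢ mate p → Touch x us⁺ y p q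
  inner-only {p} {q} o o′ pq ne nm with spot o | spot o′
  ... | inj₂ k | inj₂ l = within o o′ (⊑verts k) (⊑verts l) ne nm pq
  ... | inj₁ P | inj₁ Q = ⊥-elim (cross o ne nm pq P Q)
  ... | inj₂ k | inj₁ Q with mem? Fin._≟_ q (vertsOf i)
  ... | yes l = within o o′ (⊑verts k) (⊑verts l) ne nm pq
  ... | no l  = inj₁ (one-side o k Q l pq)
  inner-only {p} {q} o o′ pq ne nm | inj₁ P | inj₂ l with mem? Fin._≟_ p (vertsOf i)
  ... | yes k = within o o′ (⊑verts k) (⊑verts l) ne nm pq
  ... | no k  = inj₂ (one-side o′ l P k (edge-sym pq))

  c-only : ∀ {a b} → edge c a b → a ≢ b → b ≢ mate a → Touch x us⁺ y a b
  c-only {a} {b} e ne nm = go (classify a) (classify b)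
    where
    nm′ : a ≢ mate b
    nm′ k = nm (trans (sym (mate² b)) (cong mate (sym k)))
    c∉bs : c ∉ bs
    c∉bs k = ≢c (inB (λ j → j) k) refl
    a₀ : ∃[ j ] j ∈ as
    a₀ = inhabited (subst (0 <_) (sym as#) (s≤s z≤n))
    corner : ∀ {w p} → Class w → Outer p → edge c w p → w ≢ p → p ≢ mate w → Touch x us⁺ y w p
    corner (outer o) o′ e ne nm  = inner-only o o′ e ne nm
    corner (is-x refl) o e _ _ = ⊥-elim (hit-x (away o) (edge-sym e) c∈)
    corner (is-u refl) o e _ _ = ⊥-elim (hit-u (away o) (edge-sym e) c∈ c≢d)
    corner (is-v refl) o e _ _ with head-v (proj₂ a₀) (proj₂ (as-all (proj₂ a₀))) o (edge-sym e)
    ... | refl = inj₁ (inj₂ (inj₁ (sym uv , refl)))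
    go : Class a → Class b → Touch x us⁺ y a b
    go ca (outer o) = corner ca o e ne nm
    go (outer o) cb = swapTouch (corner cb o (edge-sym e) (λ k → ne (sym k)) nm′)
    go (is-x refl) (is-x refl) = ⊥-elim (ne refl)
    go (is-x refl) (is-u refl) = inj₁ (inj₁ (refl , refl))
    go (is-x refl) (is-v refl) = ⊥-elim (no-xv c∈ c≢d c∉bs e)
    go (is-u refl) (is-x refl) = inj₂ (inj₁ (refl , refl))
    go (is-u refl) (is-u refl) = ⊥-elim (ne refl)
    go (is-u refl) (is-v refl) = ⊥-elim (nm (sym uv))
    go (is-v refl) (is-x refl) = ⊥-elim (no-xv c∈ c≢d c∉bs (edge-sym e))
    go (is-v refl) (is-u refl) = ⊥-elim (nm (sym vu))
    go (is-v refl) (is-v refl) = ⊥-elim (ne refl)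

module Traverse {n m : ℕ} {𝒮 : System n m} {cs t x u v c d} {s : Setup 𝒮 cs t x u v c d}
                {i y z us as bs} (F : Full s i y z us as bs)
                (others : ∀ i′ → i′ ≢ i → Threads.Valid (System.mate 𝒮) (System.mate² 𝒮) (System.edge 𝒮) (Setup.S s i′)) where
  open Setup s using (Js; only; u-cov; uv; u∉verts; v∉verts; x-free)
  open Alternating 𝒮 using (Augmenting; Free; Walk; edge; edge-≡; here; mate; mate²; reverseAug; step; step-nonmatching; walk-end)
  open Threads mate mate² using (Inner; Thread; Thread-source; Thread-target; Touch; Valid; stop; stop-snoc; verts; verts-covered; verts-∈)
  open Following mate mate² using (First; Inner-snoc; Thread-last; first-edge; not-back)
  open Work s using (c-rich)
  open Full F using (a; as-all)
  open At a using (val; verts⊑; y≢x)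
  open Extend F using (as-edges; us⁺; y-free)
  open Extended F others using (as-only)
  open NewColour F others using (c-only)
  open Modes s using (own-colour; last-edge)
  open Real 𝒮 using (Half)

  us⁺! : Unique (verts us⁺)
  us⁺! = subst (λ w → Unique (u ∷ w ∷ verts (z ∷ us))) (sym uv)
    (Unique-∷ ((λ e → u-cov (trans uv (sym e))) ∷∉ (λ k → u∉verts i (verts⊑ k)))
      (Unique-∷ (λ k → v∉verts i (verts⊑ k)) (Valid.verts! val)))

  x∉us⁺ : x ∉ verts us⁺
  x∉us⁺ k = verts-covered us⁺! k x-free

  next : ∀ us₁ {us₂ p b} → us⁺ ≡ us₁ ++ us₂ → p ≡ stop x us₁ → edge c p b → p ≢ b → b ≢ mate p → First us₂ y b
  next us₁ {us₂} {p} {b} eq refl e ne nm with c-only e ne nm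
  ... | inj₁ th = first-edge us₁ (subst (λ l → Unique (x ∷ verts l)) eq (Unique-∷ x∉us⁺ us⁺!)) (subst (λ l → Thread x l y p b) eq th)
  ... | inj₂ th = ⊥-elim (not-back us₁ (subst (λ l → Unique (verts l)) eq us⁺!) (λ k → x∉us⁺ (verts-∈ (subst (x ∈_) (sym eq) k)))
      x-free y-free (λ k → y≢x (sym k)) (subst (λ l → Thread x l y b p) eq th))

  record Upto (p : Fin n) : Set where
    field
      us₁ us₂ : List (Fin n)
      split   : us⁺ ≡ us₁ ++ us₂
      p≡      : p ≡ stop x us₁
      done    : ∀ {a b} → Inner x us₁ a b → edge c a b

  in-us⁺ : ∀ us₁ {w us₂} → us⁺ ≡ us₁ ++ w ∷ us₂ → ¬ Free w
  in-us⁺ us₁ {w} {us₂} eq = verts-covered us⁺! (verts-∈ (subst (w ∈_) (sym eq) (∈.∈-++⁺ʳ us₁ (here refl))))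

  -- By `c-only` every stop has just one onward edge of colour `c`, so a walk in `c` from `x` has no
  -- choice.
  follow-thread : ∀ {p es vs} → Walk x p es vs → es ⊑ (c ∷ Js) → Unique vs → Upto p
  follow-thread here _ _ = record { us₁ = [] ; us₂ = us⁺ ; split = refl ; p≡ = refl ; done = λ () }
  follow-thread (step {p = p} {q} w e refl) s⊑ vs!@((a ∷ a′) ∷ _ ∷ vs′!) with follow-thread w (λ k → s⊑ (there k)) vs′!
  ... | record { us₁ = us₁ ; us₂ = us₂ ; split = split ; p≡ = p≡ ; done = done } =
    go us₂ split (next us₁ split p≡ e′ p≢q q≢)
    where
    q≢ : q ≢ mate p
    q≢ = step-nonmatching w x-free refl vs!
    p≢q : p ≢ q
    p≢q refl with walk-end w
    ... | inj₁ refl = a (sym x-free)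
    ... | inj₂ k    = All.lookup a′ k refl
    e′ : edge c p q
    e′ = own-colour (s⊑ (here refl)) e p≢q q≢
    go : ∀ us₂ → us⁺ ≡ us₁ ++ us₂ → First us₂ y q → Upto (mate q)
    go [] _ refl = ⊥-elim (a (sym y-free))
    go (_ ∷ us₃) eq refl = record
      { us₁ = us₁ ++ q ∷ [] ; us₂ = us₃ ; split = trans eq (sym (List.++-assoc us₁ (q ∷ []) us₃))
      ; p≡ = sym (stop-snoc us₁)
      ; done = λ k → [ done , (λ (a≡ , b≡) → edge-≡ (trans p≡ (sym a≡)) (sym b≡) e′) ]′ (Inner-snoc us₁ k) }

  runs-through : ∀ {y₀ es} → Augmenting x y₀ es → es ⊑ (c ∷ Js) → ∀ {a b} → Thread x us⁺ y a b → edge c a b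
  runs-through {y₀} P s⊑ {a} {b} with follow-thread walk (λ k → s⊑ (↭.∈-resp-↭ (↭-sym colours) (there k))) simple | last-edge P s⊑
    where open Augmenting P
  ... | record { us₁ = us₁ ; us₂ = us₂ ; split = split ; p≡ = p≡ ; done = done } | e , ne , nm = go us₂ split (next us₁ split p≡ e ne nm)
    where
    go : ∀ us₂ → us⁺ ≡ us₁ ++ us₂ → First us₂ y y₀ → Thread x us⁺ y a b → edge c a b
    go (w ∷ _) eq refl th = ⊥-elim (in-us⁺ us₁ eq (Augmenting.y-free P))
    go [] eq refl th with Thread-last us₁ (subst (λ l → Thread x l y a b) (trans eq (List.++-identityʳ us₁)) th)
    ... | inj₁ k         = done k
    ... | inj₂ (a≡ , b≡) = edge-≡ (trans p≡ (sym a≡)) (sym b≡) e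

  final : ∀ {x₀ y₀ es} → Augmenting x₀ y₀ es → es ⊑ (c ∷ Js) → y₀ ≡ x ⊎ y₀ ≡ y
  final P s⊑ with last-edge P s⊑
  ... | e , ne , nm with c-only e ne nm
  ... | inj₁ th with Thread-target us⁺ th
  ... | inj₁ k = inj₂ k
  ... | inj₂ k = ⊥-elim (verts-covered us⁺! (verts-∈ k) (Augmenting.y-free P))
  final P s⊑ | e , ne , nm | inj₂ th with Thread-source us⁺ th
  ... | inj₁ k = inj₁ k
  ... | inj₂ k = ⊥-elim (verts-covered us⁺! k (Augmenting.y-free P))

  -- The path granted to `c ∷ Js` joins `x` to `y`; being forced along the thread, it shows all the
  -- edges of the thread in `c`.
  c-edges : ∀ {a b} → Thread x us⁺ y a b → edge c a b
  c-edges th with c-rich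
  ... | x₀ , y₀ , es , P , s⊑ with final P s⊑ | final (reverseAug P) s⊑
  ... | inj₁ refl | _         = runs-through (reverseAug P) s⊑ th
  ... | inj₂ _    | inj₁ refl = runs-through P s⊑ th
  ... | inj₂ p    | inj₂ q    = ⊥-elim (Augmenting.x≢y P (trans q (sym p)))

  T⁺ : Strip n m
  T⁺ = strip x y us⁺ (c ∷ as) (d ∷ bs)

  half⁺ : Half T⁺
  half⁺ = record { edges = edges′ ; only = only′ }
    where
    edges′ : ∀ {j a b} → j ∈ c ∷ as → Thread x us⁺ y a b → edge j a b
    edges′ (here refl) th                         = c-edges th
    edges′ (there j∈) (inj₁ (refl , refl))        = proj₂ (as-all j∈)
    edges′ {j} {a} {b} (there j∈) (inj₂ th) = as-edges j∈ (subst (λ w → Thread w (z ∷ us) y a b) uv th)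
    only′ : ∀ {j a b} → j ∈ c ∷ as → edge j a b → a ≢ b → b ≢ mate a → Touch x us⁺ y a b
    only′ (here refl) = c-only
    only′ (there j∈)  = as-only j∈

module _ {n m : ℕ} {𝒮 : System n m} {cs t x u v c d} {s : Setup 𝒮 cs t x u v c d}
         {i y z us as bs} (F : Full s i y z us as bs)
         (others : ∀ i′ → i′ ≢ i → Threads.Valid (System.mate 𝒮) (System.mate² 𝒮) (System.edge 𝒮) (Setup.S s i′)) where
  open Setup s using (c∉cols; c≢d; d∉cols; uv; x-free)
  open Alternating 𝒮 using (edge; here; mate; mate²)
  open Threads mate mate² using (Only; Valid; swapStrip)
  open Real 𝒮 using (Half; join-only)
  open Traverse F others using (T⁺; half⁺; us⁺!)
  open Full F using (a)
  open At a using (cols⊑T; val; y≢x)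

  -- The roles of `u`, `v`, of `c`, `d` and of the two sides are exchanged together, so the first
  -- half applies.
  half⁺-swap : Half (swapStrip T⁺)
  half⁺-swap = subst (λ w → Half (strip x y (w ∷ mate z ∷ map mate us) (d ∷ bs) (c ∷ as))) (sym uv)
    (Traverse.half⁺ (flipFull {s = s} F) others)

  extended-valid : Valid edge T⁺
  extended-valid = record
    { src-free = x-free ; tgt-free = Valid.tgt-free val ; src≢tgt = λ k → y≢x (sym k)
    ; verts! = us⁺! ; 0<us = s≤s z≤n ; as# = cong suc (Valid.as# val) ; bs# = cong suc (Valid.bs# val)
    ; cols! = Unique-∷ (λ k → c∉ (↭.∈-resp-↭ σ k)) (Unique-↭ (↭-sym σ) (Unique-∷ d∉ (Valid.cols! val)))
    ; A-edges = Half.edges half⁺ ; B-edges = Half.edges half⁺-swap }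
    where
    σ : as ++ d ∷ bs ↭ d ∷ as ++ bs
    σ = ↭.shift d as bs
    d∉ : d ∉ as ++ bs
    d∉ k = d∉cols i (cols⊑T k)
    c∉ : c ∉ d ∷ as ++ bs
    c∉ (here e)  = c≢d e
    c∉ (there k) = c∉cols i (cols⊑T k)

  extended-only : Only edge T⁺
  extended-only = join-only half⁺ half⁺-swap

-- Rebuilding the decomposition around the triangle

sum-update : {X : Set} {f g : X → ℕ} {x : X} (xs : List X) → Unique xs → x ∈ xs → g x ≡ suc (f x) →
             (∀ {y} → y ≢ x → g y ≡ f y) → sum (map g xs) ≡ suc (sum (map f xs))
sum-update {f = f} {g} (x ∷ xs) u@(_ ∷ _) (here refl) e e′ = cong₂ _+_ e (rest xs (∉-head u))
  where
  rest : ∀ ys → x ∉ ys → sum (map g ys) ≡ sum (map f ys)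
  rest []       _  = refl
  rest (y ∷ ys) x∉ = cong₂ _+_ (e′ (λ k → x∉ (here (sym k)))) (rest ys (λ k → x∉ (there k)))
sum-update {f = f} (y ∷ ys) u@(_ ∷ u′) (there i) e e′ =
  trans (cong₂ _+_ (e′ (λ { refl → ∉-head u i })) (sum-update ys u′ i e e′)) (ℕ.+-suc (f y) _)

module Settle {n m : ℕ} {𝒮 : System n m} {cs t x u v c d} (s : Setup 𝒮 cs t x u v c d) where
  open Setup s using (S; h)
  open Alternating 𝒮 using (edge; edge-≡; mate; mate²)
  open Threads mate mate² using (Only; Valid)
  open Real 𝒮 using (join-only; join-valid)

  Direct : Fin h → Set
  Direct i = ∃[ y ] ∃[ z ] ∃[ us ] ∃[ as ] ∃[ bs ] (S i ≡ strip x y (z ∷ us) as bs × At s i y z us as bs ×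
    (∀ {j} → j ∈ as → edge j x z) × (∀ {j} → j ∈ bs → edge j x (mate z)))

  settle : ∀ i → (Strip.src (S i) ≡ x → Direct i × Escape s i × Escape (mirror s) i) → Valid edge (S i) × Only edge (S i)
  settle i f with Strip.src (S i) Fin.≟ x
  ... | no ne = Off.off-strip s i ne
  ... | yes e with f e
  ... | (y , z , us , as , bs , eq , a , D , D′) , E , E′ =
    subst (λ T → Valid edge T × Only edge T) (sym eq) (join-valid val h₁ h₂ , join-only h₁ h₂)
    where
    open At a using (T; val)
    h₁ = Beside.beside-half a D D′ E E′
    h₂ = Beside.beside-half (swapAt {s = s} a) D′ (λ j∈ → edge-≡ refl (sym (mate² z)) (D j∈)) E E′

  -- Validity alone does not involve escapes. It comes first when all strips are direct, because the
  -- escape there is an uncovered neighbour of `v`, found only by means of valid strips.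
  settle-valid : ∀ i → (Strip.src (S i) ≡ x → Direct i) → Valid edge (S i)
  settle-valid i f with Strip.src (S i) Fin.≟ x
  ... | no ne = proj₁ (Off.off-strip s i ne)
  ... | yes e with f e
  ... | y , z , us , as , bs , eq , a , D , D′ = subst (Valid edge) (sym eq) (record
      { src-free = src-free ; tgt-free = tgt-free ; src≢tgt = src≢tgt ; verts! = verts! ; 0<us = 0<us
      ; as# = as# ; bs# = bs# ; cols! = cols!
      ; A-edges = direct-edges a D ; B-edges = direct-edges (swapAt {s = s} a) D′ })
    where
    open Valid (At.val a) using (0<us; A-edges; B-edges; as#; bs#; cols!; src-free; src≢tgt; tgt-free; verts!)

module Extension {n m : ℕ} {𝒮 : System n m} {cs t x u v c d} {s : Setup 𝒮 cs t x u v c d}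
                 {i y z us as bs} (F : Full s i y z us as bs) where
  open Setup s using (Js; Js!; Js#; Js-pure; Js∩cols; Js⊑; S; cols-disjoint; colsOf; cols⊑; cover; c∈; c∉Js; c∉cols; d∈; d∉Js; d∉cols; h; only; palette; total; uv; u∉verts; valid; verts-disjoint; vertsOf; v∉verts)
  open Alternating 𝒮 using (Free; Reach; edge; edge-sym; here; mate; mate²)
  open Threads mate mate² using (Only; Valid; verts; verts-mate)
  open Reaching 𝒮 using (to-tgt; widen)
  open Work s using (lower; mate-outer; module 𝓡)
  open Modes s using (via-x; via-u; via-v; turn; Js-mate)
  open Settle s using (settle)
  open Full F using (a; cz; dz)
  open At a using (T; cols⊑T; val; verts⊑; width; y≢x; ⊑colsT; ⊑verts)
  open Entry a using (z∈; z-outer)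

  reach-strip : ∀ {w} → w ∈ vertsOf i → Reach y w (colsOf i) (vertsOf i)
  reach-strip k = widen (lower (𝓡.to-tgt val (⊑verts k)) y≢x) cols⊑T verts⊑

  -- A colour of another strip running through the triangle would, by `head-v`, put the entry of `c`
  -- or `d` at the head of that strip, but these entries lie on strip `i`.
  direct : ∀ {i′ y′ z′ us′ as′ bs′} → i′ ≢ i → At s i′ y′ z′ us′ as′ bs′ → ∀ {j} → j ∈ as′ → edge j x z′
  direct ne a′ j∈ with Entry.modeA a′ j∈
  ... | via-x e = edge-sym e
  ... | via-v e e′ with Entry.head-v a′ j∈ (edge-sym e′) z-outer cz
  ... | refl = ⊥-elim (ne (verts-disjoint (Entry.z∈ a′) z∈))
  direct ne a′ j∈ | via-u e e′
    with Entry.head-v {s = mirror s} (mirrorAt {s = s} a′) j∈ (edge-sym e′) (turn (mate-outer z-outer)) dz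
  ... | refl = ⊥-elim (ne (verts-disjoint (Entry.z∈ a′) (verts-mate z∈)))

  others : ∀ i′ → i′ ≢ i → Valid edge (S i′) × Only edge (S i′)
  others i′ ne = settle i′ λ e →
    (let y′ , z′ , us′ , as′ , bs′ , eq , a′ = at {s = s} i′ e in
      y′ , z′ , us′ , as′ , bs′ , eq , a′ , direct ne a′ , direct ne (swapAt {s = s} a′)) ,
    -- The escapes run through strip `i`: from `v` by `c` to `z`, or from `u` by `d` to `mate z`,
    -- and then inside that strip to `y`.
    record { qv = cz ; y-free = Valid.tgt-free val ; y≢x = y≢x ; reach = reach-strip z∈ ; es⊑ = cols⊑ i ; c∉ = c∉cols i
           ; u∉ = u∉verts i ; v∉ = v∉verts i ; es∩ = λ k l → ne (cols-disjoint {i′} {i} k l) ; zs∩ = λ k l → ne (verts-disjoint k l) } ,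
    record { qv = dz ; y-free = Valid.tgt-free val ; y≢x = y≢x ; reach = reach-strip (verts-mate z∈) ; es⊑ = cols⊑ i ; c∉ = d∉cols i
           ; u∉ = v∉verts i ; v∉ = u∉verts i ; es∩ = λ k l → ne (cols-disjoint {i′} {i} k l) ; zs∩ = λ k l → ne (verts-disjoint k l) }

  others-valid : ∀ i′ → i′ ≢ i → Valid edge (S i′)
  others-valid i′ ne = proj₁ (others i′ ne)

  T⁺ : Strip n m
  T⁺ = strip x y (u ∷ z ∷ us) (c ∷ as) (d ∷ bs)

  S⁺ : Fin h → Strip n m
  S⁺ i′ with i′ Fin.≟ i
  ... | yes _ = T⁺
  ... | no _  = S i′

  S⁺-new : S⁺ i ≡ T⁺
  S⁺-new with i Fin.≟ i
  ... | yes _ = refl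
  ... | no ne = ⊥-elim (ne refl)

  S⁺-old : ∀ {i′} → i′ ≢ i → S⁺ i′ ≡ S i′
  S⁺-old {i′} ne with i′ Fin.≟ i
  ... | yes e = ⊥-elim (ne e)
  ... | no _  = refl

  S⁺-elim : ∀ (P : Strip n m → Set) → P T⁺ → (∀ i′ → i′ ≢ i → P (S i′)) → ∀ i′ → P (S⁺ i′)
  S⁺-elim P p f i′ with i′ Fin.≟ i
  ... | yes _ = p
  ... | no ne = f i′ ne

  new-vert : ∀ {w} → w ∈ verts (Strip.us T⁺) → (w ≡ u ⊎ w ≡ v) ⊎ w ∈ vertsOf i
  new-vert (here e)          = inj₁ (inj₁ e)
  new-vert (there (here e))  = inj₁ (inj₂ (trans e uv))
  new-vert (there (there k)) = inj₂ (verts⊑ k)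

  new-col : ∀ {e} → e ∈ Strip.cols T⁺ → (e ≡ c ⊎ e ≡ d) ⊎ e ∈ colsOf i
  new-col (here e)  = inj₁ (inj₁ e)
  new-col (there k) with ∈.∈-++⁻ as k
  ... | inj₁ l         = inj₂ (cols⊑T (∈.∈-++⁺ˡ l))
  ... | inj₂ (here e)  = inj₁ (inj₂ e)
  ... | inj₂ (there l) = inj₂ (cols⊑T (∈.∈-++⁺ʳ as l))

  vert⁺ : ∀ i′ {w} → w ∈ verts (Strip.us (S⁺ i′)) → (i′ ≡ i × (w ≡ u ⊎ w ≡ v)) ⊎ w ∈ vertsOf i′
  vert⁺ i′ k with i′ Fin.≟ i
  ... | no _ = inj₂ k
  ... | yes refl with new-vert k
  ... | inj₁ e = inj₁ (refl , e)
  ... | inj₂ l = inj₂ l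

  col⁺ : ∀ i′ {e} → e ∈ Strip.cols (S⁺ i′) → (i′ ≡ i × (e ≡ c ⊎ e ≡ d)) ⊎ e ∈ colsOf i′
  col⁺ i′ k with i′ Fin.≟ i
  ... | no _ = inj₂ k
  ... | yes refl with new-col k
  ... | inj₁ e = inj₁ (refl , e)
  ... | inj₂ l = inj₂ l

  not-uv : ∀ {w} i′ → (w ≡ u ⊎ w ≡ v) → w ∉ vertsOf i′
  not-uv i′ (inj₁ refl) = u∉verts i′
  not-uv i′ (inj₂ refl) = v∉verts i′

  not-cd : ∀ {e} i′ → (e ≡ c ⊎ e ≡ d) → e ∉ colsOf i′
  not-cd i′ (inj₁ refl) = c∉cols i′
  not-cd i′ (inj₂ refl) = d∉cols i′

  verts-keep : ∀ i′ {w} → w ∈ vertsOf i′ → w ∈ verts (Strip.us (S⁺ i′))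
  verts-keep i′ k with i′ Fin.≟ i
  ... | no _     = k
  ... | yes refl = there (there (⊑verts k))

  vertsT⁺ : ∀ {w} → w ∈ verts (Strip.us T⁺) → ∃[ i′ ] w ∈ verts (Strip.us (S⁺ i′))
  vertsT⁺ k = i , subst (λ T → _ ∈ verts (Strip.us T)) (sym S⁺-new) k

  colsT⁺ : ∀ {e} → e ∈ Strip.cols T⁺ → ∃[ i′ ] e ∈ Strip.cols (S⁺ i′)
  colsT⁺ k = i , subst (λ T → _ ∈ Strip.cols T) (sym S⁺-new) k

  cols-keep : ∀ i′ {e} → e ∈ colsOf i′ → e ∈ Strip.cols (S⁺ i′)
  cols-keep i′ k with i′ Fin.≟ i
  ... | no _     = k
  ... | yes refl = there (↭.∈-resp-↭ (↭-sym (↭.shift d as bs)) (there (⊑colsT k)))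

  decomposition : Decomposition 𝒮 cs t
  decomposition = record
    { Js = Js ; Js! = Js! ; Js# = Js# ; Js⊑ = Js⊑ ; Js-pure = Js-mate ; h = h ; S = S⁺
    ; valid = S⁺-elim (Valid edge) (extended-valid F others-valid) others-valid
    ; only = S⁺-elim (Only edge) (extended-only F others-valid) (λ i′ ne → proj₂ (others i′ ne))
    ; verts-disjoint = verts-disjoint⁺ ; cols-disjoint = cols-disjoint⁺ ; cover = cover⁺
    ; cols⊑ = cols⊑⁺ ; Js∩cols = λ {i′} → Js∩cols⁺ i′ ; palette = palette⁺ ; total = total⁺ }
    where
    verts-disjoint⁺ : ∀ {i₁ i₂ w} → w ∈ verts (Strip.us (S⁺ i₁)) → w ∈ verts (Strip.us (S⁺ i₂)) → i₁ ≡ i₂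
    verts-disjoint⁺ {i₁} {i₂} k l with vert⁺ i₁ k | vert⁺ i₂ l
    ... | inj₁ (refl , _) | inj₁ (refl , _) = refl
    ... | inj₁ (_ , e) | inj₂ l′ = ⊥-elim (not-uv i₂ e l′)
    ... | inj₂ k′ | inj₁ (_ , e) = ⊥-elim (not-uv i₁ e k′)
    ... | inj₂ k′ | inj₂ l′      = verts-disjoint k′ l′
    cols-disjoint⁺ : ∀ {i₁ i₂ w} → w ∈ Strip.cols (S⁺ i₁) → w ∈ Strip.cols (S⁺ i₂) → i₁ ≡ i₂
    cols-disjoint⁺ {i₁} {i₂} k l with col⁺ i₁ k | col⁺ i₂ l
    ... | inj₁ (refl , _) | inj₁ (refl , _) = refl
    ... | inj₁ (_ , e) | inj₂ l′ = ⊥-elim (not-cd i₂ e l′)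
    ... | inj₂ k′ | inj₁ (_ , e) = ⊥-elim (not-cd i₁ e k′)
    ... | inj₂ k′ | inj₂ l′      = cols-disjoint {i₁} {i₂} k′ l′
    cover⁺ : ∀ {w} → ¬ Free w → ∃[ i′ ] w ∈ verts (Strip.us (S⁺ i′))
    cover⁺ {w} w-cov with w Fin.≟ u | w Fin.≟ v
    ... | yes refl | _ = vertsT⁺ (here refl)
    ... | no _ | yes refl = vertsT⁺ (there (here (sym uv)))
    ... | no p | no q = let i′ , k = cover w-cov p q in i′ , verts-keep i′ k
    cols⊑⁺ : ∀ i′ → Strip.cols (S⁺ i′) ⊑ cs
    cols⊑⁺ i′ k with col⁺ i′ k
    ... | inj₁ (_ , inj₁ refl) = c∈
    ... | inj₁ (_ , inj₂ refl) = d∈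
    ... | inj₂ l               = cols⊑ i′ l
    Js∩cols⁺ : ∀ i′ {e} → e ∈ Js → e ∉ Strip.cols (S⁺ i′)
    Js∩cols⁺ i′ j k with col⁺ i′ k
    ... | inj₁ (_ , inj₁ refl) = c∉Js j
    ... | inj₁ (_ , inj₂ refl) = d∉Js j
    ... | inj₂ l               = Js∩cols j l
    palette⁺ : ∀ {e} → e ∈ cs → e ∈ Js ⊎ ∃[ i′ ] e ∈ Strip.cols (S⁺ i′)
    palette⁺ e∈ with palette e∈
    ... | inj₁ (inj₁ refl)   = inj₂ (colsT⁺ (here refl))
    ... | inj₁ (inj₂ refl)   = inj₂ (colsT⁺ (there (∈.∈-++⁺ʳ as (here refl))))
    ... | inj₂ (inj₁ j)      = inj₁ j
    ... | inj₂ (inj₂ (i′ , k)) = inj₂ (i′ , cols-keep i′ k)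
    weight⁺ : weight S⁺ ≡ suc (weight S)
    weight⁺ = sum-update (allFin h) (Unique.allFin⁺ h) (∈.∈-allFin i)
      (trans (cong (λ T → length (Strip.us T)) S⁺-new) (cong suc (sym width)))
      (λ ne → cong (λ T → length (Strip.us T)) (S⁺-old ne))
    total⁺ : length cs ≡ t + (weight S⁺ + weight S⁺)
    total⁺ = trans total (trans (solve 2 (λ t w → con 2 :+ (t :+ (w :+ w)) := t :+ ((con 1 :+ w) :+ (con 1 :+ w))) refl t (weight S))
      (cong (λ w → t + (w + w)) (sym weight⁺)))

module _ {n m : ℕ} {𝒮 : System n m} {cs t x u v c d} (s : Setup 𝒮 cs t x u v c d) where
  SomeFull : Set
  SomeFull = ∃[ i ] ∃[ y ] ∃[ z ] ∃[ us ] ∃[ as ] ∃[ bs ] Full s i y z us as bs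

module _ {n m : ℕ} {𝒮 : System n m} {cs t x u v c d} (s : Setup 𝒮 cs t x u v c d) where
  open Setup s using (S)
  open Alternating 𝒮 using (edge; edge-sym; here)
  open Settle s using (Direct)
  open Modes s using (via-x; via-u; via-v)

  SomeExtension : Set
  SomeExtension = SomeFull s ⊎ SomeFull (mirror s)

  direct-or-full : ∀ {i y z us as bs} → At s i y z us as bs → (∀ {j} → j ∈ as → edge j x z) ⊎ SomeExtension
  direct-or-full {i} {y} {z} {us} {as} {bs} a = go as (λ j → j)
    where
    go : ∀ ks → ks ⊑ as → (∀ {j} → j ∈ ks → edge j x z) ⊎ SomeExtension
    go [] _ = inj₁ λ ()
    go (k ∷ ks) ⊑as with go ks (λ j → ⊑as (there j)) | Entry.modeA a (⊑as (here refl))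
    ... | inj₂ q | _ = inj₂ q
    ... | inj₁ f | via-x e = inj₁ λ { (here refl) → edge-sym e ; (there j) → f j }
    ... | inj₁ f | via-v e e′ = inj₂ (inj₁ (i , y , z , us , as , bs , full {s = s} a (⊑as (here refl)) e (edge-sym e′)))
    ... | inj₁ f | via-u e e′ = inj₂ (inj₂ (i , y , z , us , as , bs ,
      full {s = mirror s} (mirrorAt {s = s} a) (⊑as (here refl)) e (edge-sym e′)))

  all-direct : (∀ i → Strip.src (S i) ≡ x → Direct i) ⊎ SomeExtension
  all-direct = choose λ i → each i
    where
    choose : ∀ {k} {P : Fin k → Set} {Q : Set} → (∀ i → P i ⊎ Q) → (∀ i → P i) ⊎ Q
    choose {zero}  f = inj₁ λ ()
    choose {suc k} f with f zero | choose (λ i → f (suc i))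
    ... | inj₂ q | _      = inj₂ q
    ... | inj₁ _ | inj₂ q = inj₂ q
    ... | inj₁ p | inj₁ g = inj₁ λ { zero → p ; (suc i) → g i }
    each : ∀ i → (Strip.src (S i) ≡ x → Direct i) ⊎ SomeExtension
    each i with Strip.src (S i) Fin.≟ x
    ... | no ne = inj₁ λ e → ⊥-elim (ne e)
    ... | yes e with at {s = s} i e
    ... | y , z , us , as , bs , eq , a with direct-or-full a | direct-or-full (swapAt {s = s} a)
    ... | inj₂ q | _      = inj₂ q
    ... | inj₁ _ | inj₂ q = inj₂ q
    ... | inj₁ D | inj₁ D′ = inj₁ λ _ → y , z , us , as , bs , eq , a , D , D′

-- A new strip of width one

module Fresh {n m : ℕ} {𝒮 : System n m} {cs t x u v c d} (s : Setup 𝒮 cs t x u v c d)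
             (valid′ : ∀ i → Threads.Valid (System.mate 𝒮) (System.mate² 𝒮) (System.edge 𝒮) (Setup.S s i)) where
  open Setup s using (cols⊑; c∈; c∉cols; c≢d; d∈; d∉cols; none; only; u-cov; uv; u∉verts; vu; v∉verts; x-free; xu)
  open Alternating 𝒮 using (Free; Reach; edge; edge-sym; edge-≡; here; mate; mate-injective; mate²)
  open Threads mate mate² using (Thread; Touch)
  open Reaching 𝒮 using (close; extend; stay)
  open Work s using (Hit; Outer; away; hit-u; hit-x; hitC; locate; mate-outer; toU)
  open Cross s using (Place; Rooted; cross; free; root-of; strip)
  open Real 𝒮 using (Half)
  open Modes s using (classify; is-x; is-u; is-v; outer; Class)

  place : ∀ {p} → Outer p → Place p
  place (_ , p≢u , p≢v) with locate p≢u p≢v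
  ... | inj₁ f       = free f
  ... | inj₂ (i , k) = strip i k (valid′ i)

  no-inner : ∀ {p q} → Outer p → Outer q → edge c p q → p ≢ q → q ≢ mate p → ⊥
  no-inner o o′ e ne nm = cross o ne nm e (place o) (place o′)

  -- A covered `q` would come with an earlier edge of colour `c` between outer vertices, which
  -- `cross` forbids once all strips are valid.
  q-free : Free (Hit.q hitC)
  q-free with Hit.prev hitC
  ... | inj₁ f = f
  ... | inj₂ (r , o , r≢q , r≢q̄ , e) =
    ⊥-elim (no-inner o (mate-outer (Hit.outer hitC)) e r≢q̄ (λ k → r≢q (sym (mate-injective k))))

  module Tip {y : Fin n} (y-free : Free y) (y≢x : y ≢ x) (yv : edge c y v) (yu : edge d y u) where

    free-escape : ∀ i → Escape s i
    free-escape i = record { qv = yv ; y-free = y-free ; y≢x = y≢x ; reach = stay ; es⊑ = ∈-[] ; c∉ = ∈-[] ; u∉ = ∈-[]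
      ; v∉ = ∈-[] ; es∩ = λ _ → ∈-[] ; zs∩ = λ _ → ∈-[] }

    T₀ : Strip n m
    T₀ = strip x y (u ∷ []) (c ∷ []) (d ∷ [])

    half₀ : Half T₀
    half₀ = record { edges = edges′ ; only = λ { (here refl) → only′ } }
      where
      edges′ : ∀ {j a b} → j ∈ c ∷ [] → Thread x (u ∷ []) y a b → edge j a b
      edges′ (here refl) (inj₁ (refl , refl)) = xu
      edges′ (here refl) (inj₂ (refl , refl)) = edge-≡ (sym uv) refl (edge-sym yv)
      no-xv : ¬ edge c x v
      -- The forbidden path is x -c- v u -d- y.
      no-xv e = none (close x-free y-free (λ k → y≢x (sym k)) (toU e) stay (edge-sym yu) d∈ ((λ k → c≢d (sym k)) ∷∉ ∈-[]) ∈-[]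
        (c∈ ∷⊑ ∈-[]) ∈-[] (λ _ → ∈-[]) (λ _ → ∈-[]))
      at-v : ∀ {p} → Outer p → edge c v p → p ≡ y
      at-v {p} o e with p Fin.≟ y
      ... | yes k = k
      -- The path y -d- u v -c- p would continue to an uncovered vertex other than `y`.
      ... | no ne = ⊥-elim (none (close y-free P.r-free (λ k → P.r≢e (sym k))
          (subst (λ w → Reach y w (d ∷ []) (u ∷ w ∷ [])) uv (extend stay yu ∈-[] u-cov ∈-[] ∈-[])) P.reach e c∈
          ((λ k → c≢d k) ∷∉ ∈-[]) (λ k → let i , _ , l = P.es⊑ k in c∉cols i l) (d∈ ∷⊑ ∈-[])
          (λ k → let i , _ , l = P.es⊑ k in cols⊑ i l) ((λ k → let i , _ , l = P.es⊑ k in d∉cols i l) ∷# ∈-[])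
          ((λ k → let i , _ , l = P.zs⊑ k in u∉verts i l) ∷# (λ k → let i , _ , l = P.zs⊑ k in v∉verts i l) ∷# ∈-[])))
        where
        module P = Rooted (root-of (place o) y (λ _ → ne))
      only′ : ∀ {a b} → edge c a b → a ≢ b → b ≢ mate a → Touch x (u ∷ []) y a b
      only′ {a} {b} e ne nm = go (classify a) (classify b)
        where
        corner : ∀ {w p} → Class w → Outer p → edge c w p → w ≢ p → p ≢ mate w → Thread x (u ∷ []) y w p
        corner (outer o) o′ e ne nm  = ⊥-elim (no-inner o o′ e ne nm)
        corner (is-x refl) o e _ _ = ⊥-elim (hit-x (away o) (edge-sym e) c∈)
        corner (is-u refl) o e _ _ = ⊥-elim (hit-u (away o) (edge-sym e) c∈ c≢d)
        corner (is-v refl) o e _ _ = inj₂ (sym uv , at-v o e)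
        go : Class a → Class b → Touch x (u ∷ []) y a b
        go ca (outer o) = inj₁ (corner ca o e ne nm)
        go (outer o) cb = inj₂ (corner cb o (edge-sym e) (λ k → ne (sym k)) (λ k → nm (trans (sym (mate² b)) (cong mate (sym k)))))
        go (is-x refl) (is-x refl) = ⊥-elim (ne refl)
        go (is-x refl) (is-u refl) = inj₁ (inj₁ (refl , refl))
        go (is-x refl) (is-v refl) = ⊥-elim (no-xv e)
        go (is-u refl) (is-x refl) = inj₂ (inj₁ (refl , refl))
        go (is-u refl) (is-u refl) = ⊥-elim (ne refl)
        go (is-u refl) (is-v refl) = ⊥-elim (nm (sym uv))
        go (is-v refl) (is-x refl) = ⊥-elim (no-xv (edge-sym e))
        go (is-v refl) (is-u refl) = ⊥-elim (nm (sym vu))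
        go (is-v refl) (is-v refl) = ⊥-elim (ne refl)

module FreshStrip {n m : ℕ} {𝒮 : System n m} {cs t x u v c d} (s : Setup 𝒮 cs t x u v c d)
                  (direct : ∀ i → Strip.src (Setup.S s i) ≡ x → Settle.Direct s i) where
  open Setup s using (Js; Js!; Js#; Js-pure; Js∩cols; Js⊑; S; cols-disjoint; colsOf; cols⊑; cover; c∈; c∉Js; c∉cols; c≢d; d∈; d∉Js; d∉cols; h; none; only; palette; total; u-cov; uv; u∉verts; v-cov; valid; verts-disjoint; vertsOf; vu; v∉verts; x-free)
  open Alternating 𝒮 using (Free; Reach; edge; edge-sym; edge-≡; here; mate; mate²)
  open Threads mate mate² using (Only; Valid; swapStrip; verts)
  open Reaching 𝒮 using (close; extend; stay)
  open Work s using (Hit; hitC)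
  open Real 𝒮 using (Half; join-only)
  open Settle s using (settle; settle-valid)
  open Modes s using (module M; Js-mate)

  valid′ : ∀ i → Valid edge (S i)
  valid′ i = settle-valid i (direct i)

  y y′ : Fin n
  y  = Hit.q hitC
  y′ = M.Hit.q M.hitC

  y-free : Free y
  y-free = Fresh.q-free s valid′

  -- Two different vertices would be the ends of the rainbow path y -c- v u -d- y′.
  y≡y′ : y ≡ y′
  y≡y′ with y Fin.≟ y′
  ... | yes e = e
  ... | no ne = ⊥-elim (none (close y-free (Fresh.q-free (mirror s) valid′) ne
      (subst (λ w → Reach y w (c ∷ []) (v ∷ w ∷ [])) vu (extend stay (Hit.qv hitC) ∈-[] v-cov ∈-[] ∈-[]))
      stay (edge-sym (M.Hit.qv M.hitC)) d∈ ((λ k → c≢d (sym k)) ∷∉ ∈-[]) ∈-[] (c∈ ∷⊑ ∈-[]) ∈-[] (λ _ → ∈-[]) (λ _ → ∈-[])))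

  y≢x : y ≢ x
  y≢x = proj₁ (Hit.outer hitC)

  yu : edge d y u
  yu = edge-≡ (sym y≡y′) refl (M.Hit.qv M.hitC)

  module P = Fresh.Tip s valid′ y-free y≢x (Hit.qv hitC) yu using (T₀; free-escape; half₀)
  module Q = Fresh.Tip (mirror s) valid′ y-free y≢x yu (Hit.qv hitC) using (free-escape; half₀)
  open P using (T₀)

  settled : ∀ i → Valid edge (S i) × Only edge (S i)
  settled i = settle i λ e → direct i e , P.free-escape i , Q.free-escape i

  half₀-swap : Half (swapStrip T₀)
  half₀-swap = subst (λ w → Half (strip x y (w ∷ []) (d ∷ []) (c ∷ []))) (sym uv) Q.half₀

  fresh-valid : Valid edge T₀
  fresh-valid = record
    { src-free = x-free ; tgt-free = y-free ; src≢tgt = λ k → y≢x (sym k)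
    ; verts! = pair-unique (λ e → u-cov (sym e)) ; 0<us = s≤s z≤n ; as# = refl ; bs# = refl ; cols! = pair-unique c≢d
    ; A-edges = Half.edges P.half₀ ; B-edges = Half.edges half₀-swap }

  S⁺ : Fin (suc h) → Strip n m
  S⁺ zero    = T₀
  S⁺ (suc i) = S i

  decomposition : Decomposition 𝒮 cs t
  decomposition = record
    { Js = Js ; Js! = Js! ; Js# = Js# ; Js⊑ = Js⊑ ; Js-pure = Js-mate ; h = suc h ; S = S⁺
    ; valid = λ { zero → fresh-valid ; (suc i) → proj₁ (settled i) }
    ; only = λ { zero → join-only P.half₀ half₀-swap ; (suc i) → proj₂ (settled i) }
    ; verts-disjoint = λ {i} {i′} → verts-disjoint⁺ i i′ ; cols-disjoint = λ {i} {i′} → cols-disjoint⁺ i i′ ; cover = cover⁺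
    ; cols⊑ = λ { zero (here refl) → c∈ ; zero (there (here refl)) → d∈ ; (suc i) k → cols⊑ i k }
    ; Js∩cols = λ { {zero} j (here refl) → c∉Js j ; {zero} j (there (here refl)) → d∉Js j ; {suc i} j k → Js∩cols j k }
    ; palette = palette⁺ ; total = total⁺ }
    where
    verts⁻ : ∀ {w} → w ∈ verts (u ∷ []) → ∀ i → w ∉ vertsOf i
    verts⁻ (here refl) i = u∉verts i
    verts⁻ (there (here refl)) i k = v∉verts i (subst (_∈ vertsOf i) uv k)
    cols⁻ : ∀ {w} → w ∈ c ∷ d ∷ [] → ∀ i → w ∉ colsOf i
    cols⁻ (here refl) i = c∉cols i
    cols⁻ (there (here refl)) i = d∉cols i
    verts-disjoint⁺ : ∀ i₁ i₂ {w} → w ∈ verts (Strip.us (S⁺ i₁)) → w ∈ verts (Strip.us (S⁺ i₂)) → i₁ ≡ i₂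
    verts-disjoint⁺ zero     zero     _ _ = refl
    verts-disjoint⁺ zero     (suc i₂) k l = ⊥-elim (verts⁻ k i₂ l)
    verts-disjoint⁺ (suc i₁) zero     k l = ⊥-elim (verts⁻ l i₁ k)
    verts-disjoint⁺ (suc i₁) (suc i₂) k l = cong suc (verts-disjoint k l)
    cols-disjoint⁺ : ∀ i₁ i₂ {w} → w ∈ Strip.cols (S⁺ i₁) → w ∈ Strip.cols (S⁺ i₂) → i₁ ≡ i₂
    cols-disjoint⁺ zero     zero     _ _ = refl
    cols-disjoint⁺ zero     (suc i₂) k l = ⊥-elim (cols⁻ k i₂ l)
    cols-disjoint⁺ (suc i₁) zero     k l = ⊥-elim (cols⁻ l i₁ k)
    cols-disjoint⁺ (suc i₁) (suc i₂) k l = cong suc (cols-disjoint {i₁} {i₂} k l)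
    cover⁺ : ∀ {w} → ¬ Free w → ∃[ i ] w ∈ verts (Strip.us (S⁺ i))
    cover⁺ {w} w-cov with w Fin.≟ u | w Fin.≟ v
    ... | yes refl | _       = zero , here refl
    ... | no _ | yes refl    = zero , there (here (sym uv))
    ... | no p | no q        = let i , k = cover w-cov p q in suc i , k
    palette⁺ : ∀ {e} → e ∈ cs → e ∈ Js ⊎ ∃[ i ] e ∈ Strip.cols (S⁺ i)
    palette⁺ e∈ with palette e∈
    ... | inj₁ (inj₁ refl)     = inj₂ (zero , here refl)
    ... | inj₁ (inj₂ refl)     = inj₂ (zero , there (here refl))
    ... | inj₂ (inj₁ j)        = inj₁ j
    ... | inj₂ (inj₂ (i , k))  = inj₂ (suc i , k)
    width : Fin (suc h) → ℕ
    width i = length (Strip.us (S⁺ i))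
    weight⁺ : weight S⁺ ≡ suc (weight S)
    weight⁺ = cong (λ l → suc (sum l)) (trans (List.map-tabulate suc width) (sym (List.map-tabulate (λ i → i) (λ i → length (Strip.us (S i))))))
    total⁺ : length cs ≡ t + (weight S⁺ + weight S⁺)
    total⁺ = trans total (trans (solve 2 (λ t w → con 2 :+ (t :+ (w :+ w)) := t :+ ((con 1 :+ w) :+ (con 1 :+ w))) refl t (weight S))
      (cong (λ w → t + (w + w)) (sym weight⁺)))

decompose : ∀ {n m : ℕ} {𝒮 : System n m} {cs t x u v c d} → Setup 𝒮 cs t x u v c d → Decomposition 𝒮 cs t
decompose s with all-direct s
... | inj₁ D = FreshStrip.decomposition s D
... | inj₂ (inj₁ (_ , _ , _ , _ , _ , _ , F)) = Extension.decomposition F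
... | inj₂ (inj₂ (_ , _ , _ , _ , _ , _ , F)) = Extension.decomposition F

-- Transfer from the matching of the contraction to the original one

module Agree {n : ℕ} (f : Fin n → Fin n) (f² : ∀ v → f (f v) ≡ v) (g : Fin n → Fin n) (g² : ∀ v → g (g v) ≡ v) where
  module 𝒇 = Threads f f² using (Only; Thread; Touch; verts; verts-map; verts-∈)
  module 𝒈 = Threads g g² using (Only; Thread; Touch; Valid; verts)

  verts-agree : ∀ us → (∀ {z} → z ∈ us → f z ≡ g z) → 𝒇.verts us ≡ 𝒈.verts us
  verts-agree []       _ = refl
  verts-agree (u ∷ us) h = cong₂ (λ v l → u ∷ v ∷ l) (h (here refl)) (verts-agree us (λ k → h (there k)))

  map-agree : ∀ us → (∀ {z} → z ∈ us → f z ≡ g z) → map f us ≡ map g us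
  map-agree []       _ = refl
  map-agree (u ∷ us) h = cong₂ _∷_ (h (here refl)) (map-agree us (λ k → h (there k)))

  thread-agree : ∀ {p} us {y a b} → (∀ {z} → z ∈ us → f z ≡ g z) → 𝒇.Thread p us y a b → 𝒈.Thread p us y a b
  thread-agree []       h t = t
  thread-agree (u ∷ us) h (inj₁ e) = inj₁ e
  thread-agree (u ∷ us) {y} {a} {b} h (inj₂ t) =
    inj₂ (thread-agree us (λ k → h (there k)) (subst (λ w → 𝒇.Thread w us y a b) (h (here refl)) t))

module AgreeStrip {n m : ℕ} {f : Fin n → Fin n} {f² : ∀ v → f (f v) ≡ v} {g : Fin n → Fin n} {g² : ∀ v → g (g v) ≡ v}
                  {E E′ : Fin m → Fin n → Fin n → Set} {S : Strip n m}
                  (v : Threads.Valid f f² E S) (agree : ∀ {z} → z ∈ verts-of f (Strip.us S) → f z ≡ g z) where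
  private
    module 𝒇 = Threads f f² using (Only; Thread; Touch; verts; verts-map; verts-∈)
    module 𝒈 = Threads g g² using (Only; Thread; Touch; Valid; verts)
    module 𝒇𝒈 = Agree f f² g g² using (map-agree; thread-agree; verts-agree)
    module 𝒈𝒇 = Agree g g² f f² using (thread-agree)
  open Strip S using (src; tgt; us)
  open Threads.Valid v using (0<us; A-edges; B-edges; as#; bs#; cols!; src-free; src≢tgt; tgt-free; verts!)

  on-us : ∀ {z} → z ∈ us → f z ≡ g z
  on-us k = agree (𝒇.verts-∈ k)

  on-map : ∀ {z} → z ∈ map f us → f z ≡ g z
  on-map k = agree (↭.∈-resp-↭ (𝒇.verts-map us) (𝒇.verts-∈ k))

  verts≡ : 𝒇.verts us ≡ 𝒈.verts us
  verts≡ = 𝒇𝒈.verts-agree us on-us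

  map≡ : map f us ≡ map g us
  map≡ = 𝒇𝒈.map-agree us on-us

  valid-agree : (∀ {c a b} → E c a b → E′ c a b) → g src ≡ src → g tgt ≡ tgt → 𝒈.Valid E′ S
  valid-agree h sf tf = record
    { src-free = sf ; tgt-free = tf ; src≢tgt = src≢tgt ; verts! = subst Unique verts≡ verts! ; 0<us = 0<us
    ; as# = as# ; bs# = bs# ; cols! = cols!
    ; A-edges = λ j∈ th → h (A-edges j∈ (𝒈𝒇.thread-agree us (λ k → sym (on-us k)) th))
    ; B-edges = λ {_} {a} {b} j∈ th → h (B-edges j∈ (𝒈𝒇.thread-agree (map f us) (λ k → sym (on-map k))
        (subst (λ l → 𝒈.Thread src l tgt a b) (sym map≡) th))) }

  only-agree : (∀ {c a b} → E′ c a b → E c a b × f a ≡ g a) → 𝒇.Only E S → 𝒈.Only E′ S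
  only-agree h o = record
    { A-only = λ {_} {a} {b} j∈ e ne nm → touch us on-us (𝒇.Only.A-only o j∈ (proj₁ (h e)) ne (λ k → nm (trans k (proj₂ (h e)))))
    ; B-only = λ {_} {a} {b} j∈ e ne nm → subst (λ l → 𝒈.Touch src l tgt a b) map≡
        (touch (map f us) on-map (𝒇.Only.B-only o j∈ (proj₁ (h e)) ne (λ k → nm (trans k (proj₂ (h e)))))) }
    where
    touch : ∀ us {a b} → (∀ {z} → z ∈ us → f z ≡ g z) → 𝒇.Touch src us tgt a b → 𝒈.Touch src us tgt a b
    touch us k (inj₁ t) = inj₁ (𝒇𝒈.thread-agree us k t)
    touch us k (inj₂ t) = inj₂ (𝒇𝒈.thread-agree us k t)

module FromTriangle {n m : ℕ} {𝒮 : System n m} {cs : List (Fin m)} {t : ℕ} (T : Triangle 𝒮 cs)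
                    (cs! : Unique cs) (rich : Alternating.Rich 𝒮 t cs) (none : ¬ Alternating.Rainbow 𝒮 cs) where
  open Alternating 𝒮 using (Blossom; Free; Rainbow; Rich; Rich-⊑; edge; edge-sym; here; mate; mate-injective; mate²; order)
  open Threads mate mate² using (Only; Thread; Valid; cols-comm; flip-only; flip-valid; flipStrip; verts; verts-covered; verts-↭)
  open Triangle T using (c; c∈; c≢d; d; d∈; r; r-free; ru; ru′; u; u-cov)

  blossom₃ : Blossom r (d ∷ c ∷ []) (u ∷ mate u ∷ [])
  blossom₃ = triangle-blossom T

  open Blossom blossom₃ using (closed; covered; reach)
  open Contraction 𝒮 r (u ∷ mate u ∷ []) r-free closed covered using (LiesAt; _∈?_; contracted; free/⁻; lift; mate/-in; mate/-out; order-drop; project-rich; r∉zs; module /)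
  module /T = Threads /.mate /.mate² using (Only; Thread; Valid; verts; verts-covered)

  dc⊑ : (d ∷ c ∷ []) ⊑ cs
  dc⊑ (here refl)         = d∈
  dc⊑ (there (here refl)) = c∈

  split : ∃[ ds ] (cs ↭ d ∷ c ∷ ds)
  split = split-off (d ∷ c ∷ []) (pair-unique (λ e → c≢d (sym e))) dc⊑

  ds : List (Fin m)
  ds = proj₁ split

  σ : cs ↭ d ∷ c ∷ ds
  σ = proj₂ split

  dcds! : Unique (d ∷ c ∷ ds)
  dcds! = Unique-↭ σ cs!

  ds! : Unique ds
  ds! = proj₁ (proj₂ (Unique-++⁻ (d ∷ c ∷ []) dcds!))

  ds⊑ : ds ⊑ cs
  ds⊑ k = ↭.∈-resp-↭ (↭-sym σ) (there (there k))

  c∉ds : c ∉ ds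
  c∉ds = proj₂ (proj₂ (Unique-++⁻ (d ∷ c ∷ []) dcds!)) (there (here refl))

  d∉ds : d ∉ ds
  d∉ds = proj₂ (proj₂ (Unique-++⁻ (d ∷ c ∷ []) dcds!)) (here refl)

  none/ : ¬ /.Rainbow ds
  none/ R = none (lift reach R ds⊑ dc⊑ λ k → (λ e → d∉ds (subst (_∈ ds) e k)) ∷∉ (λ e → c∉ds (subst (_∈ ds) e k)) ∷∉ ∈-[])

  rich/ : /.Rich t ds
  rich/ = project-rich (Rich-⊑ ds⊑ rich)

  order-2 : /.order + 2 ≤ order
  order-2 = order-drop (Blossom.zs! blossom₃)

  length-2 : length cs ≡ 2 + length ds
  length-2 = ↭.↭-length σ

  -- Two colours and at least two covered vertices disappear, so equality could only turn into a
  -- surplus of colours, and a surplus gives a rainbow path by `greedy`.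
  tight : length cs ≡ order + t → length ds ≡ /.order + t
  tight eq with (/.order + t) ℕ.<? length ds
  ... | yes l = ⊥-elim (none/ (greedy contracted ds! rich/ l))
  ... | no ¬l = ℕ.≤-antisym (ℕ.≮⇒≥ ¬l) (ℕ.+-cancelˡ-≤ 2 _ _ (begin
      2 + (/.order + t)   ≡⟨ solve 2 (λ o t → con 2 :+ (o :+ t) := (o :+ con 2) :+ t) refl /.order t ⟩
      (/.order + 2) + t   ≤⟨ ℕ.+-monoˡ-≤ t order-2 ⟩
      order + t           ≡⟨ trans (sym eq) length-2 ⟩
      2 + length ds       ∎))
    where open ℕ.≤-Reasoning

  π : Fin n → Fin n
  π a with a ∈? (u ∷ mate u ∷ [])
  ... | yes _ = r
  ... | no _  = a

  π-lies : ∀ a → LiesAt a (π a)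
  π-lies a with a ∈? (u ∷ mate u ∷ [])
  ... | yes k = inj₁ (k , refl)
  ... | no k  = inj₂ (k , refl)

  lies-π : ∀ {a p} → LiesAt a p → π a ≡ p
  lies-π {a} l with a ∈? (u ∷ mate u ∷ []) | l
  ... | yes _ | inj₁ (_ , e)  = sym e
  ... | yes k | inj₂ (k′ , _) = ⊥-elim (k′ k)
  ... | no k  | inj₁ (k′ , _) = ⊥-elim (k k′)
  ... | no _  | inj₂ (_ , e)  = sym e

  π-∉ : ∀ a → π a ∉ u ∷ mate u ∷ []
  π-∉ a with π-lies a
  ... | inj₁ (_ , e) = subst (_∉ u ∷ mate u ∷ []) (sym e) r∉zs
  ... | inj₂ (k , e) = subst (_∉ u ∷ mate u ∷ []) (sym e) k

  L : Fin m → Fin n → Fin n → Set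
  L e a b = ∃[ a′ ] ∃[ b′ ] (π a′ ≡ a × π b′ ≡ b × edge e a′ b′)

  L-sym : ∀ {e a b} → L e a b → L e b a
  L-sym (a , b , p , q , e) = b , a , q , p , edge-sym e

  /⇒L : ∀ {e a b} → /.edge e a b → L e a b
  /⇒L (a , b , la , lb , e) = a , b , lies-π la , lies-π lb , e

  L⇒/ : ∀ {e a b} → L e a b → /.edge e a b × /.mate a ≡ mate a
  L⇒/ (a , b , refl , refl , e) = (a , b , π-lies a , π-lies b , e) , mate/-out (π-∉ a)

  record Oriented (S : Strip n m) : Set where
    field
      S′     : Strip n m
      valid  : Valid L S′
      only   : Only L S′
      tgt≢r  : Strip.tgt S′ ≢ r
      verts↭ : verts (Strip.us S′) ↭ /T.verts (Strip.us S)
      cols↭  : Strip.cols S′ ↭ Strip.cols S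
      width  : length (Strip.us S′) ≡ length (Strip.us S)

  -- The two ends of a strip differ, so flipping makes `r` at most the first one.
  orient : ∀ {S} → /T.Valid /.edge S → /T.Only /.edge S → Oriented S
  orient {S} v o = go (Strip.tgt S Fin.≟ r)
    where
    agree : ∀ {z} → z ∈ /T.verts (Strip.us S) → /.mate z ≡ mate z
    agree k = mate/-out λ l → /T.verts-covered (/T.Valid.verts! v) k (mate/-in l)
    free-of : ∀ {w} → /.mate w ≡ w → (w ∈ u ∷ mate u ∷ [] → ⊥) → mate w ≡ w
    free-of f w∉ = free/⁻ w∉ f
    open Strip S using (as; cols; src; tgt; us)
    out : ∀ {a b j} → /.edge j a b → a ∉ u ∷ mate u ∷ [] × b ∉ u ∷ mate u ∷ []
    out (a , b , la , lb , _) = subst (_∉ _) (lies-π la) (π-∉ a) , subst (_∉ _) (lies-π lb) (π-∉ b)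
    module G = AgreeStrip {f = /.mate} {/.mate²} {mate} {mate²} {/.edge} {L} {S} v agree using (only-agree; valid-agree; verts≡)
    some-a : ∃[ j ] j ∈ as
    some-a = inhabited (subst (0 <_) (sym (/T.Valid.as# v)) (/T.Valid.0<us v))
    -- In the contraction `u` and `mate u` are uncovered as well, so freeness does not exclude them
    -- as ends; they are excluded because no edge of the contraction contains them.
    src∉ : src ∉ u ∷ mate u ∷ []
    src∉ = proj₁ (out (/T.Valid.A-edges v (proj₂ some-a) (proj₂ (start us))))
      where
      start : ∀ us → ∃[ b ] /T.Thread src us tgt src b
      start []      = tgt , refl , refl
      start (w ∷ _) = w , inj₁ (refl , refl)
    tgt∉ : tgt ∉ u ∷ mate u ∷ []
    tgt∉ = proj₂ (out (/T.Valid.A-edges v (proj₂ some-a) (proj₂ (finish us))))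
      where
      finish : ∀ {p} us → ∃[ a ] /T.Thread p us tgt a tgt
      finish []       = _ , refl , refl
      finish (w ∷ us) = let a , t = finish us in a , inj₂ t
    v′ : Valid L S
    v′ = G.valid-agree /⇒L (free-of (/T.Valid.src-free v) src∉) (free-of (/T.Valid.tgt-free v) tgt∉)
    o′ : Only L S
    o′ = G.only-agree L⇒/ o
    go : Dec (tgt ≡ r) → Oriented S
    go (no ne) = record { S′ = S ; valid = v′ ; only = o′ ; tgt≢r = ne
      ; verts↭ = subst (verts us ↭_) (sym G.verts≡) ↭-refl ; cols↭ = ↭-refl ; width = refl }
    go (yes e) = record { S′ = flipStrip S ; valid = flip-valid L-sym v′ ; only = flip-only L-sym o′
      ; tgt≢r = λ k → Valid.src≢tgt v′ (trans k (sym e))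
      ; verts↭ = subst (verts (reverse us) ↭_) (sym G.verts≡) (verts-↭ (↭.↭-reverse us))
      ; cols↭ = ↭-sym (cols-comm S) ; width = List.length-reverse us }

  module _ (D : Decomposition contracted ds t) where
    private module D = Decomposition D

    oriented : ∀ i → Oriented (D.S i)
    oriented i = orient (D.valid i) (D.only i)

    S : Fin D.h → Strip n m
    S i = Oriented.S′ (oriented i)

    verts⁻ : ∀ {w} i → w ∈ verts (Strip.us (S i)) → w ∈ D.vertsOf i
    verts⁻ i k = ↭.∈-resp-↭ (Oriented.verts↭ (oriented i)) k

    cols⁻ : ∀ {w} i → w ∈ Strip.cols (S i) → w ∈ D.colsOf i
    cols⁻ i k = ↭.∈-resp-↭ (Oriented.cols↭ (oriented i)) k

    zs∉ : ∀ {w} i → w ∈ u ∷ mate u ∷ [] → w ∉ verts (Strip.us (S i))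
    zs∉ i l k = /T.verts-covered (/T.Valid.verts! (D.valid i)) (verts⁻ i k) (mate/-in l)

    weight≡ : weight S ≡ weight D.S
    weight≡ = cong sum (List.map-cong (λ i → Oriented.width (oriented i)) (allFin D.h))

    setup : Setup 𝒮 cs t r u (mate u) c d
    setup = record
      { rich = rich ; none = none ; x-free = r-free ; uv = refl ; vu = mate² u ; u-cov = u-cov
      ; v-cov = λ f → u-cov (mate-injective f) ; c≢d = c≢d ; c∈ = c∈ ; d∈ = d∈ ; xu = ru ; xv = ru′
      ; π = π ; π-u = lies-π (inj₁ (here refl , refl)) ; π-v = lies-π (inj₁ (there (here refl) , refl))
      ; π-out = λ p q → lies-π (inj₂ (((λ e → p e) ∷∉ (λ e → q e) ∷∉ ∈-[]) , refl))
      ; Js = D.Js ; Js! = D.Js! ; Js# = D.Js# ; Js⊑ = λ k → ds⊑ (D.Js⊑ k)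
      ; c∉Js = λ k → c∉ds (D.Js⊑ k) ; d∉Js = λ k → d∉ds (D.Js⊑ k)
      ; Js-pure = λ {j} {a} {b} j∈ e ne → trans (D.Js-pure j∈ (a , b , π-lies a , π-lies b , e) ne) (mate/-out (π-∉ a))
      ; h = D.h ; S = S ; valid = λ i → Oriented.valid (oriented i) ; only = λ i → Oriented.only (oriented i)
      ; tgt≢x = λ i → Oriented.tgt≢r (oriented i)
      ; u∉verts = λ i → zs∉ i (here refl) ; v∉verts = λ i → zs∉ i (there (here refl))
      ; verts-disjoint = λ {i} {i′} k l → D.verts-disjoint (verts⁻ i k) (verts⁻ i′ l)
      ; cols-disjoint = λ {i} {i′} k l → D.cols-disjoint (cols⁻ i k) (cols⁻ i′ l)
      ; cover = cover ; cols⊑ = λ i k → ds⊑ (D.cols⊑ i (cols⁻ i k))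
      ; c∉cols = λ i k → c∉ds (D.cols⊑ i (cols⁻ i k)) ; d∉cols = λ i k → d∉ds (D.cols⊑ i (cols⁻ i k))
      ; Js∩cols = λ {i} j k → D.Js∩cols {i} j (cols⁻ i k)
      ; palette = palette
      ; total = trans length-2 (cong (2 +_) (trans D.total (cong (λ w → t + (w + w)) (sym weight≡)))) }
      where
      cover : ∀ {z} → ¬ Free z → z ≢ u → z ≢ mate u → ∃[ i ] z ∈ verts (Strip.us (S i))
      cover {z} z-cov p q with D.cover {z} (λ f → z-cov (trans (sym (mate/-out ((λ e → p e) ∷∉ (λ e → q e) ∷∉ ∈-[]))) f))
      ... | i , k = i , ↭.∈-resp-↭ (↭-sym (Oriented.verts↭ (oriented i))) k
      palette : ∀ {e} → e ∈ cs → (e ≡ c ⊎ e ≡ d) ⊎ e ∈ D.Js ⊎ ∃[ i ] e ∈ Strip.cols (S i)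
      palette e∈ with ↭.∈-resp-↭ σ e∈
      ... | here e         = inj₁ (inj₂ e)
      ... | there (here e) = inj₁ (inj₁ e)
      ... | there (there k) with D.palette k
      ... | inj₁ j       = inj₂ (inj₁ j)
      ... | inj₂ (i , l) = inj₂ (inj₂ (i , ↭.∈-resp-↭ (↭-sym (Oriented.cols↭ (oriented i))) l))

-- The extremal structure, by induction

module _ {n m : ℕ} where

  -- Without covered vertices any edge that is not a loop is already an augmenting path, so all
  -- colours are pure and there are no strips.
  unmatched : ∀ (𝒮 : System n m) {cs t} → Unique cs → ¬ Alternating.Rainbow 𝒮 cs → length cs ≡ Alternating.order 𝒮 + t →
              Alternating.order 𝒮 ≡ 0 → Decomposition 𝒮 cs t
  unmatched 𝒮 {cs} cs! none eq o≡0 = record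
    { Js = cs ; Js! = cs! ; Js# = trans eq (cong (_+ _) o≡0) ; Js⊑ = λ k → k
    ; Js-pure = λ j∈ e ne → ⊥-elim (none (_ , _ , _ , bridge here e here (all-free _) (all-free _) ne [] , (j∈ ∷⊑ ∈-[]) , [] ∷ []))
    ; h = 0 ; S = λ () ; valid = λ () ; only = λ () ; verts-disjoint = λ { {()} } ; cols-disjoint = λ { {()} }
    ; cover = λ ¬f → ⊥-elim (¬f (all-free _)) ; cols⊑ = λ () ; Js∩cols = λ { {()} } ; palette = inj₁
    ; total = trans eq (trans (cong (_+ _) o≡0) (sym (ℕ.+-identityʳ _))) }
    where
    open Alternating 𝒮 using (Free; Free?; Rainbow; bridge; covered-∈; here; mate; mate-injective; mate²; order)
    all-free : ∀ v → Free v
    all-free v with Free? v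
    ... | yes f = f
    ... | no ¬f with subst (_ ≤_) o≡0 (length-⊆ {xs = v ∷ []} ([] ∷ []) (covered-∈ ¬f ∷⊑ ∈-[]))
    ... | ()

  decomposition-below : ∀ f (𝒮 : System n m) → Alternating.order 𝒮 < f → ∀ {t cs} → Unique cs → Alternating.Rich 𝒮 t cs →
                        ¬ Alternating.Rainbow 𝒮 cs → length cs ≡ Alternating.order 𝒮 + t → Decomposition 𝒮 cs t
  decomposition-below (suc f) 𝒮 o<f {t} {cs} cs! rich none eq with Alternating.order 𝒮 ℕ.≟ 0
  ... | yes o≡0 = unmatched 𝒮 cs! none eq o≡0
  ... | no o≢0 with Growth.outcome 𝒮 cs! rich (ℕ.≤-reflexive (sym eq)) (subst (t <_) (sym eq) (ℕ.m<n+m t (ℕ.n≢0⇒n>0 o≢0))) (λ 𝒯 _ → greedy 𝒯)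
  ... | rainbow R       = ⊥-elim (none R)
  -- The blossom has fewer colours than covered vertices, which makes up for the equality in the
  -- count.
  ... | blossom B es⊑ l = ⊥-elim (none (contract-greedy B es⊑ cs! rich (ℕ.+-mono-≤-< (ℕ.≤-reflexive (sym eq)) l) (greedy _)))
  ... | triangle T      = decompose (setup (decomposition-below f _ smaller ds! rich/ none/ (tight eq)))
    where
    open FromTriangle T cs! rich none using (Oriented; S; cols⁻; c∉ds; ds!; ds⊑; d∉ds; length-2; lies-π; none/; order-2; oriented; rich/; setup; tight; verts⁻; weight≡; zs∉; π; π-lies; π-∉; σ)
    smaller : _ < f
    smaller = ℕ.<-≤-trans (ℕ.m<m+n _ (s≤s z≤n)) (ℕ.≤-trans order-2 (ℕ.≤-pred o<f))

-- Graphs with a matching as systems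

lookup-injective : {X : Set} {xs : List X} → Unique xs → ∀ {i j} → lookup xs i ≡ lookup xs j → i ≡ j
lookup-injective {xs = x ∷ xs} (a ∷ u) {zero}  {zero}  e = refl
lookup-injective {xs = x ∷ xs} (a ∷ u) {zero}  {suc j} e = ⊥-elim (All.lookup a (∈.∈-lookup j) e)
lookup-injective {xs = x ∷ xs} (a ∷ u) {suc i} {zero}  e = ⊥-elim (All.lookup a (∈.∈-lookup i) (sym e))
lookup-injective {xs = x ∷ xs} (a ∷ u) {suc i} {suc j} e = cong suc (lookup-injective u e)

∈ₑ-sym : ∀ {n} {S : EdgeSet n} {a b} → (a , b) ∈ₑ S → (b , a) ∈ₑ S
∈ₑ-sym (inj₁ e) = inj₂ e
∈ₑ-sym (inj₂ e) = inj₁ e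

module Encoding {n m k : ℕ} (G : Graph n) (F : EdgeSet n) (A : Fin m → EdgeSet n)
                (matching : IsMatching G F) (size : HasSize F k) (A⊆E : ∀ j → A j ⊆ₑ E G) where

  private
    V = Fin n

  F⊆E : F ⊆ₑ E G
  F⊆E = proj₁ matching

  F-unique : ∀ {x y z} → (x , y) ∈ₑ F → (x , z) ∈ₑ F → y ≡ z
  F-unique = proj₂ matching _ _ _

  es : Fin k → V × V
  es = proj₁ size

  es∈F : ∀ r → (proj₁ (es r) , proj₂ (es r)) ∈ₑ F
  es∈F = proj₁ (proj₂ size)

  es-complete : ∀ {x y} → (x , y) ∈ₑ F → ∃[ r ] (es r ≈ₑ (x , y))
  es-complete = proj₂ (proj₂ (proj₂ size)) _ _

  EndOf : V → Fin k → Set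
  EndOf v r = v ≡ proj₁ (es r) ⊎ v ≡ proj₂ (es r)

  end? : ∀ v r → Dec (EndOf v r)
  end? v r = (v Fin.≟ proj₁ (es r)) ⊎-dec (v Fin.≟ proj₂ (es r))

  -- Membership in `F` is an arbitrary proposition; the enumeration of the k edges is what makes the
  -- partner of a vertex computable.
  mate₀ : V → V
  mate₀ v with Fin.any? (end? v)
  ... | yes (r , inj₁ _) = proj₂ (es r)
  ... | yes (r , inj₂ _) = proj₁ (es r)
  ... | no _             = v

  mate-spec : ∀ v → (v , mate₀ v) ∈ₑ F ⊎ (mate₀ v ≡ v × ¬ Covered F v)
  mate-spec v with Fin.any? (end? v)
  ... | yes (r , inj₁ refl) = inj₁ (es∈F r)
  ... | yes (r , inj₂ refl) = inj₁ (∈ₑ-sym {S = F} (es∈F r))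
  ... | no none             = inj₂ (refl , λ (w , f) → uncovered f)
    where
    uncovered : ∀ {w} → ¬ ((v , w) ∈ₑ F)
    uncovered f with es-complete f
    ... | r , inj₁ (e , _) = none (r , inj₁ (sym e))
    ... | r , inj₂ (_ , e) = none (r , inj₂ (sym e))

  F⇒mate : ∀ {v w} → (v , w) ∈ₑ F → mate₀ v ≡ w
  F⇒mate {v} f with mate-spec v
  ... | inj₁ f′       = F-unique f′ f
  ... | inj₂ (_ , ¬c) = ⊥-elim (¬c (_ , f))

  mate₀² : ∀ v → mate₀ (mate₀ v) ≡ v
  mate₀² v with mate-spec v
  ... | inj₁ f       = F⇒mate (∈ₑ-sym {S = F} f)
  ... | inj₂ (e , _) = trans (cong mate₀ e) e

  loop : ∀ {v} → ¬ ((v , v) ∈ₑ E G)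
  loop {v} = loopless G v

  mate⇒F : ∀ {v w} → mate₀ v ≡ w → v ≢ w → (v , w) ∈ₑ F
  mate⇒F {v} refl ne with mate-spec v
  ... | inj₁ f       = f
  ... | inj₂ (e , _) = ⊥-elim (ne (sym e))

  free⇒¬covered : ∀ {v} → mate₀ v ≡ v → ¬ Covered F v
  free⇒¬covered {v} e (w , f) = loop (F⊆E _ _ (subst (λ w → (v , w) ∈ₑ F) (trans (sym (F⇒mate f)) e) f))

  ¬covered⇒free : ∀ {v} → ¬ Covered F v → mate₀ v ≡ v
  ¬covered⇒free {v} ¬c with mate-spec v
  ... | inj₁ f       = ⊥-elim (¬c (_ , f))
  ... | inj₂ (e , _) = e

  𝒮 : System n m
  𝒮 = record { mate = mate₀ ; mate² = mate₀² ; edge = λ j a b → (a , b) ∈ₑ A j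
             ; edge-sym = λ {j} e → ∈ₑ-sym {S = A j} e }

  open Alternating 𝒮 using (Augmenting; AugmentingIn; Free; Rainbow; Rich; Walk; covered-∈; covered-∈⁻; coveredVertices; coveredVertices!; edge; edge-sym; here; mate; mate-injective; order; step; step-nonmatching; walk-covered)

  edge-≢ : ∀ {j a b} → edge j a b → a ≢ b
  edge-≢ {j} e refl = loop (A⊆E j _ _ e)

  endpoints : List (Fin k) → List V
  endpoints []       = []
  endpoints (r ∷ rs) = proj₁ (es r) ∷ proj₂ (es r) ∷ endpoints rs

  endpoints-length : ∀ rs → length (endpoints rs) ≡ 2 * length rs
  endpoints-length []       = refl
  endpoints-length (r ∷ rs) = cong suc (trans (cong suc (endpoints-length rs)) (sym (ℕ.+-suc (length rs) _)))

  endpoints-∈⁻ : ∀ {v} rs → v ∈ endpoints rs → ∃[ r ] (r ∈ rs × EndOf v r)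
  endpoints-∈⁻ (r ∷ rs) (here e)          = r , here refl , inj₁ e
  endpoints-∈⁻ (r ∷ rs) (there (here e))  = r , here refl , inj₂ e
  endpoints-∈⁻ (r ∷ rs) (there (there i)) = let s , j , e = endpoints-∈⁻ rs i in s , there j , e

  endpoints-∈ : ∀ {v r rs} → r ∈ rs → EndOf v r → v ∈ endpoints rs
  endpoints-∈ (here refl) (inj₁ e) = here e
  endpoints-∈ (here refl) (inj₂ e) = there (here e)
  endpoints-∈ (there i)   e        = there (there (endpoints-∈ i e))

  end-covered : ∀ {v r} → EndOf v r → ∃[ w ] ((v , w) ∈ₑ F × es r ≈ₑ (v , w))
  end-covered {r = r} (inj₁ refl) = _ , es∈F r , inj₁ (refl , refl)
  end-covered {r = r} (inj₂ refl) = _ , ∈ₑ-sym {S = F} (es∈F r) , inj₂ (refl , refl)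

  same-edge : ∀ {v r s} → EndOf v r → EndOf v s → r ≡ s
  same-edge {v} {r} {s} p q with end-covered p | end-covered q
  ... | w , f , e | w′ , f′ , e′ with F-unique f f′
  ... | refl = proj₁ (proj₂ (proj₂ size)) r s (join e e′)
    where
    join : ∀ {p q : V × V} {v w} → p ≈ₑ (v , w) → q ≈ₑ (v , w) → p ≈ₑ q
    join (inj₁ (refl , refl)) (inj₁ (refl , refl)) = inj₁ (refl , refl)
    join (inj₁ (refl , refl)) (inj₂ (refl , refl)) = inj₂ (refl , refl)
    join (inj₂ (refl , refl)) (inj₁ (refl , refl)) = inj₂ (refl , refl)
    join (inj₂ (refl , refl)) (inj₂ (refl , refl)) = inj₁ (refl , refl)

  endpoints! : ∀ {rs} → Unique rs → Unique (endpoints rs)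
  endpoints! [] = []
  endpoints! {r ∷ rs} u@(_ ∷ u′) = Unique-∷ first (Unique-∷ (λ i → old (inj₂ refl) i) (endpoints! u′))
    where
    old : ∀ {v} → EndOf v r → v ∉ endpoints rs
    old p i with endpoints-∈⁻ rs i
    ... | s , j , q with same-edge p q
    ... | refl = ∉-head u j
    first : proj₁ (es r) ∉ proj₂ (es r) ∷ endpoints rs
    first (here e)  = loop (subst (λ w → (proj₁ (es r) , w) ∈ₑ E G) (sym e) (F⊆E _ _ (es∈F r)))
    first (there i) = old (inj₁ refl) i

  order≡ : order ≡ 2 * k
  order≡ = trans (ℕ.≤-antisym (length-⊆ coveredVertices! below) (length-⊆ (endpoints! (Unique.allFin⁺ k)) above))
    (trans (endpoints-length (allFin k)) (cong (2 *_) (List.length-tabulate {n = k} (λ i → i))))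
    where
    below : ∀ {z} → z ∈ coveredVertices → z ∈ endpoints (allFin k)
    below {z} i with mate-spec z
    ... | inj₂ (e , _) = ⊥-elim (covered-∈⁻ i e)
    ... | inj₁ f with es-complete f
    ... | r , inj₁ (e , _) = endpoints-∈ (∈.∈-allFin r) (inj₁ (sym e))
    ... | r , inj₂ (_ , e) = endpoints-∈ (∈.∈-allFin r) (inj₂ (sym e))
    above : ∀ {z} → z ∈ endpoints (allFin k) → z ∈ coveredVertices
    above i with endpoints-∈⁻ (allFin k) i
    ... | r , _ , e = let w , f , _ = end-covered e in covered-∈ λ fr → free⇒¬covered fr (w , f)

  module FromAAP {ds : List (Fin m)} {r} (ι : Fin r → Fin m) (ι∈ : ∀ q → ι q ∈ ds) (P : AAP G F) (sub : P ⊆Path ⋃ₑ ι A) where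
    open AAP P

    x : V
    x = vs zero

    colour : ∀ {a b} → (a , b) ∈ₑ ⋃ₑ ι A → ∃[ j ] (j ∈ ds × (a , b) ∈ₑ A j)
    colour (inj₁ (q , e)) = ι q , ι∈ q , inj₁ e
    colour (inj₂ (q , e)) = ι q , ι∈ q , inj₂ e

    -- `ws` is the part of the path still to be read. Each round takes one edge outside `F` and the
    -- following edge of `F`, so that a round always starts with an edge outside `F`.
    build : ∀ ℓ (ws : Fin (suc (suc ℓ)) → V) {cs us} → Walk x (ws zero) cs us → cs ⊑ ds → Unique us →
            (∀ i j → ws i ≡ ws j → i ≡ j) → (∀ i → ws (suc i) ∉ us) → (∀ i → x ≢ ws (suc i)) →
            (∀ i → (ws (inject₁ i) , ws (suc i)) ∈ₑ ⋃ₑ ι A) →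
            (∀ (i : Fin ℓ) → let e = (ws (inject₁ (inject₁ i)) , ws (suc (inject₁ i))) ∈ₑ F
                                 f = (ws (inject₁ (suc i)) , ws (suc (suc i))) ∈ₑ F in
                             (e → ¬ f) × (¬ e → f)) →
            ¬ ((ws zero , ws (suc zero)) ∈ₑ F) → ¬ Covered F (ws (fromℕ (suc ℓ))) → AugmentingIn ds
    build zero ws w s us! inj out x≢ sub alt nF endF with colour (sub zero)
    ... | j , j∈ , e = x , ws (suc zero) , _ , record { colours = ↭-refl ; walk = w ; last = e
      ; x-free = ¬covered⇒free startFree ; y-free = ¬covered⇒free endF ; x≢y = x≢ zero ; simple = us! } ,
      λ { (here refl) → j∈ ; (there i) → s i }
    -- With two edges left the path would end with an edge of `F` at an uncovered vertex.
    build (suc zero) ws w s us! inj out x≢ sub alt nF endF =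
      ⊥-elim (endF (_ , ∈ₑ-sym {S = F} (proj₂ (alt zero) nF)))
    build (suc (suc ℓ)) ws {us = us} w s us! inj out x≢ sub alt nF endF with colour (sub zero)
    ... | j , j∈ , e = build ℓ (λ i → ws (suc (suc i))) (step w e (sym (F⇒mate (proj₂ (alt zero) nF))))
      (λ { (here refl) → j∈ ; (there i) → s i })
      (Unique-∷ (λ { (here e) → Fin.0≢1+n (Fin.suc-injective (inj _ _ e)) ; (there i) → out zero i }) (Unique-∷ (out (suc zero)) us!))
      (λ _ _ e → Fin.suc-injective (Fin.suc-injective (inj _ _ e)))
      (λ i → λ { (here e) → Fin.0≢1+n (Fin.suc-injective (sym (inj _ _ e)))
            ; (there (here e)) → Fin.0≢1+n (Fin.suc-injective (Fin.suc-injective (sym (inj _ _ e))))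
            ; (there (there k)) → out (suc (suc i)) k })
      (λ i → x≢ (suc (suc i))) (λ i → sub (suc (suc i))) (λ i → alt (suc (suc i)))
      (proj₁ (alt (suc zero)) (proj₂ (alt zero) nF)) endF

    augmenting : AugmentingIn ds
    augmenting = build len vs here (λ ()) [] (λ _ _ e → simple e) (λ _ ()) (λ i e → Fin.0≢1+n (simple e)) sub alternating
      (λ f → startFree (_ , f)) endFree

  -- The vertices z, p, … of a walk from r to p followed by the edge pz, in reverse order.
  steps : ∀ {r p cs vs} → Walk r p cs vs → ℕ
  steps here         = 0
  steps (step w _ _) = suc (suc (steps w))

  path : ∀ {r p cs vs} → V → (w : Walk r p cs vs) → Fin (suc (suc (steps w))) → V
  path     z w                              zero          = z
  path {r} z here                           (suc zero)    = r
  path     z (step {q′ = q′} w _ _)         (suc zero)    = q′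
  path     z (step {q = q} w _ _)           (suc (suc i)) = path q w i

  path-end : ∀ {r p cs vs z} (w : Walk r p cs vs) → path z w (fromℕ (suc (steps w))) ≡ r
  path-end here         = refl
  path-end (step w _ _) = path-end w

  path-1 : ∀ {r p cs vs z} (w : Walk r p cs vs) → path z w (suc zero) ≡ p
  path-1 here            = refl
  path-1 (step w _ refl) = refl

  path-∈ : ∀ {r p cs vs z} (w : Walk r p cs vs) i → path z w i ≡ z ⊎ path z w i ∈ r ∷ vs
  path-∈ w            zero       = inj₁ refl
  path-∈ here         (suc zero) = inj₂ (here refl)
  path-∈ (step w _ _) (suc zero) = inj₂ (there (there (here refl)))
  path-∈ (step w _ _) (suc (suc i)) with path-∈ w i
  ... | inj₁ e         = inj₂ (there (here e))
  ... | inj₂ (here e)  = inj₂ (here e)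
  ... | inj₂ (there k) = inj₂ (there (there (there k)))

  path-injective : ∀ {r p cs vs z} (w : Walk r p cs vs) → Free r → Unique vs → z ∉ r ∷ vs →
                   ∀ i j → path z w i ≡ path z w j → i ≡ j
  path-injective {r} {z = z} w f u z∉ = go w u z∉
    where
    go : ∀ {p cs vs z} (w : Walk r p cs vs) → Unique vs → z ∉ r ∷ vs → ∀ i j → path z w i ≡ path z w j → i ≡ j
    tail-≢ : ∀ {p cs vs z} (w : Walk r p cs vs) → Unique vs → z ∉ r ∷ vs → ∀ i → path z w (suc i) ≢ z
    tail-≢ here         u z∉ zero    e = z∉ (here (sym e))
    tail-≢ (step w _ _) u z∉ zero    e = z∉ (there (there (here (sym e))))
    tail-≢ (step w _ _) u z∉ (suc i) e with path-∈ w i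
    ... | inj₁ k         = z∉ (there (here (trans (sym e) k)))
    ... | inj₂ (here k)  = z∉ (here (trans (sym e) k))
    ... | inj₂ (there k) = z∉ (there (there (there (subst (_∈ _) e k))))
    second-≢ : ∀ {p q cs vs c} (w : Walk r p cs vs) → Unique (q ∷ mate q ∷ vs) → edge c p q → ∀ i → path q w i ≢ mate q
    second-≢ w ((a ∷ _) ∷ b ∷ _) e i k with path-∈ w i
    ... | inj₁ l         = a (trans (sym l) k)
    ... | inj₂ (here l)  = a (mate-injective (trans (trans (sym k) l) (trans (sym f) (cong mate (trans (sym l) k)))))
    ... | inj₂ (there l) = All.lookup b (subst (_∈ _) k l) refl
    go w u z∉ zero zero _ = refl
    go w u z∉ zero (suc j) e = ⊥-elim (tail-≢ w u z∉ j (sym e))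
    go w u z∉ (suc i) zero e = ⊥-elim (tail-≢ w u z∉ i e)
    go here u z∉ (suc zero) (suc zero) e = refl
    go (step w _ _) u z∉ (suc zero) (suc zero) e = refl
    go (step w e′ refl) u z∉ (suc zero) (suc (suc j)) e = ⊥-elim (second-≢ w u e′ j (sym e))
    go (step w e′ refl) u z∉ (suc (suc i)) (suc zero) e = ⊥-elim (second-≢ w u e′ i e)
    go (step {q = q} w e′ refl) ((a ∷ a′) ∷ b ∷ u) z∉ (suc (suc i)) (suc (suc j)) e =
      cong (λ k → suc (suc k)) (go w u (λ { (here refl) → a (sym f) ; (there k) → All.lookup a′ k refl }) i j e)

  Off-F : V → V → Set
  Off-F a b = ¬ ((a , b) ∈ₑ F)

  module _ {r : V} (f : Free r) where

    step-off : ∀ {p q cs vs} → Walk r p cs vs → Unique (q ∷ mate q ∷ vs) → Off-F q p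
    step-off w u k = step-nonmatching w f refl u (sym (F⇒mate (∈ₑ-sym {S = F} k)))

    matched : ∀ {p q cs vs} (w : Walk r p cs vs) → Unique (q ∷ mate q ∷ vs) → (mate q , q) ∈ₑ F
    matched w ((a ∷ _) ∷ _) = ∈ₑ-sym {S = F} (mate⇒F refl a)

    path-in-G : ∀ {p cs vs z c} (w : Walk r p cs vs) → edge c p z → Unique vs →
                ∀ i → (path z w (inject₁ i) , path z w (suc i)) ∈ₑ E G
    path-in-G {z = z} {c} w e u zero = subst (λ p → (z , p) ∈ₑ E G) (sym (path-1 w)) (A⊆E c _ _ (edge-sym e))
    path-in-G (step w e′ refl) e u (suc zero) = F⊆E _ _ (matched w u)
    path-in-G (step w e′ refl) e (_ ∷ _ ∷ u) (suc (suc i)) = path-in-G w e′ u i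

    first-off : ∀ {p cs vs z} (w : Walk r p cs vs) → Off-F z p → Off-F (path z w zero) (path z w (suc zero))
    first-off {z = z} w o = subst (Off-F z) (sym (path-1 w)) o

    path-alternating : ∀ {p cs vs z} (w : Walk r p cs vs) → Unique vs → Off-F z p → ∀ (i : Fin (steps w)) →
      let e = (path z w (inject₁ (inject₁ i)) , path z w (suc (inject₁ i))) ∈ₑ F
          f = (path z w (inject₁ (suc i)) , path z w (suc (suc i))) ∈ₑ F in
      (e → ¬ f) × (¬ e → f)
    path-alternating w@(step w′ e refl) u o zero = (λ k → ⊥-elim (first-off w o k)) , λ _ → matched w′ u
    path-alternating (step w e refl) u o (suc zero) =
      (λ _ → first-off w (step-off w u)) , λ k → ⊥-elim (k (matched w u))
    path-alternating (step w e refl) u@(_ ∷ _ ∷ u′) o (suc (suc i)) = path-alternating w u′ (step-off w u) i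

    -- `IsRainbow` asks for an index at every position; at a matching edge the colour of the
    -- preceding edge serves as default.
    colouring : ∀ {p cs vs} → Fin m → (w : Walk r p cs vs) → Fin (suc (steps w)) → Fin m
    colouring c w                  zero          = c
    colouring c (step w _ _)       (suc zero)    = c
    colouring c (step {c = c′} w _ _) (suc (suc i)) = colouring c′ w i

    colouring-∈ : ∀ {p cs vs c} (w : Walk r p cs vs) i → colouring c w i ∈ c ∷ cs
    colouring-∈ w            zero          = here refl
    colouring-∈ (step w _ _) (suc zero)    = here refl
    colouring-∈ (step w _ _) (suc (suc i)) = there (colouring-∈ w i)

    colouring-edge : ∀ {p cs vs z c} (w : Walk r p cs vs) → edge c p z → Unique vs →
      ∀ i → Off-F (path z w (inject₁ i)) (path z w (suc i)) →
      (path z w (inject₁ i) , path z w (suc i)) ∈ₑ A (colouring c w i)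
    colouring-edge {z = z} {c} w e u zero _ = subst (λ p → (z , p) ∈ₑ A c) (sym (path-1 w)) (edge-sym e)
    colouring-edge (step w _ refl) e u (suc zero) o = ⊥-elim (o (matched w u))
    colouring-edge (step w e′ refl) e (_ ∷ _ ∷ u) (suc (suc i)) o = colouring-edge w e′ u i o

    colouring-injective : ∀ {p cs vs z c} (w : Walk r p cs vs) → Unique vs → Unique (c ∷ cs) →
      ∀ i j → Off-F (path z w (inject₁ i)) (path z w (suc i)) → Off-F (path z w (inject₁ j)) (path z w (suc j)) →
      colouring c w i ≡ colouring c w j → i ≡ j
    colouring-injective w u d zero zero _ _ _ = refl
    colouring-injective (step w _ refl) u d (suc zero) j o _ _ = ⊥-elim (o (matched w u))
    colouring-injective (step w _ refl) u d zero (suc zero) _ o _ = ⊥-elim (o (matched w u))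
    colouring-injective (step w _ refl) u d (suc (suc i)) (suc zero) _ o _ = ⊥-elim (o (matched w u))
    colouring-injective (step w _ refl) u d zero (suc (suc j)) _ _ e = ⊥-elim (∉-head d (subst (_∈ _) (sym e) (colouring-∈ w j)))
    colouring-injective (step w _ refl) u d (suc (suc i)) zero _ _ e = ⊥-elim (∉-head d (subst (_∈ _) e (colouring-∈ w i)))
    colouring-injective (step w _ refl) (_ ∷ _ ∷ u) (_ ∷ d) (suc (suc i)) (suc (suc j)) o o′ e =
      cong (λ k → suc (suc k)) (colouring-injective w u d i j o o′ e)

  realise : ∀ {cs} → Rainbow cs → Σ (AAP G F) λ P → IsRainbow A P
  realise (x , y , fs , P , _ , fs!) = record
    { len = steps walk ; vs = path y walk ; simple = λ {i} {j} → path-injective walk x-free simple y∉ i j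
    ; inG = path-in-G x-free walk last simple ; alternating = path-alternating x-free walk simple off
    ; startFree = free⇒¬covered y-free ; endFree = λ k → free⇒¬covered x-free (subst (Covered F) (path-end walk) k) } ,
    colouring x-free c walk , colouring-edge x-free walk last simple ,
    colouring-injective x-free walk simple (Unique-↭ colours fs!)
    where
    open Augmenting P using (c; colours; cs; end; last; simple; vs; walk; x-free; x≢y; y-free)
    y∉ : y ∉ x ∷ vs
    y∉ (here e)  = x≢y (sym e)
    y∉ (there k) = walk-covered walk simple k y-free
    off : Off-F y end
    off k = free⇒¬covered y-free (_ , k)

  module _ (t : ℕ) (many : ∀ (ι : Fin (suc t) → Fin m) → Injective _≡_ _≡_ ι → Σ (AAP G F) λ P → P ⊆Path ⋃ₑ ι A) where

    rich-encoding : ∀ cs → Rich t cs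
    rich-encoding cs ds ds! _ l = FromAAP.augmenting ι (λ q → ∈.∈-lookup (inject≤ q l)) (proj₁ (many ι ι-inj)) (proj₂ (many ι ι-inj))
      where
      -- `ds` may have more than t + 1 entries; the first t + 1 are taken.
      ι : Fin (suc t) → Fin m
      ι q = lookup ds (inject≤ q l)
      ι-inj : Injective _≡_ _≡_ ι
      ι-inj {i} {j} e = Fin.inject≤-injective l l i j (lookup-injective ds! e)

-- From decompositions to generalized badges

module Links {n : ℕ} (mate : Fin n → Fin n) (mate² : ∀ v → mate (mate v) ≡ v)
             (f g : Fin n → Fin n) (fg : ∀ v → mate (g v) ≡ f v) where
  open Threads mate mate² using (Thread)

  private
    V = Fin n

  -- With `f` = `mate` and `g` the identity these are the edges of A(OS) except the first, written
  -- with indices as in `Badge`; with the two functions exchanged they are those of B(OS).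
  Link : V → List V → V → V → V → Set
  Link z us y a b = (∃[ i ] (a ≡ f (lookup (z ∷ us) (inject₁ i)) × b ≡ g (lookup (z ∷ us) (suc i))))
                  ⊎ (a ≡ f (lookup (z ∷ us) (fromℕ (length us))) × b ≡ y)

  thread⇒link : ∀ {z} us {y a b} → Thread (f z) (map g us) y a b → Link z us y a b
  thread⇒link []       e        = inj₂ e
  thread⇒link (u ∷ us) (inj₁ e) = inj₁ (zero , e)
  thread⇒link (u ∷ us) {y} {a} {b} (inj₂ t) with thread⇒link us (subst (λ w → Thread w (map g us) y a b) (fg u) t)
  ... | inj₁ (i , e) = inj₁ (suc i , e)
  ... | inj₂ e       = inj₂ e

  link⇒thread : ∀ {z} us {y a b} → Link z us y a b → Thread (f z) (map g us) y a b
  link⇒thread []       (inj₂ e)           = e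
  link⇒thread (u ∷ us) (inj₁ (zero , e))  = inj₁ e
  link⇒thread (u ∷ us) {y} {a} {b} (inj₁ (suc i , e)) =
    inj₂ (subst (λ w → Thread w (map g us) y a b) (sym (fg u)) (link⇒thread us (inj₁ (i , e))))
  link⇒thread (u ∷ us) {y} {a} {b} (inj₂ e) =
    inj₂ (subst (λ w → Thread w (map g us) y a b) (sym (fg u)) (link⇒thread us (inj₂ e)))

count-list : ∀ {m} {sel : Fin m → Set} {js : List (Fin m)} → Unique js → (∀ {j} → j ∈ js → sel j) →
             (∀ {j} → sel j → j ∈ js) → CountIs sel (length js)
count-list {js = js} u f g = lookup js , lookup-injective u , (λ r → f (∈.∈-lookup r)) ,
  λ j s → index (g s) , sym (Any.lookup-index (g s))

nonempty : {X : Set} (xs : List X) → 0 < length xs → ∃[ x ] ∃[ xs′ ] xs ≡ x ∷ xs′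
nonempty (x ∷ xs) _ = x , xs , refl

module ToBadge {n m k t : ℕ} (G : Graph n) (F : EdgeSet n) (A : Fin m → EdgeSet n)
               (matching : IsMatching G F) (size : HasSize F k) (A⊆E : ∀ j → A j ⊆ₑ E G) where
  open Encoding G F A matching size A⊆E using (edge-≢; free⇒¬covered; mate⇒F; 𝒮)
  open Alternating 𝒮 using (Free; edge; edge-sym; mate; mate-injective; mate²)
  open Threads mate mate² using (Only; Thread; Valid; verts; verts-covered; verts-mate; verts-∈; verts-∈⁻)

  module _ (D : Decomposition 𝒮 (allFin m) t) where
    open Decomposition D using (Js; Js!; Js#; Js-pure; S; cols-disjoint; colsOf; cover; h; only; palette; total; valid; verts-disjoint; vertsOf)

    InF : Fin m → Set
    InF j = A j ⊆ₑ F

    Js⇒InF : ∀ {j} → j ∈ Js → InF j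
    Js⇒InF j∈ a b e = mate⇒F (sym (Js-pure j∈ e (edge-≢ e))) (edge-≢ e)

    src-off : ∀ {i j w} → edge j (Strip.src (S i)) w → ¬ InF j
    src-off {i} e sub = free⇒¬covered (Valid.src-free (valid i)) (_ , sub _ _ e)

    z₀ : Fin h → Fin n
    z₀ i = proj₁ (nonempty (Strip.us (S i)) (Valid.0<us (valid i)))

    us₀ : Fin h → List (Fin n)
    us₀ i = proj₁ (proj₂ (nonempty (Strip.us (S i)) (Valid.0<us (valid i))))

    us≡ : ∀ i → Strip.us (S i) ≡ z₀ i ∷ us₀ i
    us≡ i = proj₂ (proj₂ (nonempty (Strip.us (S i)) (Valid.0<us (valid i))))

    module LA = Links mate mate² mate (λ v → v) (λ _ → refl) using (Link; link⇒thread; thread⇒link)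
    module LB = Links mate mate² (λ v → v) mate mate² using (Link; link⇒thread; thread⇒link)

    source target : Fin h → Fin n
    source i = Strip.src (S i)
    target i = Strip.tgt (S i)

    A-thread : Fin h → Fin n → Fin n → Set
    A-thread i = Thread (source i) (Strip.us (S i)) (target i)

    B-thread : Fin h → Fin n → Fin n → Set
    B-thread i = Thread (source i) (map mate (Strip.us (S i))) (target i)

    A-split : ∀ i {a b} → A-thread i a b → (a ≡ source i × b ≡ z₀ i) ⊎ LA.Link (z₀ i) (us₀ i) (target i) a b
    A-split i {a} {b} th with subst (λ l → Thread (source i) l (target i) a b) (us≡ i) th
    ... | inj₁ e  = inj₁ e
    ... | inj₂ t′ = inj₂ (LA.thread⇒link (us₀ i) (subst (λ l → Thread (mate (z₀ i)) l (target i) a b) (sym (List.map-id (us₀ i))) t′))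

    A-join : ∀ i {a b} → (a ≡ source i × b ≡ z₀ i) ⊎ LA.Link (z₀ i) (us₀ i) (target i) a b → A-thread i a b
    A-join i {a} {b} l = subst (λ l → Thread (source i) l (target i) a b) (sym (us≡ i)) (go l)
      where
      go : (a ≡ source i × b ≡ z₀ i) ⊎ LA.Link (z₀ i) (us₀ i) (target i) a b → Thread (source i) (z₀ i ∷ us₀ i) (target i) a b
      go (inj₁ e) = inj₁ e
      go (inj₂ e) = inj₂ (subst (λ l → Thread (mate (z₀ i)) l (target i) a b) (List.map-id (us₀ i)) (LA.link⇒thread (us₀ i) e))

    B-split : ∀ i {a b} → B-thread i a b → (a ≡ source i × b ≡ mate (z₀ i)) ⊎ LB.Link (z₀ i) (us₀ i) (target i) a b
    B-split i {a} {b} th with subst (λ l → Thread (source i) (map mate l) (target i) a b) (us≡ i) th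
    ... | inj₁ e  = inj₁ e
    ... | inj₂ t′ = inj₂ (LB.thread⇒link (us₀ i) (subst (λ w → Thread w (map mate (us₀ i)) (target i) a b) (mate² (z₀ i)) t′))

    B-join : ∀ i {a b} → (a ≡ source i × b ≡ mate (z₀ i)) ⊎ LB.Link (z₀ i) (us₀ i) (target i) a b → B-thread i a b
    B-join i {a} {b} l = subst (λ l → Thread (source i) (map mate l) (target i) a b) (sym (us≡ i)) (go l)
      where
      go : (a ≡ source i × b ≡ mate (z₀ i)) ⊎ LB.Link (z₀ i) (us₀ i) (target i) a b →
           Thread (source i) (map mate (z₀ i ∷ us₀ i)) (target i) a b
      go (inj₁ e) = inj₁ e
      go (inj₂ e) = inj₂ (subst (λ w → Thread w (map mate (us₀ i)) (target i) a b) (sym (mate² (z₀ i))) (LB.link⇒thread (us₀ i) e))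

    -- Its thread starts with an edge at the source of the strip, which `F` does not cover.
    cols⇒¬InF : ∀ {i j} → j ∈ colsOf i → ¬ InF j
    cols⇒¬InF {i} k with ∈.∈-++⁻ (Strip.as (S i)) k
    ... | inj₁ l = src-off {i} (Valid.A-edges (valid i) l (A-join i (inj₁ (refl , refl))))
    ... | inj₂ l = src-off {i} (Valid.B-edges (valid i) l (B-join i (inj₁ (refl , refl))))

    InF⇒Js : ∀ {j} → InF j → j ∈ Js
    InF⇒Js {j} sub with palette (∈.∈-allFin j)
    ... | inj₁ k       = k
    ... | inj₂ (i , k) = ⊥-elim (cols⇒¬InF {i} k sub)

    ¬InF⇒cols : ∀ {j} → ¬ InF j → ∃[ i ] j ∈ colsOf i
    ¬InF⇒cols {j} ¬sub with palette (∈.∈-allFin j)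
    ... | inj₁ k = ⊥-elim (¬sub (Js⇒InF k))
    ... | inj₂ p = p

    count : CountIs InF t
    count = subst (CountIs InF) Js# (count-list Js! Js⇒InF InF⇒Js)

    weight₀ : Fin h → ℕ
    weight₀ i = suc (length (us₀ i))

    u′ v′ : (i : Fin h) → Fin (weight₀ i) → Fin n
    u′ i r = lookup (z₀ i ∷ us₀ i) r
    v′ i r = mate (u′ i r)

    us₀! : ∀ i → Unique (verts (z₀ i ∷ us₀ i))
    us₀! i = subst (λ l → Unique (verts l)) (us≡ i) (Valid.verts! (valid i))

    in-verts : ∀ i {w} → w ∈ z₀ i ∷ us₀ i → w ∈ vertsOf i
    in-verts i k = verts-∈ (subst (_ ∈_) (sym (us≡ i)) k)

    u∈ : ∀ i r → u′ i r ∈ vertsOf i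
    u∈ i r = in-verts i (∈.∈-lookup r)

    v∈ : ∀ i r → v′ i r ∈ vertsOf i
    v∈ i r = verts-mate (u∈ i r)

    side : (i : Fin h) → Bool → Fin (weight₀ i) → Fin n
    side i true  = u′ i
    side i false = v′ i

    side∈ : ∀ i b r → side i b r ∈ vertsOf i
    side∈ i true  = u∈ i
    side∈ i false = v∈ i

    lookup-us! : ∀ i → Unique (z₀ i ∷ us₀ i)
    lookup-us! i = distinct (us₀! i)
      where
      distinct : ∀ {us} → Unique (verts us) → Unique us
      distinct {[]}     _           = []
      distinct {u ∷ us} (a ∷ _ ∷ w) = Unique-∷ (λ k → All.lookup a (there (verts-∈ k)) refl) (distinct w)

    opposite : ∀ i r s → u′ i r ≢ v′ i s
    opposite i r s e = Following.mate-∉ mate mate² (us₀! i) (∈.∈-lookup s) (subst (_∈ z₀ i ∷ us₀ i) e (∈.∈-lookup r))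

    side-injective : ∀ i b b′ r r′ → side i b r ≡ side i b′ r′ → (b , r) ≡ (b′ , r′)
    side-injective i true  true  r r′ e = cong (true ,_) (lookup-injective (lookup-us! i) e)
    side-injective i false false r r′ e = cong (false ,_) (lookup-injective (lookup-us! i) (mate-injective e))
    side-injective i true  false r r′ e = ⊥-elim (opposite i r r′ e)
    side-injective i false true  r r′ e = ⊥-elim (opposite i r′ r (sym e))

    interior₀ : (Σ (Fin h) λ e → Bool × Fin (weight₀ e)) → Fin n
    interior₀ p = if proj₁ (proj₂ p) then u′ (proj₁ p) (proj₂ (proj₂ p)) else v′ (proj₁ p) (proj₂ (proj₂ p))

    interior≡ : ∀ i b r → interior₀ (i , b , r) ≡ side i b r
    interior≡ i true  r = refl
    interior≡ i false r = refl

    interior∈ : ∀ i b r → interior₀ (i , b , r) ∈ vertsOf i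
    interior∈ i b r = subst (_∈ vertsOf i) (sym (interior≡ i b r)) (side∈ i b r)

    interior-injective : Injective _≡_ _≡_ interior₀
    interior-injective {i , b , r} {i′ , b′ , r′} e
      with verts-disjoint (interior∈ i b r) (subst (_∈ vertsOf i′) (sym e) (interior∈ i′ b′ r′))
    ... | refl = cong (i ,_) (side-injective i b b′ r r′ (trans (sym (interior≡ i b r)) (trans e (interior≡ i b′ r′))))

    badge : Badge n
    badge = record
      { h = h ; ends = λ i → source i , target i ; loopless = λ i → Valid.src≢tgt (valid i) ; w₀ = λ i → length (us₀ i)
      ; u = u′ ; v = v′ ; interiorDistinct = interior-injective
      ; interiorOutside = λ (i , b , r) i′ →
          (λ e → outside i b r (trans (cong mate e) (trans (Valid.src-free (valid i′)) (sym e)))) ,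
          (λ e → outside i b r (trans (cong mate e) (trans (Valid.tgt-free (valid i′)) (sym e)))) }
      where
      outside : ∀ i b r → ¬ Free (interior₀ (i , b , r))
      outside i b r = verts-covered (Valid.verts! (valid i)) (interior∈ i b r)

    private module 𝓑 = Badge badge

    badge-size : m ≡ 2 * k + t → 𝓑.size ≡ k
    badge-size m≡ = ℕ.*-cancelˡ-≡ _ k 2 (ℕ.+-cancelʳ-≡ t _ _ (begin
      2 * 𝓑.size + t             ≡⟨ cong (λ w → 2 * w + t) (cong sum (List.map-cong (λ i → sym (cong length (us≡ i))) (allFin h))) ⟩
      2 * weight S + t           ≡⟨ solve 2 (λ w t → con 2 :* w :+ t := t :+ (w :+ w)) refl (weight S) t ⟩
      t + (weight S + weight S)  ≡⟨ sym total ⟩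
      length (allFin m)          ≡⟨ List.length-tabulate {n = m} (λ i → i) ⟩
      m                          ≡⟨ m≡ ⟩
      2 * k + t                  ∎))
      where open ≡-Reasoning

    as≡ : ∀ i → length (Strip.as (S i)) ≡ weight₀ i
    as≡ i = trans (Valid.as# (valid i)) (cong length (us≡ i))

    bs≡ : ∀ i → length (Strip.bs (S i)) ≡ weight₀ i
    bs≡ i = trans (Valid.bs# (valid i)) (cong length (us≡ i))

    β : 𝓑.Index → Fin m
    β (i , true  , r) = lookup (Strip.as (S i)) (cast (sym (as≡ i)) r)
    β (i , false , r) = lookup (Strip.bs (S i)) (cast (sym (bs≡ i)) r)

    as! : ∀ i → Unique (Strip.as (S i))
    as! i = proj₁ (Unique-++⁻ (Strip.as (S i)) (Valid.cols! (valid i)))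

    bs! : ∀ i → Unique (Strip.bs (S i))
    bs! i = proj₁ (proj₂ (Unique-++⁻ (Strip.as (S i)) (Valid.cols! (valid i))))

    as∩bs : ∀ i {e} → e ∈ Strip.as (S i) → e ∉ Strip.bs (S i)
    as∩bs i = proj₂ (proj₂ (Unique-++⁻ (Strip.as (S i)) (Valid.cols! (valid i))))

    β∈ : ∀ p → β p ∈ colsOf (proj₁ p)
    β∈ (i , true  , r) = ∈.∈-++⁺ˡ (∈.∈-lookup {xs = Strip.as (S i)} _)
    β∈ (i , false , r) = ∈.∈-++⁺ʳ (Strip.as (S i)) (∈.∈-lookup {xs = Strip.bs (S i)} _)

    cast-injective : ∀ {p q} (e : p ≡ q) {r s : Fin p} → cast e r ≡ cast e s → r ≡ s
    cast-injective e {r} {s} k = trans (sym (Fin.cast-involutive (sym e) e r)) (trans (cong (cast (sym e)) k) (Fin.cast-involutive (sym e) e s))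

    β-injective : Injective _≡_ _≡_ β
    β-injective {p} {q} e with cols-disjoint {proj₁ p} {proj₁ q} (β∈ p) (subst (_∈ colsOf (proj₁ q)) (sym e) (β∈ q))
    β-injective {i , true  , r} {_ , true  , s} e | refl = cong (λ r → i , true , r) (cast-injective (sym (as≡ i)) (lookup-injective (as! i) e))
    β-injective {i , false , r} {_ , false , s} e | refl = cong (λ r → i , false , r) (cast-injective (sym (bs≡ i)) (lookup-injective (bs! i) e))
    β-injective {i , true  , r} {_ , false , s} e | refl =
      ⊥-elim (as∩bs i (∈.∈-lookup {xs = Strip.as (S i)} _) (subst (_∈ Strip.bs (S i)) (sym e) (∈.∈-lookup {xs = Strip.bs (S i)} _)))
    β-injective {i , false , r} {_ , true  , s} e | refl =
      ⊥-elim (as∩bs i (∈.∈-lookup {xs = Strip.as (S i)} _) (subst (_∈ Strip.bs (S i)) e (∈.∈-lookup {xs = Strip.bs (S i)} _)))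

    β-onto : ∀ j → ¬ InF j → ∃[ p ] (β p ≡ j)
    β-onto j ¬sub with ¬InF⇒cols ¬sub
    ... | i , k with ∈.∈-++⁻ (Strip.as (S i)) k
    ... | inj₁ l = (i , true , cast (as≡ i) (index l)) ,
      trans (cong (lookup (Strip.as (S i))) (Fin.cast-involutive (sym (as≡ i)) (as≡ i) (index l))) (sym (Any.lookup-index l))
    ... | inj₂ l = (i , false , cast (bs≡ i) (index l)) ,
      trans (cong (lookup (Strip.bs (S i))) (Fin.cast-involutive (sym (bs≡ i)) (bs≡ i) (index l))) (sym (Any.lookup-index l))

    skeleton-mate : ∀ {a b} → 𝓑.skeleton a b → mate a ≡ b
    skeleton-mate (i , r , refl , refl) = refl

    skeleton-mate′ : ∀ {a b} → (a , b) ∈ₑ 𝓑.skeleton → mate a ≡ b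
    skeleton-mate′ (inj₁ k) = skeleton-mate k
    skeleton-mate′ (inj₂ k) = trans (cong mate (sym (skeleton-mate k))) (mate² _)

    mate-skeleton : ∀ {a b} → mate a ≡ b → a ≢ b → (a , b) ∈ₑ 𝓑.skeleton
    mate-skeleton {a} refl ne with cover {a} (λ f → ne (sym f))
    ... | i , k with verts-∈⁻ (Strip.us (S i)) k
    ... | inj₁ l = inj₁ (i , place l)
      where
      place : ∀ {w} → w ∈ Strip.us (S i) → ∃[ r ] (w ≡ u′ i r × mate w ≡ v′ i r)
      place {w} l with subst (w ∈_) (us≡ i) l
      ... | l′ = index l′ , Any.lookup-index l′ , cong mate (Any.lookup-index l′)
    ... | inj₂ l with subst (mate a ∈_) (us≡ i) l
    ... | l′ = inj₂ (i , index l′ , Any.lookup-index l′ , trans (sym (mate² a)) (cong mate (Any.lookup-index l′)))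

    Aₑ⇒thread : ∀ i {a b} → 𝓑.Aₑ i a b → A-thread i a b
    Aₑ⇒thread i (inj₁ e)        = A-join i (inj₁ e)
    Aₑ⇒thread i (inj₂ e)        = A-join i (inj₂ e)

    Bₑ⇒thread : ∀ i {a b} → 𝓑.Bₑ i a b → B-thread i a b
    Bₑ⇒thread i (inj₁ e)        = B-join i (inj₁ e)
    Bₑ⇒thread i (inj₂ e)        = B-join i (inj₂ e)

    member⇒edge : ∀ p {a b} → 𝓑.member p a b → ¬ ((a , b) ∈ₑ 𝓑.skeleton) → edge (β p) a b
    member⇒edge (i , true  , r) (inj₁ e) _ = Valid.A-edges (valid i) (∈.∈-lookup {xs = Strip.as (S i)} _) (Aₑ⇒thread i e)
    member⇒edge (i , false , r) (inj₁ e) _ = Valid.B-edges (valid i) (∈.∈-lookup {xs = Strip.bs (S i)} _) (Bₑ⇒thread i e)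
    member⇒edge (i , true  , r) (inj₂ e) k = ⊥-elim (k (inj₁ (i , e)))
    member⇒edge (i , false , r) (inj₂ e) k = ⊥-elim (k (inj₁ (i , e)))

    edge⇒member : ∀ p {a b} → edge (β p) a b → mate a ≢ b → (a , b) ∈ₑ 𝓑.member p
    edge⇒member (i , true , r) e nm with Only.A-only (only i) (∈.∈-lookup {xs = Strip.as (S i)} _) e (edge-≢ e) (λ k → nm (sym k))
    ... | inj₁ th = inj₁ (inj₁ (A-split i th))
    ... | inj₂ th = inj₂ (inj₁ (A-split i th))
    edge⇒member (i , false , r) e nm with Only.B-only (only i) (∈.∈-lookup {xs = Strip.bs (S i)} _) e (edge-≢ e) (λ k → nm (sym k))
    ... | inj₁ th = inj₁ (inj₁ (B-split i th))
    ... | inj₂ th = inj₂ (inj₁ (B-split i th))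

    -- Deleting the whole skeleton and restoring the part contained in A (β p) spares a
    -- decision which skeleton edges belong to A (β p).
    added : 𝓑.Index → EdgeSet n
    added p a b = 𝓑.skeleton a b × (a , b) ∈ₑ A (β p)

    forth : ∀ p → A (β p) ⊆ₑ ((𝓑.member p ∖ₑ 𝓑.skeleton) ∪ₑ added p)
    forth p a b e with mate a Fin.≟ b
    ... | yes eq with mate-skeleton eq (edge-≢ e)
    ... | inj₁ k = inj₁ (inj₂ (k , e))
    ... | inj₂ k = inj₂ (inj₂ (k , edge-sym {β p} e))
    forth p a b e | no nm with edge⇒member p e nm
    ... | inj₁ k = inj₁ (inj₁ (k , λ s → nm (skeleton-mate′ s)))
    ... | inj₂ k = inj₂ (inj₁ (k , λ s → nm (skeleton-mate′ (∈ₑ-sym {S = 𝓑.skeleton} s))))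

    back : ∀ p → ((𝓑.member p ∖ₑ 𝓑.skeleton) ∪ₑ added p) ⊆ₑ A (β p)
    back p a b (inj₁ (inj₁ (k , ns))) = member⇒edge p k ns
    back p a b (inj₁ (inj₂ (_ , e)))  = e
    back p a b (inj₂ (inj₁ (k , ns))) = edge-sym {β p} (member⇒edge p k ns)
    back p a b (inj₂ (inj₂ (_ , e)))  = edge-sym {β p} e

    gen-badge : m ≡ 2 * k + t → IsGenBadge k A (λ j → ¬ InF j)
    gen-badge m≡ = badge , badge-size m≡ , β , β-injective , (λ p → cols⇒¬InF {proj₁ p} (β∈ p)) , β-onto ,
      λ p → 𝓑.skeleton , added p , (λ _ _ k → k) ,
        (λ _ _ → λ { (inj₁ (k , _)) → inj₁ k ; (inj₂ (k , _)) → inj₂ k }) , forth p , back p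

theorem4p1 : ∀ {n} (G : Graph n) (F : EdgeSet n) (k t m : ℕ)
                 (A : Fin m → EdgeSet n) →
                 IsMatching G F →
                 HasSize F k →
                 (∀ j → A j ⊆ₑ E G) →
                 (∀ (ι : Fin (suc t) → Fin m) → Injective _≡_ _≡_ ι →
                    Σ (AAP G F) λ P → P ⊆Path ⋃ₑ ι A) →
                 ¬ (Σ (AAP G F) λ P → IsRainbow A P) →
                 (m ≤ 2 * k + t) ×
                 (m ≡ 2 * k + t →
                    CountIs (λ j → A j ⊆ₑ F) t ×
                    IsGenBadge k A (λ j → ¬ (A j ⊆ₑ F)))
theorem4p1 G F k t m A matching size A⊆E many none = bound , structure
  where
  open Encoding G F A matching size A⊆E using (edge-≢; order≡; realise; rich-encoding; 𝒮)
  open Alternating 𝒮 using (Rainbow; Rich; edge; edge-sym; mate)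
  cs = allFin m
  cs# : length cs ≡ m
  cs# = List.length-tabulate (λ i → i)
  rich : Rich t cs
  rich = rich-encoding t many cs
  no-rainbow : ¬ Rainbow cs
  no-rainbow R = none (realise R)
  bound : m ≤ 2 * k + t
  bound with (2 * k + t) ℕ.<? m
  ... | no ¬l = ℕ.≮⇒≥ ¬l
  ... | yes l = ⊥-elim (no-rainbow (greedy 𝒮 (Unique.allFin⁺ m) rich
      (subst₂ _<_ (cong (_+ t) (sym order≡)) (sym cs#) l)))
  structure : m ≡ 2 * k + t → CountIs (λ j → A j ⊆ₑ F) t × IsGenBadge k A (λ j → ¬ (A j ⊆ₑ F))
  structure m≡ = ToBadge.count G F A matching size A⊆E D , ToBadge.gen-badge G F A matching size A⊆E D m≡
    where
    D : Decomposition 𝒮 cs t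
    D = decomposition-below _ 𝒮 ℕ.≤-refl (Unique.allFin⁺ m) rich no-rainbow
      (trans cs# (trans m≡ (cong (_+ t) (sym order≡))))
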